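{- (1) Let $E_e$ and $\tilde E_e$ be the systems of edge vectors on $(\mathcal N,\mathcal O,\mathfrak l)$ and on $(\tilde{\mathcal N},\mathcal O,\mathfrak l)$ respectively, where $\tilde{\mathcal N}$ is obtained from $\mathcal N$ by moving one internal trivalent white vertex $V$ (vertex gauge transformation), with incoming edge $e_3$ and outgoing edges $e_1,e_2$. Let $\tilde e_i$ denote the edge $e_i$ after the move, let $f_i$ ($i=1,2$) be an edge outgoing at the end vertex of $e_i$, and let $f_3$ be an edge incoming at the initial vertex of $e_3$. Then $\tilde E_e=E_e$ for all $e\neq e_1,e_2,e_3$, and $$\tilde E_{e_i}=(-1)^{\mathrm{wind}(\tilde e_i,f_i)-\mathrm{wind}(e_i,f_i)+\mathrm{int}(\tilde e_i)-\mathrm{int}(e_i)}E_{e_i}\quad(i=1,2),\qquad \tilde E_{e_3}=(-1)^{\mathrm{wind}(f_3,\tilde e_3)-\mathrm{wind}(f_3,e_3)}E_{e_3}.$$ (2) Let instead $\tilde{\mathcal N}$ be obtained from $\mathcal N$ by moving one internal trivalent black vertex $V$ with outgoing edge $e_1$ and incoming edges $e_2,e_3$. Let $f_1$ be an edge outgoing at the end vertex of $e_1$ and $f_i$ ($i=2,3$) an edge incoming at the initial vertex of $e_i$. Then $\tilde E_e=E_e$ for all $e\neq e_1,e_2,e_3$, and $$\tilde E_{e_1}=(-1)^{\mathrm{wind}(\tilde e_1,f_1)-\mathrm{wind}(e_1,f_1)+\mathrm{int}(\tilde e_1)-\mathrm{int}(e_1)}E_{e_1},\qquad \tilde E_{e_i}=(-1)^{\mathrm{wind}(f_i,\tilde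 e_i)-\mathrm{wind}(f_i,e_i)}E_{e_i}\quad(i=2,3).$$
   Context: **Plabic networks.** Let $D$ be a closed convex disk whose boundary contains a straight segment. A plabic graph is a finite directed planar graph embedded in $D$ with straight edges. It has boundary vertices $b_1,\dots,b_n$ on the segment, labelled clockwise, each of degree 1 (a source if its edge is outgoing, a sink otherwise). The remaining (internal) vertices lie inside $D$ and have degree 2 or 3. No component is isolated from the boundary. The graph is perfect: each internal vertex has exactly one incoming edge (then it is white) or exactly one outgoing edge (then it is black); bivalent vertices have one incoming and one outgoing edge and either color. The orientation $\mathcal O$ is called a perfect orientation. A network $\mathcal N$ has a positive weight $w_e$ on each directed edge. **Gauge rays.** A gauge ray direction $\mathfrak l$ is an oriented direction, not parallel to any edge, such that the rays with direction $\mathfrak l$ starting at boundary vertices point inside $D$ and contain no internal vertices. The gauge rays are those starting at the boundary sources, and $\mathrm{int}(e)$ is the number of their intersections with $e$ (base points not counted). **Winding.** $s(a,b)=+1,0,-1$ if the ordered pair $(a,b)$ is positively oriented, parallel, negatively oriented. For consecutive directed edges: $\mathrm{wind}(e,f)=\pm1$ if $s(e,f)=s(e,\mathfrak l)=s(\mathfrak l,f)=\pm1$; otherwise $0$. **Edge vectors.** The edge vectors are the unique solution of $E_e=(-1)^{\mathrm{int}(e)}w_e\sum_f(-1)^{\mathrm{wind}(e,f)}E_f$ (for every edge $e$ ending at an internal vertex $V$, $f$ running over the edges outgoing at $V$), with $E_{e_j}=(-1)^{\mathrm{int}(e_j)}w_{e_j}E_j$ at the edge $e_j$ ending at the sink $b_j$,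 $E_j$ being the $j$-th canonical basis vector of $\mathbb R^n$. **Vertex gauge transformation.** A single internal vertex $V$ is moved continuously to a new position, all other vertices staying fixed, the graph remaining a straight-edge planar embedding throughout (the relative positions in the graph do not change) and the weights being unchanged. The direction $\mathfrak l$ is a gauge ray direction for both the initial and the final graph. If an edge $f_i$ does not exist because $e_i$ ends at a boundary sink or starts at a boundary source, the corresponding winding terms are omitted. -}

module Defs where

open import Level using (0ℓ)
open import Algebra.Bundles using (CommutativeRing)
open import Data.Bool.Base using (if_then_else_)
open import Data.Fin.Base as Fin using (Fin)
import Data.Fin.Properties as Fin
open import Data.Integer.Base as ℤ using (ℤ; 0ℤ; 1ℤ; -1ℤ; ∣_∣)
import Data.Integer.Properties as ℤ
open import Data.List.Base using (length; filter; allFin)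
open import Data.Nat.Base as ℕ using (ℕ)
open import Data.Product.Base using (_×_; _,_; ∃; ∃-syntax; proj₁; proj₂)
open import Data.Sum.Base using (_⊎_; inj₁; inj₂; [_,_])
import Data.Sum.Properties as Sum
open import Data.Vec.Functional using (Vector; updateAt)
open import Function.Base using (_∘_; const)
open import Relation.Binary.Construct.Closure.Equivalence using (EqClosure)
import Relation.Binary.Construct.StrictToNonStrict as NonStrict
open import Relation.Binary.Core using (Rel)
open import Relation.Binary.Definitions using (Decidable; DecidableEquality; tri<; tri≈; tri>)
open import Relation.Binary.PropositionalEquality.Core using (_≡_; _≢_)
open import Relation.Binary.Structures using (IsStrictTotalOrder)
open import Relation.Nullary.Decidable using (Dec; does; _×-dec_; map′)
open import Relation.Nullary.Negation using (¬_)

-- The standard library has no real numbers.  They are characterised up to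
-- isomorphism as the complete ordered field; results are stated for an
-- arbitrary one.

record CompleteOrderedField : Set₁ where
  field
    commutativeRing : CommutativeRing 0ℓ 0ℓ

  open CommutativeRing commutativeRing public

  infix 4 _<_

  field
    inverse            : ∀ {x} → ¬ (x ≈ 0#) → ∃[ y ] x * y ≈ 1#
    _<_                : Rel Carrier 0ℓ
    isStrictTotalOrder : IsStrictTotalOrder _≈_ _<_
    0<1                : 0# < 1#
    +-monoˡ-<          : ∀ z {x y} → x < y → x + z < y + z
    *-pos              : ∀ {x y} → 0# < x → 0# < y → 0# < x * y

  open IsStrictTotalOrder isStrictTotalOrder public
    using (compare; _<?_; <-respʳ-≈; <-respˡ-≈)
  open NonStrict _≈_ _<_ public using (_≤_)

  _≤?_ : Decidable _≤_
  _≤?_ = NonStrict.decidable′ _≈_ _<_ compare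

  IsUpperBound : (Carrier → Set) → Carrier → Set
  IsUpperBound P u = ∀ x → P x → x ≤ u

  IsSupremum : (Carrier → Set) → Carrier → Set
  IsSupremum P s = IsUpperBound P s × (∀ u → IsUpperBound P u → s ≤ u)

  field
    supremum : (P : Carrier → Set) → ∃ P → ∃ (IsUpperBound P) → ∃ (IsSupremum P)

data Colour : Set where
  white black : Colour

-- The combinatorial part of a plabic graph with n boundary vertices: `inj₁ i`
-- is the i-th boundary vertex, `inj₂ v` an internal one.

record PlabicGraph (n : ℕ) : Set where
  field
    #internal #edges : ℕ

  Internal : Set
  Internal = Fin #internal

  Vertex : Set
  Vertex = Fin n ⊎ Internal

  Edge : Set
  Edge = Fin #edges

  field
    source target : Edge → Vertex
    colour        : Internal → Colour

  infix 4 _≟ᵛ_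
  _≟ᵛ_ : DecidableEquality Vertex
  _≟ᵛ_ = Sum.≡-dec Fin._≟_ Fin._≟_

  indegree : Vertex → ℕ
  indegree v = length (filter (λ e → target e ≟ᵛ v) (allFin #edges))

  outdegree : Vertex → ℕ
  outdegree v = length (filter (λ e → source e ≟ᵛ v) (allFin #edges))

  degree : Vertex → ℕ
  degree v = indegree v ℕ.+ outdegree v

  Adjacent : Rel Vertex 0ℓ
  Adjacent u v = ∃[ e ] (source e ≡ u × target e ≡ v)

  field
    boundary-degree : ∀ i → degree (inj₁ i) ≡ 1
    internal-degree : ∀ v → degree (inj₂ v) ≡ 2 ⊎ degree (inj₂ v) ≡ 3
    white-perfect   : ∀ v → colour v ≡ white → indegree  (inj₂ v) ≡ 1
    black-perfect   : ∀ v → colour v ≡ black → outdegree (inj₂ v) ≡ 1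
    not-isolated    : ∀ v → ∃[ i ] EqClosure Adjacent (inj₂ v) (inj₁ i)

  IsBoundarySource : Fin n → Set
  IsBoundarySource i = ∃[ e ] source e ≡ inj₁ i

  isBoundarySource? : ∀ i → Dec (IsBoundarySource i)
  isBoundarySource? i = Fin.any? (λ e → source e ≟ᵛ inj₁ i)

module _ {n : ℕ} (G : PlabicGraph n) where
  open PlabicGraph G

  -- An edge f following (resp. preceding) e, or the fact that there is none
  -- because e ends (resp. starts) at the boundary.

  data Next (e : Edge) : Set where
    edge : ∀ f → source f ≡ target e → Next e
    none : ∀ i → target e ≡ inj₁ i → Next e

  data Prev (e : Edge) : Set where
    edge : ∀ f → target f ≡ source e → Prev e
    none : ∀ i → source e ≡ inj₁ i → Prev e

module Plabic (ℝ : CompleteOrderedField) where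

  open CompleteOrderedField ℝ public
  open import Algebra.Properties.Semiring.Exp semiring using (_^_)
  open import Algebra.Properties.CommutativeMonoid.Sum +-commutativeMonoid using (sum)

  -- Absolute values suffice: (-1)ᶻ depends only on the parity of z.
  -1^_ : ℤ → Carrier
  -1^ z = (- 1#) ^ ∣ z ∣

  ----------------------------------------------------------------------
  -- The plane

  Point : Set
  Point = Carrier × Carrier

  infix  4 _≈ₚ_
  infixl 6 _⊕_ _⊝_
  infixl 7 _•_

  _≈ₚ_ : Rel Point 0ℓ
  (x , y) ≈ₚ (x′ , y′) = x ≈ x′ × y ≈ y′

  _⊕_ _⊝_ : Point → Point → Point
  (x , y) ⊕ (x′ , y′) = x + x′ , y + y′
  (x , y) ⊝ (x′ , y′) = x - x′ , y - y′

  _•_ : Carrier → Point → Point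
  t • (x , y) = t * x , t * y

  cross : Point → Point → Carrier
  cross (x , y) (x′ , y′) = x * y′ - y * x′

  Parallel : Rel Point 0ℓ
  Parallel a b = cross a b ≈ 0#

  s : Point → Point → ℤ
  s a b with compare 0# (cross a b)
  ... | tri< _ _ _ = 1ℤ
  ... | tri≈ _ _ _ = 0ℤ
  ... | tri> _ _ _ = -1ℤ

  ∣_-_∣<_ : Carrier → Carrier → Carrier → Set
  ∣ x - y ∣< ε = x < y + ε × y < x + ε

  -- Closeness in the sup norm, which induces the usual topology.
  Near : Carrier → Rel Point 0ℓ
  Near ε (x , y) (x′ , y′) = ∣ x - x′ ∣< ε × ∣ y - y′ ∣< ε

  InUnit : Carrier → Set
  InUnit t = 0# ≤ t × t ≤ 1#

  OnSegment : Point → Point → Point → Set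
  OnSegment p q r = ∃[ t ] (InUnit t × r ≈ₚ p ⊕ t • (q ⊝ p))

  Interior : (Point → Set) → Point → Set
  Interior D p = ∃[ r ] (0# < r × (∀ q → Near r p q → D q))

  ContinuousOnUnit : (Carrier → Point) → Set
  ContinuousOnUnit γ = ∀ t → InUnit t → ∀ ε → 0# < ε →
    ∃[ δ ] (0# < δ × (∀ u → InUnit u → ∣ t - u ∣< δ → Near ε (γ t) (γ u)))

  -- A closed convex disk is a compact convex set with nonempty interior.  Its
  -- boundary segment is traversed clockwise, that is, with the interior on the
  -- right, from `start` to `end`.

  record Disk : Set₁ where
    field
      D          : Point → Set
      closed     : ∀ p → (∀ ε → 0# < ε → ∃[ q ] (D q × Near ε p q)) → D p
      bounded    : ∃[ r ] (∀ p → D p → Near r (0# , 0#) p)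
      convex     : ∀ p q r → D p → D q → OnSegment p q r → D r
      inhabited  : ∃ (Interior D)
      start end  : Point
      onBoundary : ∀ p → OnSegment start end p → D p × ¬ Interior D p
      clockwise  : ∀ p → Interior D p → s (end ⊝ start) (p ⊝ start) ≡ -1ℤ

  ----------------------------------------------------------------------
  -- Intersection of a ray with a segment

  -- The base point b of the ray is not counted, whence 0 < t.
  RayMeets : (b 𝔩 p q : Point) → Set
  RayMeets b 𝔩 p q = ∃[ t ] (0# < t × OnSegment p q (b ⊕ t • 𝔩))

  module RayIntersection where
    open import Algebra.Properties.Ring ring
    open import Algebra.Properties.AbelianGroup +-abelianGroup using (⁻¹-∙-comm; ⁻¹-involutive)
    open import Algebra.Properties.CommutativeSemigroup *-commutativeSemigroup
      using (xy∙z≈xz∙y)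
    import Algebra.Properties.CommutativeSemigroup +-commutativeSemigroup as +ˢ
    open import Relation.Binary.Reasoning.Setoid setoid

    sub-cong : ∀ {a b c d} → a ≈ b → c ≈ d → a - c ≈ b - d
    sub-cong p q = +-cong p (-‿cong q)

    neg-sub : ∀ a b → - (a - b) ≈ b - a
    neg-sub a b = begin
      - (a - b)      ≈⟨ ⁻¹-∙-comm a (- b) ⟨
      - a + - (- b)  ≈⟨ +-congˡ (⁻¹-involutive b) ⟩
      - a + b        ≈⟨ +-comm (- a) b ⟩
      b - a          ∎

    x-y+y : ∀ x y → x - y + y ≈ x
    x-y+y x y = trans (+-assoc x (- y) y) (trans (+-congˡ (-‿inverseˡ y)) (+-identityʳ x))

    telescope : ∀ a b c → (a - b) + (b - c) ≈ a - c
    telescope a b c = trans (sym (+-assoc (a - b) b (- c))) (+-congʳ (x-y+y a b))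

    cancelʳ : ∀ a b c → (a - b) - (c - b) ≈ a - c
    cancelʳ a b c = trans (+-congˡ (neg-sub c b)) (telescope a b c)

    cancelˡ : ∀ a b c → (a - b) - (a - c) ≈ c - b
    cancelˡ a b c = begin
      (a - b) - (a - c)  ≈⟨ +-congˡ (neg-sub a c) ⟩
      (a - b) + (c - a)  ≈⟨ +-comm (a - b) (c - a) ⟩
      (c - a) + (a - b)  ≈⟨ telescope c a b ⟩
      c - b              ∎

    solve-coord : ∀ b p u v → u - v ≈ p - b → b + u ≈ p + v
    solve-coord b p u v eq = begin
      b + u              ≈⟨ +-comm b u ⟩
      u + b              ≈⟨ +-congʳ (x-y+y u v) ⟨
      u - v + v + b      ≈⟨ +-congʳ (+-congʳ eq) ⟩
      p - b + v + b      ≈⟨ +ˢ.xy∙z≈xz∙y (p - b) v b ⟩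
      p - b + b + v      ≈⟨ +-congʳ (x-y+y p b) ⟩
      p + v              ∎

    unsolve-coord : ∀ b p u v → b + u ≈ p + v → p - b ≈ u - v
    unsolve-coord b p u v eq = begin
      p - b              ≈⟨ cancelʳ p (- v) b ⟨
      (p - - v) - (b - - v) ≈⟨ sub-cong (+-congˡ (⁻¹-involutive v)) (+-congˡ (⁻¹-involutive v)) ⟩
      (p + v) - (b + v)  ≈⟨ sub-cong eq refl ⟨
      (b + u) - (b + v)  ≈⟨ sub-cong (+-comm b u) (+-comm b v) ⟩
      (u + b) - (v + b)  ≈⟨ sub-cong (+-congˡ (⁻¹-involutive b)) (+-congˡ (⁻¹-involutive b)) ⟨
      (u - - b) - (v - - b) ≈⟨ cancelʳ u (- b) v ⟩
      u - v              ∎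

    -- Cramer's rule for t • 𝔩 - r • d ≈ c with unknowns t and r.

    cramerˣ : ∀ c 𝔩 d → cross c d * proj₁ 𝔩 - cross c 𝔩 * proj₁ d ≈ proj₁ c * cross 𝔩 d
    cramerˣ (cx , cy) (lx , ly) (dx , dy) = begin
      (cx * dy - cy * dx) * lx - (cx * ly - cy * lx) * dx
        ≈⟨ sub-cong ([y-z]x≈yx-zx lx _ _) ([y-z]x≈yx-zx dx _ _) ⟩
      (cx * dy * lx - cy * dx * lx) - (cx * ly * dx - cy * lx * dx)
        ≈⟨ sub-cong refl (sub-cong refl (xy∙z≈xz∙y cy lx dx)) ⟩
      (cx * dy * lx - cy * dx * lx) - (cx * ly * dx - cy * dx * lx)
        ≈⟨ cancelʳ _ _ _ ⟩
      cx * dy * lx - cx * ly * dx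
        ≈⟨ sub-cong (trans (xy∙z≈xz∙y cx dy lx) (*-assoc cx lx dy)) (*-assoc cx ly dx) ⟩
      cx * (lx * dy) - cx * (ly * dx)
        ≈⟨ x[y-z]≈xy-xz cx _ _ ⟨
      cx * (lx * dy - ly * dx) ∎

    cramerʸ : ∀ c 𝔩 d → cross c d * proj₂ 𝔩 - cross c 𝔩 * proj₂ d ≈ proj₂ c * cross 𝔩 d
    cramerʸ (cx , cy) (lx , ly) (dx , dy) = begin
      (cx * dy - cy * dx) * ly - (cx * ly - cy * lx) * dy
        ≈⟨ sub-cong ([y-z]x≈yx-zx ly _ _) ([y-z]x≈yx-zx dy _ _) ⟩
      (cx * dy * ly - cy * dx * ly) - (cx * ly * dy - cy * lx * dy)
        ≈⟨ sub-cong refl (sub-cong (xy∙z≈xz∙y cx ly dy) refl) ⟩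
      (cx * dy * ly - cy * dx * ly) - (cx * dy * ly - cy * lx * dy)
        ≈⟨ cancelˡ _ _ _ ⟩
      cy * lx * dy - cy * dx * ly
        ≈⟨ sub-cong (*-assoc cy lx dy) (trans (xy∙z≈xz∙y cy dx ly) (*-assoc cy ly dx)) ⟩
      cy * (lx * dy) - cy * (ly * dx)
        ≈⟨ x[y-z]≈xy-xz cy _ _ ⟨
      cy * (lx * dy - ly * dx) ∎

    cross-t : ∀ {c} t r 𝔩 d → c ≈ₚ t • 𝔩 ⊝ r • d → cross c d ≈ t * cross 𝔩 d
    cross-t {cx , cy} t r (lx , ly) (dx , dy) (ex , ey) = begin
      cx * dy - cy * dx
        ≈⟨ sub-cong (*-congʳ ex) (*-congʳ ey) ⟩
      (t * lx - r * dx) * dy - (t * ly - r * dy) * dx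
        ≈⟨ sub-cong ([y-z]x≈yx-zx dy _ _) ([y-z]x≈yx-zx dx _ _) ⟩
      (t * lx * dy - r * dx * dy) - (t * ly * dx - r * dy * dx)
        ≈⟨ sub-cong refl (sub-cong refl (xy∙z≈xz∙y r dy dx)) ⟩
      (t * lx * dy - r * dx * dy) - (t * ly * dx - r * dx * dy)
        ≈⟨ cancelʳ _ _ _ ⟩
      t * lx * dy - t * ly * dx
        ≈⟨ sub-cong (*-assoc t lx dy) (*-assoc t ly dx) ⟩
      t * (lx * dy) - t * (ly * dx)
        ≈⟨ x[y-z]≈xy-xz t _ _ ⟨
      t * (lx * dy - ly * dx) ∎

    cross-r : ∀ {c} t r 𝔩 d → c ≈ₚ t • 𝔩 ⊝ r • d → cross c 𝔩 ≈ r * cross 𝔩 d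
    cross-r {cx , cy} t r (lx , ly) (dx , dy) (ex , ey) = begin
      cx * ly - cy * lx
        ≈⟨ sub-cong (*-congʳ ex) (*-congʳ ey) ⟩
      (t * lx - r * dx) * ly - (t * ly - r * dy) * lx
        ≈⟨ sub-cong ([y-z]x≈yx-zx ly _ _) ([y-z]x≈yx-zx lx _ _) ⟩
      (t * lx * ly - r * dx * ly) - (t * ly * lx - r * dy * lx)
        ≈⟨ sub-cong refl (sub-cong (xy∙z≈xz∙y t ly lx) refl) ⟩
      (t * lx * ly - r * dx * ly) - (t * lx * ly - r * dy * lx)
        ≈⟨ cancelˡ _ _ _ ⟩
      r * dy * lx - r * dx * ly
        ≈⟨ sub-cong (trans (xy∙z≈xz∙y r dy lx) (*-assoc r lx dy))
                    (trans (xy∙z≈xz∙y r dx ly) (*-assoc r ly dx)) ⟩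
      r * (lx * dy) - r * (ly * dx)
        ≈⟨ x[y-z]≈xy-xz r _ _ ⟨
      r * (lx * dy - ly * dx) ∎

    ≤-resp : ∀ {a b c d} → a ≈ b → c ≈ d → a ≤ c → b ≤ d
    ≤-resp p q (inj₁ a<c) = inj₁ (<-respʳ-≈ q (<-respˡ-≈ p a<c))
    ≤-resp p q (inj₂ a≈c) = inj₂ (trans (sym p) (trans a≈c q))

    rayMeets? : ∀ b 𝔩 p q → ¬ Parallel 𝔩 (q ⊝ p) → Dec (RayMeets b 𝔩 p q)
    rayMeets? b 𝔩 p q ∦ =
      map′ to from ((0# <? t) ×-dec (0# ≤? r) ×-dec (r ≤? 1#))
      where
      c d : Point
      c = p ⊝ b
      d = q ⊝ p
      i : Carrier
      i = proj₁ (inverse ∦)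
      det*i : cross 𝔩 d * i ≈ 1#
      det*i = proj₂ (inverse ∦)
      t r : Carrier
      t = cross c d * i
      r = cross c 𝔩 * i

      undo : ∀ x y z w k → x * z - y * w ≈ k * cross 𝔩 d → x * i * z - y * i * w ≈ k
      undo x y z w k eq = begin
        x * i * z - y * i * w  ≈⟨ sub-cong (xy∙z≈xz∙y x i z) (xy∙z≈xz∙y y i w) ⟩
        x * z * i - y * w * i  ≈⟨ [y-z]x≈yx-zx i _ _ ⟨
        (x * z - y * w) * i    ≈⟨ *-congʳ eq ⟩
        k * cross 𝔩 d * i      ≈⟨ *-assoc k _ i ⟩
        k * (cross 𝔩 d * i)    ≈⟨ *-congˡ det*i ⟩
        k * 1#                 ≈⟨ *-identityʳ k ⟩
        k                      ∎

      divide : ∀ x k → x ≈ k * cross 𝔩 d → k ≈ x * i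
      divide x k eq = begin
        k                    ≈⟨ *-identityʳ k ⟨
        k * 1#               ≈⟨ *-congˡ det*i ⟨
        k * (cross 𝔩 d * i)  ≈⟨ *-assoc k _ i ⟨
        k * cross 𝔩 d * i    ≈⟨ *-congʳ eq ⟨
        x * i                ∎

      to : 0# < t × 0# ≤ r × r ≤ 1# → RayMeets b 𝔩 p q
      to (0<t , 0≤r , r≤1) = t , 0<t , r , (0≤r , r≤1) ,
        ( solve-coord _ _ _ _ (undo _ _ _ _ _ (cramerˣ c 𝔩 d))
        , solve-coord _ _ _ _ (undo _ _ _ _ _ (cramerʸ c 𝔩 d)) )

      from : RayMeets b 𝔩 p q → 0# < t × 0# ≤ r × r ≤ 1#
      from (t′ , 0<t′ , r′ , (0≤r′ , r′≤1) , ex , ey) =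
        <-respʳ-≈ t′≈t 0<t′ , ≤-resp refl r′≈r 0≤r′ , ≤-resp r′≈r refl r′≤1
        where
        c≈ : c ≈ₚ t′ • 𝔩 ⊝ r′ • d
        c≈ = unsolve-coord _ _ _ _ ex , unsolve-coord _ _ _ _ ey
        t′≈t : t′ ≈ t
        t′≈t = divide _ _ (cross-t t′ r′ 𝔩 d c≈)
        r′≈r : r′ ≈ r
        r′≈r = divide _ _ (cross-r t′ r′ 𝔩 d c≈)

  open RayIntersection public using (rayMeets?)

  ----------------------------------------------------------------------
  -- Plabic networks

  module _ (disk : Disk) {n : ℕ} (G : PlabicGraph n) where
    open Disk disk
    open PlabicGraph G

    record IsEmbedding (pos : Vertex → Point) : Set where
      OnEdge : Edge → Point → Set
      OnEdge e = OnSegment (pos (source e)) (pos (target e))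

      IsEndpoint : Vertex → Edge → Set
      IsEndpoint v e = v ≡ source e ⊎ v ≡ target e

      -- The boundary vertices are labelled clockwise by their parameters τ on
      -- the boundary segment.
      field
        τ                 : Fin n → Carrier
        τ-unit            : ∀ i → InUnit (τ i)
        τ-increasing      : ∀ {i j} → i Fin.< j → τ i < τ j
        boundary-position : ∀ i → pos (inj₁ i) ≈ₚ start ⊕ τ i • (end ⊝ start)
        internal-inside   : ∀ v → Interior D (pos (inj₂ v))
        injective         : ∀ u v → pos u ≈ₚ pos v → u ≡ v
        no-loops          : ∀ e → source e ≢ target e
        vertex-on-edge    : ∀ v e → OnEdge e (pos v) → IsEndpoint v e
        edges-meet        : ∀ e f → e ≢ f → ∀ p → OnEdge e p → OnEdge f p →
                            ∃[ v ] (IsEndpoint v e × IsEndpoint v f × p ≈ₚ pos v)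

  record Network (disk : Disk) (n : ℕ) : Set where
    field
      graph : PlabicGraph n

    open PlabicGraph graph public

    field
      pos             : Vertex → Point
      isEmbedding     : IsEmbedding disk graph pos
      weight          : Edge → Carrier
      weight-positive : ∀ e → 0# < weight e

    direction : Edge → Point
    direction e = pos (target e) ⊝ pos (source e)

  module _ {disk : Disk} {n : ℕ} (N : Network disk n) where
    open Disk disk
    open Network N

    record IsGaugeDirection (𝔩 : Point) : Set where
      field
        nonzero         : ¬ (𝔩 ≈ₚ (0# , 0#))
        not-parallel    : ∀ e → ¬ Parallel 𝔩 (direction e)
        inward          : ∀ i → ∃[ t ] (0# < t × Interior D (pos (inj₁ i) ⊕ t • 𝔩))
        avoids-internal : ∀ i v t → 0# ≤ t → ¬ (pos (inj₂ v) ≈ₚ pos (inj₁ i) ⊕ t • 𝔩)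

    -- The guard s a b = s a 𝔩 = s 𝔩 b also admits the case of three zeros, where
    -- the value is 0 anyway.
    wind : Point → Edge → Edge → ℤ
    wind 𝔩 e f =
      if does ((s a b ℤ.≟ s a 𝔩) ×-dec (s a b ℤ.≟ s 𝔩 b)) then s a b else 0ℤ
      where
      a b : Point
      a = direction e
      b = direction f

    windNext : Point → (e : Edge) → Next graph e → ℤ
    windNext 𝔩 e (edge f _) = wind 𝔩 e f
    windNext 𝔩 e (none _ _) = 0ℤ

    windPrev : Point → (e : Edge) → Prev graph e → ℤ
    windPrev 𝔩 e (edge f _) = wind 𝔩 f e
    windPrev 𝔩 e (none _ _) = 0ℤ

    module _ {𝔩 : Point} (γ : IsGaugeDirection 𝔩) where
      open IsGaugeDirection γ

      -- A gauge ray meets e at most once, since e is not parallel to 𝔩; so the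
      -- number of intersections is the number of rays meeting e.
      int : Edge → ℕ
      int e = length (filter (λ i → isBoundarySource? i ×-dec
        rayMeets? (pos (inj₁ i)) 𝔩 (pos (source e)) (pos (target e)) (not-parallel e))
        (allFin n))

      record IsSolution (E : Edge → Vector Carrier n) : Set where
        field
          internal : ∀ e v → target e ≡ inj₂ v → ∀ k →
            E e k ≈ -1^ (ℤ.+ int e) * weight e *
              sum (λ f → if does (source f ≟ᵛ inj₂ v) then -1^ (wind 𝔩 e f) * E f k else 0#)
          sink : ∀ e j → target e ≡ inj₁ j → ∀ k →
            E e k ≈ -1^ (ℤ.+ int e) * weight e * (if does (j Fin.≟ k) then 1# else 0#)

      record IsEdgeVectors (E : Edge → Vector Carrier n) : Set where
        field
          isSolution : IsSolution E
          unique     : ∀ E′ → IsSolution E′ → ∀ e k → E′ e k ≈ E e k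

    ----------------------------------------------------------------------
    -- Vertex gauge transformation

    moveVertex : Internal → Point → Vertex → Point
    moveVertex V p = [ pos ∘ inj₁ , updateAt (pos ∘ inj₂) V (const p) ]

    record VertexMove (V : Internal) : Set where
      field
        path       : Carrier → Point
        continuous : ContinuousOnUnit path
        initial    : path 0# ≈ₚ pos (inj₂ V)
        embedded   : ∀ t → InUnit t → IsEmbedding disk graph (moveVertex V (path t))

    moved : {V : Internal} → VertexMove V → Network disk n
    moved {V} μ = record
      { graph           = graph
      ; pos             = moveVertex V (path 1#)
      ; isEmbedding     = embedded 1# (inj₁ 0<1 , inj₂ refl)
      ; weight          = weight
      ; weight-positive = weight-positive
      }
      where open VertexMove μ

{-# OPTIONS --safe #-}
module Submission where

-- Modulo 2, wind(e, f) tells whether 𝔩 lies in the convex cone spanned by e and f;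
-- call this w(e, f).  By uniqueness it suffices that the edge vectors multiplied by
-- the claimed signs solve the system of the moved network, which is a parity
-- identity for each pair of consecutive edges.  While V moves, w(f, x) + w(h, x) is
-- locally constant in the direction x of a moving edge as long as x does not become
-- opposite to f or h.  Let e : A → V and g : V → B, and let f be adjacent to e or g
-- at A or B, and h = B - A.  Planarity forbids e and g to become opposite to f or h,
-- so w(f, e) changes exactly when w(h, e) does, and likewise for g.  On the other
-- hand w(e, g) = w(e, h) + w(h, g), because h = e + g.  It remains to show that
-- int(e) + int(g) is unchanged modulo 2.  Since D lies on one side of its boundary
-- segment, a gauge ray meets an edge exactly when it separates the ends of the edge,
-- so the side of V enters int(e) + int(g) twice.  The exception is the ray based at
-- A when A is a source; it makes up for the missing winding at A.  When B is a sink,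
-- h and g point away from 𝔩, so w(h, g) = 0.

open import Defs
open import Algebra.Bundles using (CommutativeRing)
open import Data.Bool.Base using (Bool; true; false; not; _∧_; _∨_; _xor_; if_then_else_)
import Data.Bool.Properties as Bool
open import Data.Bool.Solver using (module xor-∧-Solver)
open import Data.Empty using (⊥)
open import Data.Fin.Base as Fin using (Fin)
import Data.Fin.Properties as Fin
open import Data.Integer.Base as ℤ using (ℤ; 0ℤ; 1ℤ; -1ℤ; ∣_∣; +_; -[1+_])
import Data.Integer.Properties as ℤ
open import Data.List.Base using (List; []; _∷_; length; filter; allFin; tabulate)
import Data.List.Properties as List
open import Data.List.Membership.Propositional using (_∈_; lose)
open import Data.List.Membership.Propositional.Properties using (∈-filter⁺; ∈-allFin)
open import Data.List.Relation.Unary.All as All using (All; []; _∷_)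
open import Data.List.Relation.Unary.AllPairs using ([]; _∷_)
open import Data.List.Relation.Unary.Unique.Propositional using (Unique)
open import Data.Maybe.Base using (Maybe; just; nothing)
open import Data.Nat.Base as ℕ using (ℕ; zero; suc; z≤n; s≤s)
import Data.Nat.Properties as ℕ
open import Data.Product.Base using (_×_; _,_; ∃-syntax; proj₁; proj₂)
open import Data.Sum.Base using (_⊎_; inj₁; inj₂; [_,_])
import Data.Sum.Properties as Sum
open import Data.Vec.Functional using (Vector)
open import Data.Vec.Functional.Properties using (updateAt-updates; updateAt-minimal)
open import Function.Base using (_∘_; id)
open import Relation.Binary.Definitions using (DecidableEquality; tri<; tri≈; tri>)
open import Relation.Binary.PropositionalEquality.Core as ≡ using (_≡_; _≢_)
open import Relation.Binary.Structures using (IsStrictTotalOrder)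
open import Relation.Nullary.Decidable using
  (Dec; yes; no; does; map′; ¬?; _×-dec_; _→-dec_; True; toWitness; dec-true; dec-false; does-≡)
open import Relation.Nullary.Negation using (¬_; contradiction)

-- As `x` turns, `w f x` jumps for two reasons: `x` passes through 𝔩, which changes the value for
-- every `f` alike, or `x` passes through the direction opposite to `f`, where the cone switches
-- sides. In a sum of two such terms the first kind of jump cancels; hence a winding is never
-- followed alone along the move, only together with one against the chord. The chord is the right
-- partner because its ends do not move and because it splits the cone of `e` and `g`. The obstacle
-- is that 𝔩 is generic only for the initial and the final graph. In between, a moving edge may be
-- parallel to 𝔩 and V may cross gauge rays, and the chord may be parallel to 𝔩 throughout. So the
-- invariance is carried by sign conditions on the moving direction and fixed ones, without
-- reference to its position relative to 𝔩, and rests on the connectedness of the unit interval; and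
-- `w` has a half-open convention for directions parallel to 𝔩. The planar case distinctions become
-- finite checks on signs of cross products, which are tied together by the three-term Plücker
-- relation.

-- Integer coefficients for the ring solver

-- The ring solver cancels terms only if equality of coefficients is decidable.
module IntegerCoefficients {c ℓ} (R : CommutativeRing c ℓ) where
  open CommutativeRing R
  open import Algebra.Properties.Semiring.Mult.TCOptimised semiring renaming (_×_ to _×ᴿ_)
  open import Algebra.Properties.Ring ring
  open import Algebra.Properties.AbelianGroup +-abelianGroup using (⁻¹-∙-comm; ⁻¹-involutive; ε⁻¹≈ε)
  open import Algebra.Properties.CommutativeSemigroup +-commutativeSemigroup using (interchange)
  open import Algebra.Solver.Ring.AlmostCommutativeRing
    using (fromCommutativeRing; _-Raw-AlmostCommutative⟶_)
  open import Relation.Binary.Reasoning.Setoid setoid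

  fromℕ : ℕ → Carrier
  fromℕ n = n ×ᴿ 1#

  fromℤ : ℤ → Carrier
  fromℤ (+ n)    = fromℕ n
  fromℤ -[1+ n ] = - fromℕ (suc n)

  fromℤ-⊖ : ∀ m n → fromℤ (m ℤ.⊖ n) ≈ fromℕ m - fromℕ n
  fromℤ-⊖ m zero = sym (trans (+-congˡ ε⁻¹≈ε) (+-identityʳ _))
  fromℤ-⊖ zero (suc n) = sym (+-identityˡ _)
  fromℤ-⊖ (suc m) (suc n) = begin
    fromℤ (suc m ℤ.⊖ suc n)                     ≡⟨ ≡.cong fromℤ (ℤ.[1+m]⊖[1+n]≡m⊖n m n) ⟩
    fromℤ (m ℤ.⊖ n)                             ≈⟨ fromℤ-⊖ m n ⟩
    fromℕ m - fromℕ n                           ≈⟨ +-identityˡ _ ⟨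
    0# + (fromℕ m - fromℕ n)                    ≈⟨ +-congʳ (-‿inverseʳ 1#) ⟨
    (1# - 1#) + (fromℕ m - fromℕ n)             ≈⟨ interchange 1# (- 1#) (fromℕ m) (- fromℕ n) ⟩
    (1# + fromℕ m) + (- 1# - fromℕ n)           ≈⟨ +-congˡ (⁻¹-∙-comm 1# (fromℕ n)) ⟩
    (1# + fromℕ m) - (1# + fromℕ n)             ≈⟨ +-cong (×-homo-+ 1# 1 m)
      (-‿cong (×-homo-+ 1# 1 n)) ⟨
    fromℕ (suc m) - fromℕ (suc n)               ∎

  fromℤ-neg : ∀ i → fromℤ (ℤ.- i) ≈ - fromℤ i
  fromℤ-neg (+ zero)  = sym ε⁻¹≈ε
  fromℤ-neg (+ suc n) = refl
  fromℤ-neg -[1+ n ]  = sym (⁻¹-involutive _)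

  fromℤ-+ : ∀ i j → fromℤ (i ℤ.+ j) ≈ fromℤ i + fromℤ j
  fromℤ-+ (+ m)    (+ n)    = ×-homo-+ 1# m n
  fromℤ-+ (+ m)    -[1+ n ] = fromℤ-⊖ m (suc n)
  fromℤ-+ -[1+ m ] (+ n)    = trans (fromℤ-⊖ n (suc m)) (+-comm _ _)
  fromℤ-+ -[1+ m ] -[1+ n ] = begin
    - fromℕ (suc (suc (m ℕ.+ n)))    ≡⟨ ≡.cong (λ k → - fromℕ (suc k)) (≡.sym (ℕ.+-suc m n)) ⟩
    - fromℕ (suc m ℕ.+ suc n)        ≈⟨ -‿cong (×-homo-+ 1# (suc m) (suc n)) ⟩
    - (fromℕ (suc m) + fromℕ (suc n)) ≈⟨ ⁻¹-∙-comm _ _ ⟨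
    - fromℕ (suc m) - fromℕ (suc n)  ∎

  fromℤ-+* : ∀ m j → fromℤ (+ m ℤ.* j) ≈ fromℕ m * fromℤ j
  fromℤ-+* m (+ n) = trans (reflexive (≡.cong fromℤ (≡.sym (ℤ.pos-* m n)))) (×1-homo-* m n)
  fromℤ-+* m -[1+ n ] = begin
    fromℤ (+ m ℤ.* ℤ.- + suc n)      ≡⟨ ≡.cong fromℤ (ℤ.neg-distribʳ-* (+ m) (+ suc n)) ⟨
    fromℤ (ℤ.- (+ m ℤ.* + suc n))    ≈⟨ fromℤ-neg (+ m ℤ.* + suc n) ⟩
    - fromℤ (+ m ℤ.* + suc n)        ≈⟨ -‿cong (fromℤ-+* m (+ suc n)) ⟩
    - (fromℕ m * fromℕ (suc n))      ≈⟨ -‿distribʳ-* _ _ ⟩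
    fromℕ m * - fromℕ (suc n)        ∎

  fromℤ-* : ∀ i j → fromℤ (i ℤ.* j) ≈ fromℤ i * fromℤ j
  fromℤ-* (+ m)    j = fromℤ-+* m j
  fromℤ-* -[1+ m ] j = begin
    fromℤ (ℤ.- + suc m ℤ.* j)        ≡⟨ ≡.cong fromℤ (ℤ.neg-distribˡ-* (+ suc m) j) ⟨
    fromℤ (ℤ.- (+ suc m ℤ.* j))      ≈⟨ fromℤ-neg (+ suc m ℤ.* j) ⟩
    - fromℤ (+ suc m ℤ.* j)          ≈⟨ -‿cong (fromℤ-+* (suc m) j) ⟩
    - (fromℕ (suc m) * fromℤ j)      ≈⟨ -‿distribˡ-* _ _ ⟩
    - fromℕ (suc m) * fromℤ j        ∎

  homomorphism : CommutativeRing.rawRing ℤ.+-*-commutativeRing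
                   -Raw-AlmostCommutative⟶ fromCommutativeRing R
  homomorphism = record
    { ⟦_⟧    = fromℤ
    ; +-homo = fromℤ-+
    ; *-homo = fromℤ-*
    ; -‿homo = fromℤ-neg
    ; 0-homo = refl
    ; 1-homo = refl
    }

  coefficients? : ∀ i j → Maybe (fromℤ i ≈ fromℤ j)
  coefficients? i j with i ℤ.≟ j
  ... | yes ≡.refl = just refl
  ... | no _       = nothing

  open import Algebra.Solver.Ring _ _ homomorphism coefficients? public
    using (solve; _:=_; _:+_; _:*_; _:-_; :-_; con)

-- Parity, and finite checks on signs

odd : ℕ → Bool
odd zero    = false
odd (suc n) = not (odd n)

module Signs where

  data Sgn : Set where
    ⁻ ⁰ ⁺ : Sgn

  infix 4 _≟_
  _≟_ : DecidableEquality Sgn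
  ⁻ ≟ ⁻ = yes ≡.refl
  ⁻ ≟ ⁰ = no λ ()
  ⁻ ≟ ⁺ = no λ ()
  ⁰ ≟ ⁻ = no λ ()
  ⁰ ≟ ⁰ = yes ≡.refl
  ⁰ ≟ ⁺ = no λ ()
  ⁺ ≟ ⁻ = no λ ()
  ⁺ ≟ ⁰ = no λ ()
  ⁺ ≟ ⁺ = yes ≡.refl

  all? : {P : Sgn → Set} → (∀ p → Dec (P p)) → Dec (∀ p → P p)
  all? P? = map′ (λ { (a , b , c) ⁻ → a ; (a , b , c) ⁰ → b ; (a , b , c) ⁺ → c })
                 (λ f → f ⁻ , f ⁰ , f ⁺)
                 (P? ⁻ ×-dec P? ⁰ ×-dec P? ⁺)

  instance
    dec-≡ : ∀ {p q : Sgn} → Dec (p ≡ q)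
    dec-≡ = _ ≟ _

    dec-≡ᵇ : ∀ {a b : Bool} → Dec (a ≡ b)
    dec-≡ᵇ = _ Bool.≟ _

    dec-⊥ : Dec ⊥
    dec-⊥ = no λ ()

    dec-→ : {P Q : Set} → {{Dec P}} → {{Dec Q}} → Dec (P → Q)
    dec-→ {{p?}} {{q?}} = p? →-dec q?

    dec-∀ : {P : Sgn → Set} → {{∀ {p} → Dec (P p)}} → Dec (∀ p → P p)
    dec-∀ {{P?}} = all? λ p → P? {p}

  -- Instance search assembles the decision procedure from the shape of the statement, and `True P?`
  -- is discharged by evaluation. A lemma on signs is thus proved by running through all cases.
  decide : {P : Set} {{P? : Dec P}} {_ : True P?} → P
  decide {{_}} {t} = toWitness t

  opp : Sgn → Sgn
  opp ⁻ = ⁺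
  opp ⁰ = ⁰
  opp ⁺ = ⁻

  infixl 7 _·_
  _·_ : Sgn → Sgn → Sgn
  ⁻ · q = opp q
  ⁰ · q = ⁰
  ⁺ · q = q

  positive negative : Sgn → Bool
  positive p = does (p ≟ ⁺)
  negative p = does (p ≟ ⁻)

  -- The signs that three numbers with sum zero can have.
  record Balanced (p q r : Sgn) : Set where
    constructor balanced
    field
      balance : positive p ∨ positive q ∨ positive r ≡ negative p ∨ negative q ∨ negative r

  instance
    dec-balanced : ∀ {p q r} → Dec (Balanced p q r)
    dec-balanced = map′ balanced Balanced.balance (_ Bool.≟ _)

  toℤ : Sgn → ℤ
  toℤ ⁻ = -1ℤ
  toℤ ⁰ = 0ℤ
  toℤ ⁺ = 1ℤ

  -- Directions parallel to 𝔩, of either orientation, count as left of 𝔩.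
  left : Sgn → Bool
  left ⁻ = false
  left ⁰ = true
  left ⁺ = true

  -- Whether the ray 𝔩 lies in the convex cone spanned by a and b, from the signs
  -- of cross 𝔩 a, cross 𝔩 b and cross a b.
  turns : Sgn → Sgn → Sgn → Bool
  turns la lb ab =
    if left la then (if left lb then false else negative ab)
               else (if left lb then positive ab else false)

  turns-sym : ∀ la lb ab → turns la lb ab ≡ turns lb la (opp ab)
  turns-sym = decide

  -- Below, la stands for the sign of cross 𝔩 a, and ab for that of cross a b.

  -- `opp la` appears because `wind` tests `s a 𝔩`, whereas `la` is the sign of `cross 𝔩 a`.
  turns-wind : ∀ la lb ab → la ≢ ⁰ → lb ≢ ⁰ →
    odd ∣ if does ((toℤ ab ℤ.≟ toℤ (opp la)) ×-dec (toℤ ab ℤ.≟ toℤ lb)) then toℤ ab else 0ℤ ∣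
      ≡ turns la lb ab
  turns-wind = decide

  -- Walking around the directions f, g, x turns by a full circle, and then passes 𝔩
  -- an odd number of times, exactly if they positively span the plane.
  turns-triangle : ∀ lf lg lx gx xf → lx ≢ ⁰ →
    Balanced (lf · gx) (lg · xf) (lx · ⁺) →
    (xf ≡ ⁰ → gx ≡ ⁻) → (gx ≡ ⁰ → xf ≡ ⁻) →
    turns lf lx (opp xf) xor turns lg lx gx ≡ turns lf lg ⁺ xor (positive gx ∧ positive xf)
  turns-triangle = decide

  -- Here g is a positive multiple of f, so both have the sign `lf` and span the same cone with x.
  -- The hypothesis is the Plücker relation, whose third term vanishes.
  turns-parallel : ∀ lf lx gx xf → lf ≢ ⁰ → lx ≢ ⁰ → Balanced (lf · gx) (lf · xf) ⁰ →
    turns lf lx (opp xf) xor turns lf lx gx ≡ false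
  turns-parallel = decide

  -- The cones of f, x and of -f, x together fill the half-plane on the side of x of the line
  -- through f. So 𝔩 lies in exactly one of them iff it lies on that side, that is, iff `lf` and
  -- `xf` agree.
  turns-antiparallel : ∀ lf lx gx xf → lf ≢ ⁰ → lx ≢ ⁰ → xf ≢ ⁰ →
    Balanced (lf · gx) (opp lf · xf) ⁰ →
    turns lf lx (opp xf) xor turns (opp lf) lx gx ≡ positive (lf · xf)
  turns-antiparallel = decide

  -- The sum h of a and b divides their cone in two. One sign `ab` serves all three pairs, as cross
  -- a b = cross a h = cross h b. If h is parallel to 𝔩, `left` puts it on one side, so that 𝔩 is
  -- neither missed nor counted twice.
  turns-sum : ∀ la lb lh ab → la ≢ ⁰ → lb ≢ ⁰ → Balanced la lb (opp lh) →
    turns la lb ab ≡ turns la lh ab xor turns lh lb ab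
  turns-sum = decide

  -- The letter k stands for the direction of the boundary segment; k𝔩 and ke are negative and kh is
  -- not positive. Within this half-plane the opposite of 𝔩 is out of reach, so 𝔩 lies between e and
  -- h iff they are on different sides of its line.
  turns-inward : ∀ le lh kh eh → le ≢ ⁰ → kh ≢ ⁺ → (kh ≡ ⁰ → lh ≢ ⁰) →
    Balanced (⁻ · eh) (⁻ · opp lh) (kh · le) →
    turns le lh eh ≡ left le xor left lh
  turns-inward = decide

  -- With kg positive and kh not negative, g and h point to the other side of the segment than 𝔩,
  -- and so does their cone.
  turns-outward : ∀ lh lg kh hg → lg ≢ ⁰ → kh ≢ ⁻ →
    Balanced (⁻ · hg) (kh · opp lg) (⁺ · lh) →
    turns lh lg hg ≡ false
  turns-outward = decide

  ≡-opp : ∀ {p q} → p ≢ ⁰ → q ≢ ⁰ → p ≢ q → q ≡ opp p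
  ≡-opp {p} {q} = decide′ p q
    where
    decide′ : ∀ p q → p ≢ ⁰ → q ≢ ⁰ → p ≢ q → q ≡ opp p
    decide′ = decide

-- Inequalities and signs in an ordered field

module OrderedField (ℝ : CompleteOrderedField) where
  open Plabic ℝ
  open IntegerCoefficients commutativeRing public
  open Signs
  private module < = IsStrictTotalOrder isStrictTotalOrder

  0≢ : ∀ {x} → 0# < x → ¬ (x ≈ 0#)
  0≢ 0<x x≈0 = <.irrefl (sym x≈0) 0<x

  <⇒0< : ∀ {x y} → x < y → 0# < y - x
  <⇒0< {x} x<y = <-respˡ-≈ (-‿inverseʳ x) (+-monoˡ-< (- x) x<y)

  0<⇒< : ∀ {x y z} → 0# < z → y - x ≈ z → x < y
  0<⇒< {x} {y} 0<z eq =
    <-respˡ-≈ (+-identityˡ x)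
      (<-respʳ-≈ (solve 2 (λ x y → y :- x :+ x := y) refl x y)
        (+-monoˡ-< x (<-respʳ-≈ (sym eq) 0<z)))

  neg⇒0< : ∀ {x} → x < 0# → 0# < - x
  neg⇒0< {x} x<0 = <-respʳ-≈ (+-identityˡ (- x)) (<⇒0< x<0)

  0<⇒neg : ∀ {x} → 0# < - x → x < 0#
  0<⇒neg {x} 0<-x = 0<⇒< 0<-x (+-identityˡ (- x))

  +-pos : ∀ {x y} → 0# < x → 0# < y → 0# < x + y
  +-pos {x} {y} 0<x 0<y = <.trans 0<y (<-respˡ-≈ (+-identityˡ y) (+-monoˡ-< y 0<x))

  +-nonneg-pos : ∀ {x y} → 0# ≤ x → 0# < y → 0# < x + y
  +-nonneg-pos (inj₁ 0<x) 0<y = +-pos 0<x 0<y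
  +-nonneg-pos {x} {y} (inj₂ 0≈x) 0<y = <-respʳ-≈ (trans (sym (+-identityˡ y)) (+-congʳ 0≈x)) 0<y

  ≤-<-trans : ∀ {x y z} → x ≤ y → y < z → x < z
  ≤-<-trans (inj₁ x<y) y<z = <.trans x<y y<z
  ≤-<-trans (inj₂ x≈y) y<z = <-respˡ-≈ (sym x≈y) y<z

  ≮⇒≥ : ∀ {x y} → ¬ (x < y) → y ≤ x
  ≮⇒≥ {x} {y} x≮y with compare x y
  ... | tri< x<y _ _ = contradiction x<y x≮y
  ... | tri≈ _ x≈y _ = inj₂ (sym x≈y)
  ... | tri> _ _ y<x = inj₁ y<x

  ≤⇒≯ : ∀ {x y} → x ≤ y → ¬ (y < x)
  ≤⇒≯ x≤y y<x = <.irrefl refl (≤-<-trans x≤y y<x)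

  x<x+ε : ∀ {x ε} → 0# < ε → x < x + ε
  x<x+ε {x} {ε} 0<ε = 0<⇒< 0<ε (solve 2 (λ x ε → x :+ ε :- x := ε) refl x ε)

  -- The ring solver proves identities only. The multiplier `k` is a certificate that turns a
  -- consequence of `c ≈ d` into an identity; `combination₂` does so for two hypotheses.
  combination : ∀ {a b c d} k → c ≈ d → a - b ≈ k * (c - d) → a ≈ b
  combination {a} {b} {c} {d} k c≈d eq = trans (solve 2 (λ a b → a := a :- b :+ b) refl a b)
    (trans (+-congʳ a-b≈0) (+-identityˡ b))
    where
    a-b≈0 : a - b ≈ 0#
    a-b≈0 = trans eq (trans (*-congˡ (trans (+-congʳ c≈d) (-‿inverseʳ d))) (zeroʳ k))

  combination₂ : ∀ {a b c₁ d₁ c₂ d₂} k₁ k₂ → c₁ ≈ d₁ → c₂ ≈ d₂ →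
    a - b ≈ k₁ * (c₁ - d₁) + k₂ * (c₂ - d₂) → a ≈ b
  combination₂ {a} {b} k₁ k₂ e₁ e₂ eq = combination k₁ e₁ (trans eq
    (trans (+-congˡ (trans (*-congˡ (trans (+-congʳ e₂) (-‿inverseʳ _))) (zeroʳ k₂)))
      (+-identityʳ _)))

  -- A view of `sgn`: matching on it yields the sign together with the inequality behind it.
  data HasSgn (x : Carrier) : Sgn → Set where
    isNeg  : x < 0# → HasSgn x ⁻
    isZero : x ≈ 0# → HasSgn x ⁰
    isPos  : 0# < x → HasSgn x ⁺

  sgn : Carrier → Sgn
  sgn x with compare 0# x
  ... | tri< _ _ _ = ⁺
  ... | tri≈ _ _ _ = ⁰
  ... | tri> _ _ _ = ⁻

  hasSgn : ∀ x → HasSgn x (sgn x)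
  hasSgn x with compare 0# x
  ... | tri< 0<x _ _ = isPos 0<x
  ... | tri≈ _ 0≈x _ = isZero (sym 0≈x)
  ... | tri> _ _ x<0 = isNeg x<0

  s-sgn : ∀ a b → s a b ≡ toℤ (sgn (cross a b))
  s-sgn a b with compare 0# (cross a b)
  ... | tri< _ _ _ = ≡.refl
  ... | tri≈ _ _ _ = ≡.refl
  ... | tri> _ _ _ = ≡.refl

  sgn-≡ : ∀ {x p} → HasSgn x p → sgn x ≡ p
  sgn-≡ {x} h with compare 0# x | h
  ... | tri< _ _ _   | isPos _    = ≡.refl
  ... | tri< _ 0≉x _ | isZero x≈0 = contradiction (sym x≈0) 0≉x
  ... | tri< _ _ x≮0 | isNeg x<0  = contradiction x<0 x≮0
  ... | tri≈ 0≮x _ _ | isPos 0<x  = contradiction 0<x 0≮x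
  ... | tri≈ _ _ _   | isZero _   = ≡.refl
  ... | tri≈ _ _ x≮0 | isNeg x<0  = contradiction x<0 x≮0
  ... | tri> 0≮x _ _ | isPos 0<x  = contradiction 0<x 0≮x
  ... | tri> _ 0≉x _ | isZero x≈0 = contradiction (sym x≈0) 0≉x
  ... | tri> _ _ _   | isNeg _    = ≡.refl

  sgn⁻¹ : ∀ {x p} → sgn x ≡ p → HasSgn x p
  sgn⁻¹ {x} ≡.refl = hasSgn x

  HasSgn-resp : ∀ {x y p} → x ≈ y → HasSgn x p → HasSgn y p
  HasSgn-resp x≈y (isNeg x<0)  = isNeg (<-respˡ-≈ x≈y x<0)
  HasSgn-resp x≈y (isZero x≈0) = isZero (trans (sym x≈y) x≈0)
  HasSgn-resp x≈y (isPos 0<x)  = isPos (<-respʳ-≈ x≈y 0<x)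

  sgn-cong : ∀ {x y} → x ≈ y → sgn x ≡ sgn y
  sgn-cong {y = y} x≈y = sgn-≡ (HasSgn-resp (sym x≈y) (hasSgn y))

  sgn-pos : ∀ {x} → sgn x ≡ ⁺ → 0# < x
  sgn-pos eq with isPos 0<x ← sgn⁻¹ eq = 0<x

  sgn-zero : ∀ {x} → sgn x ≡ ⁰ → x ≈ 0#
  sgn-zero eq with isZero x≈0 ← sgn⁻¹ eq = x≈0

  sgn-neg : ∀ {x} → sgn x ≡ ⁻ → x < 0#
  sgn-neg eq with isNeg x<0 ← sgn⁻¹ eq = x<0

  sgn≢⁻ : ∀ {x} → sgn x ≢ ⁻ → 0# ≤ x
  sgn≢⁻ {x} ≢⁻ with sgn x | hasSgn x
  ... | ⁻ | _        = contradiction ≡.refl ≢⁻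
  ... | ⁰ | isZero x≈0 = inj₂ (sym x≈0)
  ... | ⁺ | isPos 0<x  = inj₁ 0<x

  sgn-opp : ∀ x → sgn (- x) ≡ opp (sgn x)
  sgn-opp x = sgn-≡ (h (hasSgn x))
    where
    -0≈0 : - 0# ≈ 0#
    -0≈0 = solve 0 (:- con (+ 0) := con (+ 0)) refl
    h : ∀ {p} → HasSgn x p → HasSgn (- x) (opp p)
    h (isNeg x<0)  = isPos (neg⇒0< x<0)
    h (isZero x≈0) = isZero (trans (-‿cong x≈0) -0≈0)
    h (isPos 0<x)  = isNeg (0<⇒neg (<-respʳ-≈ (solve 1 (λ x → x := :- :- x) refl x) 0<x))

  sgn-* : ∀ x y → sgn (x * y) ≡ sgn x · sgn y
  sgn-* x y = sgn-≡ (h (hasSgn x) (hasSgn y))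
    where
    h : ∀ {p q} → HasSgn x p → HasSgn y q → HasSgn (x * y) (p · q)
    h (isZero x≈0) _ = isZero (trans (*-congʳ x≈0) (zeroˡ y))
    h (isNeg _) (isZero y≈0) = isZero (trans (*-congˡ y≈0) (zeroʳ x))
    h (isPos _) (isZero y≈0) = isZero (trans (*-congˡ y≈0) (zeroʳ x))
    h (isPos 0<x) (isPos 0<y) = isPos (*-pos 0<x 0<y)
    h (isPos 0<x) (isNeg y<0) = isNeg (0<⇒neg (<-respʳ-≈
      (solve 2 (λ x y → x :* :- y := :- (x :* y)) refl x y) (*-pos 0<x (neg⇒0< y<0))))
    h (isNeg x<0) (isPos 0<y) = isNeg (0<⇒neg (<-respʳ-≈
      (solve 2 (λ x y → :- x :* y := :- (x :* y)) refl x y) (*-pos (neg⇒0< x<0) 0<y)))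
    h (isNeg x<0) (isNeg y<0) = isPos (<-respʳ-≈
      (solve 2 (λ x y → :- x :* :- y := x :* y) refl x y) (*-pos (neg⇒0< x<0) (neg⇒0< y<0)))

  sgn-+ : ∀ x y → Balanced (sgn x) (sgn y) (opp (sgn (x + y)))
  sgn-+ x y = h (hasSgn x) (hasSgn y)
    where
    balanced-⁻⁺ : ∀ r → Balanced ⁻ ⁺ (opp r)
    balanced-⁻⁺ _ = balanced ≡.refl
    balanced-⁺⁻ : ∀ r → Balanced ⁺ ⁻ (opp r)
    balanced-⁺⁻ _ = balanced ≡.refl
    balanced-⁰ : ∀ q → Balanced ⁰ q (opp q)
    balanced-⁰ = decide
    known : ∀ {p q r} → HasSgn (x + y) r → Balanced p q (opp r) → Balanced p q (opp (sgn (x + y)))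
    known has b rewrite sgn-≡ has = b
    h : ∀ {p q} → HasSgn x p → HasSgn y q → Balanced p q (opp (sgn (x + y)))
    h {q = q} (isZero x≈0) hy =
      known (HasSgn-resp (sym (trans (+-congʳ x≈0) (+-identityˡ y))) hy) (balanced-⁰ q)
    h (isNeg x<0) (isZero y≈0) =
      known (isNeg (<-respˡ-≈ (sym (trans (+-congˡ y≈0) (+-identityʳ x))) x<0)) (balanced ≡.refl)
    h (isPos 0<x) (isZero y≈0) =
      known (isPos (<-respʳ-≈ (sym (trans (+-congˡ y≈0) (+-identityʳ x))) 0<x)) (balanced ≡.refl)
    h (isNeg x<0) (isNeg y<0) = known (isNeg (0<⇒neg (<-respʳ-≈
      (solve 2 (λ x y → :- x :+ :- y := :- (x :+ y)) refl x y)
      (+-pos (neg⇒0< x<0) (neg⇒0< y<0))))) (balanced ≡.refl)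
    h (isPos 0<x) (isPos 0<y) = known (isPos (+-pos 0<x 0<y)) (balanced ≡.refl)
    -- Summands of opposite signs leave the sign of the sum open, and `Balanced` then admits any.
    h (isNeg _) (isPos _) = balanced-⁻⁺ _
    h (isPos _) (isNeg _) = balanced-⁺⁻ _

  sgn-balanced : ∀ {x y z} → x + y + z ≈ 0# → Balanced (sgn x) (sgn y) (sgn z)
  sgn-balanced {x} {y} {z} eq = ≡.subst (Balanced (sgn x) (sgn y)) opp-sgn (sgn-+ x y)
    where
    opp-sgn : opp (sgn (x + y)) ≡ sgn z
    opp-sgn = ≡.trans (≡.sym (sgn-opp (x + y))) (sgn-cong (combination (- 1#) eq
      (solve 3 (λ x y z → :- (x :+ y) :- z := :- con (+ 1) :* (x :+ y :+ z :- con (+ 0)))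
        refl x y z)))

  inverse-pos : ∀ {x} → 0# < x → ∃[ y ] (0# < y × x * y ≈ 1#)
  inverse-pos {x} 0<x with y , xy≈1 ← inverse (0≢ 0<x) = y , sgn-pos y⁺ , xy≈1
    where
    y⁺ : sgn y ≡ ⁺
    y⁺ = ≡.trans (≡.cong (_· sgn y) (≡.sym (sgn-≡ (isPos 0<x))))
           (≡.trans (≡.sym (sgn-* x y)) (sgn-≡ (isPos (<-respʳ-≈ (sym xy≈1) 0<1))))

  half : ∀ {ε} → 0# < ε → ∃[ η ] (0# < η × η + η ≈ ε)
  half {ε} 0<ε with i , 0<i , 2i≈1 ← inverse-pos (+-pos 0<1 0<1) =
    ε * i , *-pos 0<ε 0<i ,
    combination ε 2i≈1 (solve 2 (λ ε i → ε :* i :+ ε :* i :- ε :=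
      ε :* ((con (+ 1) :+ con (+ 1)) :* i :- con (+ 1))) refl ε i)

-- Continuity and the connectedness of the unit interval

module Continuity (ℝ : CompleteOrderedField) where
  open Plabic ℝ
  open OrderedField ℝ
  open Signs
  private module < = IsStrictTotalOrder isStrictTotalOrder

  Around : Carrier → (Carrier → Set) → Set
  Around t Q = ∃[ δ ] (0# < δ × (∀ u → InUnit u → ∣ t - u ∣< δ → Q u))

  Around-map₂ : ∀ {t} {P Q R : Carrier → Set} → (∀ {u} → P u → Q u → R u) →
    Around t P → Around t Q → Around t R
  Around-map₂ {t} f (δ , 0<δ , p) (η , 0<η , q) with compare δ η
  ... | tri< δ<η _ _ = δ , 0<δ , λ u u∈I d → f (p u u∈I d) (q u u∈I (weaken d))
    where
    weaken : ∀ {x y} → ∣ x - y ∣< δ → ∣ x - y ∣< η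
    weaken {x} {y} (a , b) = <.trans a (y+<) , <.trans b (y+<)
      where
      y+< : ∀ {z} → z + δ < z + η
      y+< {z} = 0<⇒< (<⇒0< δ<η) (solve 3 (λ z δ η → z :+ η :- (z :+ δ) := η :- δ) refl z δ η)
  ... | tri≈ _ δ≈η _ = δ , 0<δ , λ u u∈I d →
    f (p u u∈I d) (q u u∈I (<-respʳ-≈ (+-congˡ δ≈η) (proj₁ d) , <-respʳ-≈ (+-congˡ δ≈η) (proj₂ d)))
  ... | tri> _ _ η<δ = η , 0<η , λ u u∈I d → f (p u u∈I (weaken d)) (q u u∈I d)
    where
    weaken : ∀ {x y} → ∣ x - y ∣< η → ∣ x - y ∣< δ
    weaken {x} {y} (a , b) = <.trans a (y+<) , <.trans b (y+<)
      where
      y+< : ∀ {z} → z + η < z + δ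
      y+< {z} = 0<⇒< (<⇒0< η<δ) (solve 3 (λ z δ η → z :+ η :- (z :+ δ) := η :- δ) refl z η δ)

  Around-map : ∀ {t} {P Q : Carrier → Set} → (∀ {u} → P u → Q u) → Around t P → Around t Q
  Around-map f (δ , 0<δ , p) = δ , 0<δ , λ u u∈I d → f (p u u∈I d)

  Continuous : (Carrier → Carrier) → Set
  Continuous φ = ∀ t → InUnit t → ∀ ε → 0# < ε → Around t (λ u → ∣ φ t - φ u ∣< ε)

  continuous-cong : ∀ {φ ψ} → (∀ t → φ t ≈ ψ t) → Continuous φ → Continuous ψ
  continuous-cong eq c t t∈I ε 0<ε = Around-map
    (λ {u} (a , b) → <-respˡ-≈ (eq t) (<-respʳ-≈ (+-congʳ (eq u)) a) ,
                     <-respˡ-≈ (eq u) (<-respʳ-≈ (+-congʳ (eq t)) b))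
    (c t t∈I ε 0<ε)

  continuous-const : ∀ k → Continuous (λ _ → k)
  continuous-const k t _ ε 0<ε = 1# , 0<1 , λ _ _ _ → x<x+ε 0<ε , x<x+ε 0<ε

  continuous-+ : ∀ {φ ψ} → Continuous φ → Continuous ψ → Continuous (λ t → φ t + ψ t)
  continuous-+ {φ} {ψ} c d t t∈I ε 0<ε = halves (half 0<ε)
    where
    add : ∀ {η w x y z} → η + η ≈ ε → w < x + η → y < z + η → w + y < x + z + ε
    add {η} {w} {x} {y} {z} 2η≈ε p q = 0<⇒< (+-pos (<⇒0< p) (<⇒0< q))
      (combination (- 1#) 2η≈ε (solve 6 (λ w x y z η ε →
        x :+ z :+ ε :- (w :+ y) :- (x :+ η :- w :+ (z :+ η :- y)) :=
        :- con (+ 1) :* (η :+ η :- ε)) refl w x y z η ε))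
    halves : ∃[ η ] (0# < η × η + η ≈ ε) → Around t (λ u → ∣ (φ t + ψ t) - (φ u + ψ u) ∣< ε)
    halves (η , 0<η , 2η≈ε) =
      Around-map₂ (λ (a , b) (a′ , b′) → add 2η≈ε a a′ , add 2η≈ε b b′) (c t t∈I η 0<η)
        (d t t∈I η 0<η)

  continuous-neg : ∀ {φ} → Continuous φ → Continuous (λ t → - φ t)
  continuous-neg c t t∈I ε 0<ε = Around-map (λ (a , b) → flip b , flip a) (c t t∈I ε 0<ε)
    where
    flip : ∀ {x y} → x < y + ε → - y < - x + ε
    flip {x} {y} p = 0<⇒< (<⇒0< p)
      (solve 3 (λ x y ε → :- x :+ ε :- :- y := y :+ ε :- x) refl x y ε)

  continuous-*-pos : ∀ {k φ} → 0# < k → Continuous φ → Continuous (λ t → k * φ t)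
  continuous-*-pos {k} 0<k c t t∈I ε 0<ε with i , 0<i , ki≈1 ← inverse-pos 0<k =
    Around-map (λ (a , b) → scale a , scale b) (c t t∈I (ε * i) (*-pos 0<ε 0<i))
    where
    scale : ∀ {x y} → x < y + ε * i → k * x < k * y + ε
    scale {x} {y} p = 0<⇒< (*-pos 0<k (<⇒0< p))
      (combination (- ε) ki≈1 (solve 5 (λ k i x y ε →
        k :* y :+ ε :- k :* x :- k :* (y :+ ε :* i :- x) := :- ε :* (k :* i :- con (+ 1)))
        refl k i x y ε))

  continuous-* : ∀ k {φ} → Continuous φ → Continuous (λ t → k * φ t)
  continuous-* k {φ} c with sgn k | hasSgn k
  ... | ⁻ | isNeg k<0  = continuous-cong
                           (λ t → solve 2 (λ k x → :- (:- k :* x) := k :* x) refl k (φ t))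
                           (continuous-neg (continuous-*-pos (neg⇒0< k<0) c))
  ... | ⁰ | isZero k≈0 = continuous-cong (λ t → sym (trans (*-congʳ k≈0) (zeroˡ (φ t))))
                           (continuous-const 0#)
  ... | ⁺ | isPos 0<k  = continuous-*-pos 0<k c

  -- Continuity is applied with ε = |φ t|, the distance to zero.
  sgn-locally-constant : ∀ {φ} → Continuous φ → ∀ {t} → InUnit t → ¬ (φ t ≈ 0#) →
    Around t (λ u → sgn (φ u) ≡ sgn (φ t))
  sgn-locally-constant {φ} c {t} t∈I φt≉0 with sgn (φ t) | hasSgn (φ t)
  ... | ⁰ | isZero φt≈0 = contradiction φt≈0 φt≉0
  ... | ⁻ | isNeg φt<0  = Around-map
    (λ (_ , b) → sgn-≡ (isNeg (<-respʳ-≈ (-‿inverseʳ (φ t)) b))) (c t t∈I (- φ t) (neg⇒0< φt<0))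
  ... | ⁺ | isPos 0<φt  = Around-map
    (λ {u} (a , _) → sgn-≡ (isPos (0<⇒< (<⇒0< a)
      (solve 2 (λ x y → y :- con (+ 0) := y :+ x :- x) refl (φ t) (φ u))))) (c t t∈I (φ t) 0<φt)

  LocallyConstant : (Carrier → Bool) → Set
  LocallyConstant b = ∀ t → InUnit t → Around t (λ u → b u ≡ b t)

  0∈I : InUnit 0#
  0∈I = inj₂ refl , inj₁ 0<1

  1∈I : InUnit 1#
  1∈I = inj₁ 0<1 , inj₂ refl

  -- This is where completeness enters: σ is the supremum of all t at which `b` has its value at
  -- `0#`. That set is not assumed to be an interval.
  unit-connected : ∀ {b} → LocallyConstant b → b 0# ≡ b 1#
  unit-connected {b} lc
    with σ , upper , least ← supremum (λ t → InUnit t × b t ≡ b 0#)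
           (0# , 0∈I , ≡.refl) (1# , λ _ (t∈I , _) → proj₂ t∈I)
    = reach (lc σ σ∈I)
    where
    σ∈I : InUnit σ
    σ∈I = upper 0# (0∈I , ≡.refl) , least 1# (λ _ (t∈I , _) → proj₂ t∈I)

    bσ≡b0 : Around σ (λ u → b u ≡ b σ) → b σ ≡ b 0#
    bσ≡b0 (δ , 0<δ , near) with b σ Bool.≟ b 0#
    ... | yes eq = eq
    -- If the value at σ were different, it would be so on the whole δ-neighbourhood, and σ - δ
    -- would be a smaller upper bound.
    ... | no bσ≢b0 = contradiction (0<⇒< 0<δ (solve 2 (λ σ δ → σ :- (σ :- δ) := δ) refl σ δ))
                       (≤⇒≯ (least (σ - δ) below))
      where
      below : ∀ t → InUnit t × b t ≡ b 0# → t ≤ σ - δ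
      below t (t∈I , bt≡b0) = ≮⇒≥ λ σ-δ<t → bσ≢b0 (≡.trans (≡.sym (near t t∈I
        ( 0<⇒< (<⇒0< σ-δ<t) (solve 3 (λ σ δ t → t :+ δ :- σ := t :- (σ :- δ)) refl σ δ t)
        , ≤-<-trans (upper t (t∈I , bt≡b0)) (x<x+ε 0<δ)))) bt≡b0)

    beyond : ∀ {δ η} → η + η ≈ δ → 0# < η → σ + η < σ + δ
    beyond {δ} {η} 2η≈δ 0<η = 0<⇒< 0<η (combination (- 1#) 2η≈δ (solve 3 (λ σ η δ →
      σ :+ δ :- (σ :+ η) :- η := :- con (+ 1) :* (η :+ η :- δ)) refl σ η δ))

    reach : Around σ (λ u → b u ≡ b σ) → b 0# ≡ b 1#
    reach around@(δ , 0<δ , near) = step (1# <? σ + δ) (half 0<δ)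
      where
      step : Dec (1# < σ + δ) → ∃[ η ] (0# < η × η + η ≈ δ) → b 0# ≡ b 1#
      step (yes 1<σ+δ) _ = ≡.sym (≡.trans
        (near 1# 1∈I (≤-<-trans (proj₂ σ∈I) (x<x+ε 0<δ) , 1<σ+δ)) (bσ≡b0 around))
      -- With η = δ/2 the point σ + η is still in the neighbourhood and in the unit interval, so the
      -- value persists beyond the supremum.
      step (no 1≮σ+δ) (η , 0<η , 2η≈δ) =
        contradiction (x<x+ε 0<η) (≤⇒≯ (upper (σ + η) (σ+η∈I , ≡.trans
          (near (σ + η) σ+η∈I (<.trans (x<x+ε 0<η) (x<x+ε 0<δ) , beyond 2η≈δ 0<η)) (bσ≡b0 around))))
        where
        <-≤-trans : ∀ {x y z} → x < y → y ≤ z → x < z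
        <-≤-trans x<y (inj₁ y<z) = <.trans x<y y<z
        <-≤-trans x<y (inj₂ y≈z) = <-respʳ-≈ y≈z x<y
        σ+η∈I : InUnit (σ + η)
        σ+η∈I = inj₁ (≤-<-trans (proj₁ σ∈I) (x<x+ε 0<η)) ,
                inj₁ (<-≤-trans (beyond 2η≈δ 0<η) (≮⇒≥ 1≮σ+δ))

-- The cone relation `w` and a turning direction

module Winding (ℝ : CompleteOrderedField) (𝔩 : Plabic.Point ℝ) where
  open Plabic ℝ
  open OrderedField ℝ
  open Continuity ℝ
  open Signs

  cross-cong : ∀ {a a′ b b′} → a ≈ₚ a′ → b ≈ₚ b′ → cross a b ≈ cross a′ b′
  cross-cong (ax , ay) (bx , by) = +-cong (*-cong ax by) (-‿cong (*-cong ay bx))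

  cross-antisym : ∀ a b → cross a b ≈ - cross b a
  cross-antisym (a , b) (c , d) = solve 4 (λ a b c d →
    a :* d :- b :* c := :- (c :* b :- d :* a)) refl a b c d

  sgn-cross-opp : ∀ a b → sgn (cross a b) ≡ opp (sgn (cross b a))
  sgn-cross-opp a b = ≡.trans (sgn-cong (cross-antisym a b)) (sgn-opp (cross b a))

  grassmann-plücker : ∀ a b c d →
    cross a b * cross c d + cross a c * cross d b + cross a d * cross b c ≈ 0#
  grassmann-plücker (a , b) (c , d) (e , f) (g , h) = solve 8 (λ a b c d e f g h →
    (a :* d :- b :* c) :* (e :* h :- f :* g) :+ (a :* f :- b :* e) :* (g :* d :- h :* c)
      :+ (a :* h :- b :* g) :* (c :* f :- d :* e) := con (+ 0)) refl a b c d e f g h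

  -- The Plücker relation read off in signs. In this form the geometry of four directions enters the
  -- finite checks.
  cross-balanced : ∀ a b c d → Balanced (sgn (cross a b) · sgn (cross c d))
    (sgn (cross a c) · sgn (cross d b)) (sgn (cross a d) · sgn (cross b c))
  cross-balanced a b c d = ≡.subst₂ (λ p (q , r) → Balanced p q r)
    (sgn-* _ _) (≡.cong₂ _,_ (sgn-* _ _) (sgn-* _ _))
    (sgn-balanced (grassmann-plücker a b c d))

  -- Cramer's rule as a linear dependence. Where a coefficient vanishes, `dropˡ` or `dropᵐ` leaves
  -- two vectors, and the signs of their coefficients tell whether they are opposite.
  relation : ∀ a b c → cross b c • a ⊕ cross c a • b ⊕ cross a b • c ≈ₚ (0# , 0#)
  relation (a , b) (c , d) (e , f) =
    solve 6 (λ a b c d e f →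
      (c :* f :- d :* e) :* a :+ (e :* b :- f :* a) :* c :+ (a :* d :- b :* c) :* e := con (+ 0))
      refl a b c d e f ,
    solve 6 (λ a b c d e f →
      (c :* f :- d :* e) :* b :+ (e :* b :- f :* a) :* d :+ (a :* d :- b :* c) :* f := con (+ 0))
      refl a b c d e f

  cancel-* : ∀ {x y} → ¬ (x ≈ 0#) → x * y ≈ 0# → y ≈ 0#
  cancel-* {x} {y} x≉0 xy≈0 with i , xi≈1 ← inverse x≉0 =
    combination i xy≈0 (trans (solve 1 (λ y → y :- con (+ 0) := con (+ 1) :* y) refl y)
      (trans (*-congʳ (sym xi≈1)) (solve 3 (λ x i y → x :* i :* y := i :* (x :* y :- con (+ 0)))
        refl x i y)))

  side : Point → Sgn
  side a = sgn (cross 𝔩 a)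

  w : Point → Point → Bool
  w a b = turns (side a) (side b) (sgn (cross a b))

  w-cong : ∀ {a a′ b b′} → a ≈ₚ a′ → b ≈ₚ b′ → w a b ≡ w a′ b′
  w-cong a≈ b≈ rewrite sgn-cong (cross-cong {𝔩} (refl , refl) a≈)
    | sgn-cong (cross-cong {𝔩} (refl , refl) b≈) | sgn-cong (cross-cong a≈ b≈) = ≡.refl

  w-sym : ∀ a b → w a b ≡ w b a
  w-sym a b = ≡.trans (turns-sym (side a) (side b) (sgn (cross a b)))
    (≡.cong (turns (side b) (side a)) (≡.sym (sgn-cross-opp b a)))

  side≢⁰ : ∀ {a} → ¬ Parallel 𝔩 a → side a ≢ ⁰
  side≢⁰ ∦ eq = ∦ (sgn-zero eq)

  -- x is opposite to f, or zero.
  Opposed : Point → Point → Set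
  Opposed x f = ∃[ α ] ∃[ β ] (0# < α × 0# ≤ β × α • x ⊕ β • f ≈ₚ (0# , 0#))

  opposed : ∀ {x f} a b → sgn a ≢ ⁰ → sgn b ≢ opp (sgn a) → a • x ⊕ b • f ≈ₚ (0# , 0#) →
    Opposed x f
  opposed {x} {f} a b a≢⁰ b≢ (e₁ , e₂) with sgn a | hasSgn a
  ... | ⁰ | _         = contradiction ≡.refl a≢⁰
  ... | ⁺ | isPos 0<a = a , b , 0<a , sgn≢⁻ b≢ , e₁ , e₂
  ... | ⁻ | isNeg a<0 = - a , - b , neg⇒0< a<0 , sgn≢⁻ -b≢⁻ , flip e₁ , flip e₂
    where
    -b≢⁻ : sgn (- b) ≢ ⁻
    -b≢⁻ eq = b≢ (lemma _ (≡.trans (≡.sym (sgn-opp b)) eq))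
      where
      lemma : ∀ p → opp p ≡ ⁻ → p ≡ ⁺
      lemma = decide
    flip : ∀ {x y} → a * x + b * y ≈ 0# → (- a) * x + (- b) * y ≈ 0#
    flip {x} {y} e = combination (- 1#) e (solve 4 (λ a b x y →
      :- a :* x :+ :- b :* y :- con (+ 0) := :- con (+ 1) :* (a :* x :+ b :* y :- con (+ 0)))
      refl a b x y)

  dropˡ : ∀ {a b c : Carrier} {p q r : Point} → a ≈ 0# →
    a • p ⊕ b • q ⊕ c • r ≈ₚ (0# , 0#) → c • r ⊕ b • q ≈ₚ (0# , 0#)
  dropˡ {a} {b} {c} a≈0 (e₁ , e₂) = drop e₁ , drop e₂
    where
    drop : ∀ {x y z} → a * x + b * y + c * z ≈ 0# → c * z + b * y ≈ 0#
    drop {x} e = trans (trans (+-comm _ _) (+-congʳ (sym (trans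
      (+-congʳ (trans (*-congʳ a≈0) (zeroˡ x))) (+-identityˡ _))))) e

  dropᵐ : ∀ {a b c : Carrier} {p q r : Point} → b ≈ 0# →
    a • p ⊕ b • q ⊕ c • r ≈ₚ (0# , 0#) → c • r ⊕ a • p ≈ₚ (0# , 0#)
  dropᵐ {a} {b} {c} b≈0 (e₁ , e₂) = drop e₁ , drop e₂
    where
    drop : ∀ {x y z} → a * x + b * y + c * z ≈ 0# → c * z + a * x ≈ 0#
    drop {x} {y} e = trans (trans (+-comm _ _) (+-congʳ (sym (trans
      (+-congˡ (trans (*-congʳ b≈0) (zeroˡ y))) (+-identityʳ _))))) e

  Continuousₚ : (Carrier → Point) → Set
  Continuousₚ x = Continuous (λ t → proj₁ (x t)) × Continuous (λ t → proj₂ (x t))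

  continuous-cross : ∀ f {x} → Continuousₚ x → Continuous (λ t → cross f (x t))
  continuous-cross (f₁ , f₂) (c₁ , c₂) =
    continuous-+ (continuous-* f₁ c₂) (continuous-neg (continuous-* f₂ c₁))

  module _ {x : Carrier → Point} (continuous : Continuousₚ x)
           (∦₀ : ¬ Parallel 𝔩 (x 0#)) (∦₁ : ¬ Parallel 𝔩 (x 1#)) where

    Avoids : Point → Set
    Avoids f = ∀ t → InUnit t → ¬ Opposed (x t) f

    private
      InvariantDifference : Point → Point → Set
      InvariantDifference f g = w f (x 0#) xor w g (x 0#) ≡ w f (x 1#) xor w g (x 1#)

    module _ {f g : Point} (0<fg : 0# < cross f g) (avoids-f : Avoids f) (avoids-g : Avoids g) where
      private
        gx xf : Carrier → Carrier
        gx t = cross g (x t)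
        xf t = cross (x t) f

        -- By `relation f g (x t)`, this says that x lies in the open cone opposite to that of f and
        -- g. Unlike `w`, it is independent of 𝔩 and so remains meaningful while x is parallel to 𝔩.
        between : Carrier → Bool
        between t = positive (sgn (gx t)) ∧ positive (sgn (xf t))

        -- The coefficient of g in the linear dependence vanishes; if that of f were not negative, x
        -- would be opposite to f.
        xf≡⁰⇒gx≡⁻ : ∀ {t} → InUnit t → sgn (xf t) ≡ ⁰ → sgn (gx t) ≡ ⁻
        xf≡⁰⇒gx≡⁻ {t} t∈I xf≡⁰ with sgn (gx t) ≟ ⁻
        ... | yes eq = eq
        ... | no gx≢⁻ = contradiction
          (_ , _ , 0<fg , sgn≢⁻ gx≢⁻ , dropᵐ (sgn-zero xf≡⁰) (relation f g (x t)))
          (avoids-f t t∈I)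

        gx≡⁰⇒xf≡⁻ : ∀ {t} → InUnit t → sgn (gx t) ≡ ⁰ → sgn (xf t) ≡ ⁻
        gx≡⁰⇒xf≡⁻ {t} t∈I gx≡⁰ with sgn (xf t) ≟ ⁻
        ... | yes eq = eq
        ... | no xf≢⁻ = contradiction
          (_ , _ , 0<fg , sgn≢⁻ xf≢⁻ , dropˡ (sgn-zero gx≡⁰) (relation f g (x t)))
          (avoids-g t t∈I)

        continuous-gx : Continuous gx
        continuous-gx = continuous-cross g continuous

        continuous-xf : Continuous xf
        continuous-xf = continuous-cong (λ t → sym (cross-antisym (x t) f))
          (continuous-neg (continuous-cross f continuous))

        keeps : ∀ {φ} → Continuous φ → ∀ {t} → InUnit t → ∀ {p} → sgn (φ t) ≡ p → p ≢ ⁰ →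
          Around t (λ u → sgn (φ u) ≡ sgn (φ t))
        keeps c t∈I eq p≢⁰ = sgn-locally-constant c t∈I λ φt≈0 →
          p≢⁰ (≡.trans (≡.sym eq) (sgn-≡ (isZero φt≈0)))

        -- On the border of the opposite cone one sign would vanish and the other would not be
        -- negative. This is excluded: where one sign vanishes, the other is negative and stays so,
        -- which makes `between` false nearby.
        locallyConstant : LocallyConstant between
        locallyConstant t t∈I with sgn (gx t) ≟ ⁰ | sgn (xf t) ≟ ⁰
        ... | no gx≢⁰ | no xf≢⁰ =
          Around-map₂ (≡.cong₂ λ p q → positive p ∧ positive q)
            (keeps continuous-gx t∈I ≡.refl gx≢⁰) (keeps continuous-xf t∈I ≡.refl xf≢⁰)
        ... | yes gx≡⁰ | _ = Around-map
          (λ {u} eq → ≡.trans (outside (≡.trans eq xf≡⁻) (gx u)) (≡.sym (outside xf≡⁻ (gx t))))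
          (keeps continuous-xf t∈I xf≡⁻ λ ())
          where
          xf≡⁻ = gx≡⁰⇒xf≡⁻ t∈I gx≡⁰
          outside : ∀ {q} → q ≡ ⁻ → ∀ y → positive (sgn y) ∧ positive q ≡ false
          outside ≡.refl _ = Bool.∧-zeroʳ _
        ... | no _ | yes xf≡⁰ = Around-map
          (λ {u} eq → ≡.trans (outside (≡.trans eq gx≡⁻) (xf u)) (≡.sym (outside gx≡⁻ (xf t))))
          (keeps continuous-gx t∈I gx≡⁻ λ ())
          where
          gx≡⁻ = xf≡⁰⇒gx≡⁻ t∈I xf≡⁰
          outside : ∀ {p} → p ≡ ⁻ → ∀ y → positive p ∧ positive (sgn y) ≡ false
          outside ≡.refl _ = ≡.refl

        -- Confines the dependence on time to `between`. It applies only when `x t` is not parallel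
        -- to 𝔩, which is known at `0#` and `1#`; the connectedness argument bridges the times
        -- between.
        triangle : ∀ {t} → InUnit t → ¬ Parallel 𝔩 (x t) →
          w f (x t) xor w g (x t) ≡ turns (side f) (side g) ⁺ xor between t
        triangle {t} t∈I ∦ = ≡.trans
          (≡.cong (λ p → turns (side f) (side (x t)) p xor w g (x t)) (sgn-cross-opp f (x t)))
          (turns-triangle (side f) (side g) (side (x t)) (sgn (gx t)) (sgn (xf t)) (side≢⁰ ∦)
            (≡.subst (λ p → Balanced (side f · sgn (gx t)) (side g · sgn (xf t)) (side (x t) · p))
              (sgn-≡ (isPos 0<fg)) (cross-balanced 𝔩 f g (x t)))
            (xf≡⁰⇒gx≡⁻ t∈I) (gx≡⁰⇒xf≡⁻ t∈I))

      invariant-transverse : InvariantDifference f g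
      invariant-transverse = ≡.trans (triangle 0∈I ∦₀) (≡.trans
        (≡.cong (turns (side f) (side g) ⁺ xor_) (unit-connected locallyConstant))
        (≡.sym (triangle 1∈I ∦₁)))

    module _ {f g : Point} (fg≈0 : cross f g ≈ 0#) (𝔩∦f : ¬ Parallel 𝔩 f) (g≉0 : ¬ (g ≈ₚ (0# , 0#)))
             (avoids-f : Avoids f) (avoids-g : Avoids g) where
      private
        gx xf : Carrier → Carrier
        gx t = cross g (x t)
        xf t = cross (x t) f

        side-g≢⁰ : side g ≢ ⁰
        side-g≢⁰ eq = g≉0 (vanish (proj₁ e) , vanish (proj₂ e))
          where
          e : cross 𝔩 f • g ⊕ cross g 𝔩 • f ≈ₚ (0# , 0#)
          e = dropˡ fg≈0 (relation 𝔩 f g)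
          vanish : ∀ {y z} → cross 𝔩 f * z + cross g 𝔩 * y ≈ 0# → z ≈ 0#
          vanish {y} {z} e = cancel-* 𝔩∦f (trans (sym (trans (+-congˡ (trans (*-congʳ (trans
            (cross-antisym g 𝔩) (-‿cong (sgn-zero eq))))
              (solve 1 (λ y → :- con (+ 0) :* y := con (+ 0)) refl y)))
            (+-identityʳ _))) e)

        balanced-fgx : ∀ t → Balanced (side f · sgn (gx t)) (side g · sgn (xf t)) ⁰
        balanced-fgx t = ≡.subst (Balanced _ _) (·-⁰ (side (x t)) (sgn-≡ (isZero fg≈0)))
          (cross-balanced 𝔩 f g (x t))
          where
          ·-⁰ : ∀ p {q} → q ≡ ⁰ → p · q ≡ ⁰
          ·-⁰ ⁻ ≡.refl = ≡.refl
          ·-⁰ ⁰ ≡.refl = ≡.refl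
          ·-⁰ ⁺ ≡.refl = ≡.refl

        opp-xf : ∀ t → w f (x t) xor w g (x t) ≡
          turns (side f) (side (x t)) (opp (sgn (xf t))) xor
          turns (side g) (side (x t)) (sgn (gx t))
        opp-xf t = ≡.cong (λ p → turns (side f) (side (x t)) p xor w g (x t))
          (sgn-cross-opp f (x t))

        parallel : side f ≡ side g → ∀ {t} → ¬ Parallel 𝔩 (x t) → w f (x t) xor w g (x t) ≡ false
        parallel eq {t} ∦ = ≡.trans (opp-xf t) (lemma (≡.sym eq) (balanced-fgx t))
          where
          lemma : ∀ {lg} → lg ≡ side f → Balanced (side f · sgn (gx t)) (lg · sgn (xf t)) ⁰ →
            turns (side f) (side (x t)) (opp (sgn (xf t))) xor
              turns lg (side (x t)) (sgn (gx t)) ≡ false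
          lemma ≡.refl = turns-parallel (side f) (side (x t)) _ _ (side≢⁰ 𝔩∦f) (side≢⁰ ∦)

        module _ (g≡opp : side g ≡ opp (side f)) where

          -- f and g point in opposite directions, so an x parallel to them would be opposite to one
          -- of them. The sign of `cross (x t) 𝔩`, the coefficient of f or g in the dependence with
          -- x, tells which.
          xf≉0 : ∀ {t} → InUnit t → ¬ (xf t ≈ 0#)
          xf≉0 {t} t∈I xf≈0 with sgn (cross (x t) 𝔩) ≟ opp (side f)
          ... | no ≢opp-f = avoids-f t t∈I (opposed _ _ (side≢⁰ 𝔩∦f) ≢opp-f
            (dropˡ (trans (cross-antisym f (x t)) (trans (-‿cong xf≈0) -0≈0)) (relation 𝔩 f (x t))))
            where
            -0≈0 : - 0# ≈ 0#
            -0≈0 = solve 0 (:- con (+ 0) := con (+ 0)) refl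
          ... | yes ≡opp-f = avoids-g t t∈I (opposed _ _ side-g≢⁰
            (λ eq → ≢opp side-g≢⁰ (≡.trans g≡opp (≡.trans (≡.sym ≡opp-f) eq)))
            (dropˡ (sgn-zero (gx≡⁰ (side f) (sgn (gx t)) (side g) (side≢⁰ 𝔩∦f)
              (≡.subst (λ p → Balanced (side f · sgn (gx t)) (side g · p) ⁰)
                (sgn-≡ (isZero xf≈0)) (balanced-fgx t))))
              (relation 𝔩 g (x t))))
            where
            ≢opp : ∀ {p} → p ≢ ⁰ → p ≢ opp p
            ≢opp {⁻} _ ()
            ≢opp {⁰} p≢⁰ _ = p≢⁰ ≡.refl
            ≢opp {⁺} _ ()
            gx≡⁰ : ∀ p q r → p ≢ ⁰ → Balanced (p · q) (r · ⁰) ⁰ → q ≡ ⁰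
            gx≡⁰ = decide

          antiparallel : ∀ {t} → InUnit t → ¬ Parallel 𝔩 (x t) →
            w f (x t) xor w g (x t) ≡ positive (side f · sgn (xf t))
          antiparallel {t} t∈I ∦ = ≡.trans (opp-xf t) (lemma g≡opp (balanced-fgx t))
            where
            lemma : ∀ {lg} → lg ≡ opp (side f) →
              Balanced (side f · sgn (gx t)) (lg · sgn (xf t)) ⁰ →
              turns (side f) (side (x t)) (opp (sgn (xf t))) xor turns lg (side (x t)) (sgn (gx t))
                ≡ positive (side f · sgn (xf t))
            lemma ≡.refl = turns-antiparallel (side f) (side (x t)) _ _ (side≢⁰ 𝔩∦f) (side≢⁰ ∦)
              (λ eq → xf≉0 t∈I (sgn-zero eq))

          constant : positive (side f · sgn (xf 0#)) ≡ positive (side f · sgn (xf 1#))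
          constant = unit-connected λ t t∈I → Around-map (≡.cong (λ p → positive (side f · p)))
            (sgn-locally-constant (continuous-cong (λ t → sym (cross-antisym (x t) f))
              (continuous-neg (continuous-cross f continuous))) t∈I (xf≉0 t∈I))

      invariant-parallel : InvariantDifference f g
      invariant-parallel with side f ≟ side g
      ... | yes eq = ≡.trans (parallel eq ∦₀) (≡.sym (parallel eq ∦₁))
      ... | no f≢g = ≡.trans (antiparallel g≡opp 0∈I ∦₀)
                       (≡.trans (constant g≡opp) (≡.sym (antiparallel g≡opp 1∈I ∦₁)))
        where
        g≡opp : side g ≡ opp (side f)
        g≡opp = ≡-opp (side≢⁰ 𝔩∦f) side-g≢⁰ f≢g

    -- The hypotheses on f and g are asymmetric because f will be an edge direction, whereas g will
    -- be the chord, which may be parallel to 𝔩.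
    w-difference-invariant : ∀ {f g} → ¬ Parallel 𝔩 f → ¬ (g ≈ₚ (0# , 0#)) → Avoids f → Avoids g →
      w f (x 0#) xor w g (x 0#) ≡ w f (x 1#) xor w g (x 1#)
    w-difference-invariant {f} {g} 𝔩∦f g≉0 avoids-f avoids-g with compare 0# (cross f g)
    ... | tri< 0<fg _ _ = invariant-transverse 0<fg avoids-f avoids-g
    ... | tri≈ _ 0≈fg _ = invariant-parallel (sym 0≈fg) 𝔩∦f g≉0 avoids-f avoids-g
    ... | tri> _ _ fg<0 = ≡.trans (Bool.xor-comm (w f (x 0#)) (w g (x 0#))) (≡.trans
      (invariant-transverse (<-respʳ-≈ (sym (cross-antisym g f)) (neg⇒0< fg<0)) avoids-g avoids-f)
      (Bool.xor-comm (w g (x 1#)) (w f (x 1#))))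

-- Rays and segments in the half-plane beside the boundary segment

module Rays (ℝ : CompleteOrderedField) (𝔩 : Plabic.Point ℝ) where
  open Plabic ℝ
  open OrderedField ℝ
  open Continuity ℝ
  open Signs
  open Winding ℝ 𝔩

  w-sum : ∀ {a b h} → a ⊕ b ≈ₚ h → ¬ Parallel 𝔩 a → ¬ Parallel 𝔩 b → w a b ≡ w a h xor w h b
  w-sum {a@(a₁ , a₂)} {b@(b₁ , b₂)} {h} a+b≈h 𝔩∦a 𝔩∦b = ≡.trans
    (turns-sum (side a) (side b) (side h) (sgn (cross a b)) (side≢⁰ 𝔩∦a) (side≢⁰ 𝔩∦b)
      (≡.subst (λ p → Balanced (side a) (side b) (opp p)) (sgn-cong 𝔩h) (sgn-+ _ _)))
    (≡.cong₂ (λ p q → turns (side a) (side h) p xor turns (side h) (side b) q) (sgn-cong ah)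
      (sgn-cong hb))
    where
    𝔩h : cross 𝔩 a + cross 𝔩 b ≈ cross 𝔩 h
    𝔩h = trans (solve 6 (λ l m a b c d → l :* b :- m :* a :+ (l :* d :- m :* c) :=
      l :* (b :+ d) :- m :* (a :+ c)) refl (proj₁ 𝔩) (proj₂ 𝔩) a₁ a₂ b₁ b₂)
      (cross-cong {𝔩} (refl , refl) a+b≈h)
    ah : cross a b ≈ cross a h
    ah = trans (solve 4 (λ a b c d → a :* d :- b :* c := a :* (b :+ d) :- b :* (a :+ c))
      refl a₁ a₂ b₁ b₂) (cross-cong {a} (refl , refl) a+b≈h)
    hb : cross a b ≈ cross h b
    hb = trans (solve 4 (λ a b c d → a :* d :- b :* c := (a :+ c) :* d :- (b :+ d) :* c)
      refl a₁ a₂ b₁ b₂) (cross-cong {b = b} a+b≈h (refl , refl))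

  -- One coordinate of b + t l = p + r (q - p), solved by t = -K / (M (α + β)) and r = β / (α + β);
  -- `i` and `j` are the inverses of α + β and M.
  coordinate : ∀ {α β i j M K b p q l} → (α + β) * i ≈ 1# → M * j ≈ 1# →
    M * (α * (p - b) + β * (q - b)) + K * l ≈ 0# →
    b + (- K) * i * j * l ≈ p + β * i * (q - p)
  coordinate {α} {β} {i} {j} {M} {K} {b} {p} {q} {l} i⁻¹ j⁻¹ e = RayIntersection.solve-coord b p _ _
    (trans (+-cong along (-‿cong (*-congˡ q-p))) weights)
    where
    X Y : Carrier
    X = p - b
    Y = q - b
    q-p : q - p ≈ Y - X
    q-p = solve 3 (λ b p q → q :- p := q :- b :- (p :- b)) refl b p q
    along : (- K) * i * j * l ≈ i * (α * X + β * Y)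
    along = combination₂ (- (i * j)) (i * (α * X + β * Y)) e j⁻¹
      (solve 6 (λ M K l i j D → :- K :* i :* j :* l :- i :* D :=
        :- (i :* j) :* (M :* D :+ K :* l :- con (+ 0)) :+ i :* D :* (M :* j :- con (+ 1)))
        refl M K l i j (α * X + β * Y))
    weights : i * (α * X + β * Y) - β * i * (Y - X) ≈ X
    weights = combination X i⁻¹ (solve 5 (λ i α β X Y →
      i :* (α :* X :+ β :* Y) :- β :* i :* (Y :- X) :- X := X :* ((α :+ β) :* i :- con (+ 1)))
      refl i α β X Y)

  -- `T` will be the direction of the boundary segment, which has the disk on its right. A negative
  -- cross product with `T` thus means pointing towards the disk.
  module HalfPlane {T : Point} (T𝔩<0 : cross T 𝔩 < 0#) where

    w-inward : ∀ {e h} → cross T e < 0# → cross T h ≤ 0# → ¬ Parallel 𝔩 e →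
      (cross T h ≈ 0# → ¬ Parallel 𝔩 h) → w e h ≡ left (side e) xor left (side h)
    w-inward {e} {h} Te<0 Th≤0 𝔩∦e 𝔩∦h =
      turns-inward (side e) (side h) (sgn (cross T h)) (sgn (cross e h)) (side≢⁰ 𝔩∦e)
        (λ eq → ≤⇒≯ Th≤0 (sgn-pos eq)) (λ eq → side≢⁰ (𝔩∦h (sgn-zero eq)))
        (≡.subst₂ (λ p (q , r) → Balanced (p · sgn (cross e h)) (q · r) (sgn (cross T h) · side e))
          (sgn-≡ (isNeg T𝔩<0)) (≡.cong₂ _,_ (sgn-≡ (isNeg Te<0)) (sgn-cross-opp h 𝔩))
          (cross-balanced T 𝔩 e h))

    w-outward : ∀ {h g} → 0# ≤ cross T h → 0# < cross T g → ¬ Parallel 𝔩 g → w h g ≡ false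
    w-outward {h} {g} 0≤Th 0<Tg 𝔩∦g =
      turns-outward (side h) (side g) (sgn (cross T h)) (sgn (cross h g)) (side≢⁰ 𝔩∦g)
        (λ eq → ≤⇒≯ 0≤Th (sgn-neg eq))
        (≡.subst₂ (λ p (q , r) → Balanced (p · sgn (cross h g)) (sgn (cross T h) · r) (q · side h))
          (sgn-≡ (isNeg T𝔩<0)) (≡.cong₂ _,_ (sgn-≡ (isPos 0<Tg)) (sgn-cross-opp g 𝔩))
          (cross-balanced T 𝔩 h g))

    module _ {b p q : Point} where
      private
        x y : Point
        x = p ⊝ b
        y = q ⊝ b
        _∙_ : Carrier → Carrier → Point
        α ∙ β = α • x ⊕ β • y

      -- Divided by α + β, the vector `α ∙ β` leads from b to a point of the segment. Being on the
      -- line of 𝔩 it is a multiple of 𝔩, with the factor -cross T (α ∙ β) / cross 𝔩 T, which is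
      -- positive.
      rayMeets⁺ : ∀ {α β} → 0# < α → 0# < β → cross 𝔩 (α ∙ β) ≈ 0# → cross T (α ∙ β) < 0# →
        RayMeets b 𝔩 p q
      rayMeets⁺ {α} {β} 0<α 0<β on-line inside = meets (inverse-pos (+-pos 0<α 0<β))
        (inverse-pos (<-respʳ-≈ (sym (cross-antisym 𝔩 T)) (neg⇒0< T𝔩<0)))
        (dropᵐ {cross T (α ∙ β)} {cross (α ∙ β) 𝔩} (trans (cross-antisym (α ∙ β) 𝔩)
           (trans (-‿cong on-line) (solve 0 (:- con (+ 0) := con (+ 0)) refl)))
           (relation 𝔩 T (α ∙ β)))
        where
        meets : ∃[ i ] (0# < i × (α + β) * i ≈ 1#) → ∃[ j ] (0# < j × cross 𝔩 T * j ≈ 1#) →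
          cross 𝔩 T • (α ∙ β) ⊕ cross T (α ∙ β) • 𝔩 ≈ₚ (0# , 0#) → RayMeets b 𝔩 p q
        meets (i , 0<i , i⁻¹) (j , 0<j , j⁻¹) (e₁ , e₂) =
          (- cross T (α ∙ β)) * i * j , *-pos (*-pos (neg⇒0< inside) 0<i) 0<j ,
          β * i , (inj₁ (*-pos 0<β 0<i) , inj₁ β*i<1) , coordinate i⁻¹ j⁻¹ e₁ ,
          coordinate i⁻¹ j⁻¹ e₂
          where
          β*i<1 : β * i < 1#
          β*i<1 = 0<⇒< (*-pos 0<α 0<i) (combination (- 1#) i⁻¹ (solve 3 (λ α β i →
            con (+ 1) :- β :* i :- α :* i := :- con (+ 1) :* ((α :+ β) :* i :- con (+ 1)))
            refl α β i))

      rayMeets⁻ : RayMeets b 𝔩 p q →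
        ∃[ α ] ∃[ β ] (0# ≤ α × 0# ≤ β × α + β ≈ 1# × cross 𝔩 (α ∙ β) ≈ 0#)
      rayMeets⁻ (t , _ , r , (0≤r , r≤1) , e₁ , e₂) = 1# - r , r , complement r≤1 , 0≤r ,
        solve 1 (λ r → con (+ 1) :- r :+ r := con (+ 1)) refl r ,
        trans (cross-cong {𝔩} (refl , refl) (multiple e₁ , multiple e₂))
          (solve 3 (λ l m t → l :* (t :* m) :- m :* (t :* l) := con (+ 0)) refl (proj₁ 𝔩)
            (proj₂ 𝔩) t)
        where
        complement : ∀ {r} → r ≤ 1# → 0# ≤ 1# - r
        complement (inj₁ r<1) = inj₁ (<⇒0< r<1)
        complement (inj₂ r≈1) = inj₂ (sym (trans (+-congˡ (-‿cong r≈1)) (-‿inverseʳ 1#)))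
        multiple : ∀ {b p q l} → b + t * l ≈ p + r * (q - p) →
          (1# - r) * (p - b) + r * (q - b) ≈ t * l
        multiple {b} {p} {q} {l} e = combination (- 1#) e (solve 6 (λ b p q l t r →
          (con (+ 1) :- r) :* (p :- b) :+ r :* (q :- b) :- t :* l :=
          :- con (+ 1) :* (b :+ t :* l :- (p :+ r :* (q :- p)))) refl b p q l t r)

      cross-∙ : ∀ a α β → cross a (α ∙ β) ≈ α * cross a x + β * cross a y
      cross-∙ (a₁ , a₂) α β = solve 8 (λ a₁ a₂ α β x₁ x₂ y₁ y₂ →
        a₁ :* (α :* x₂ :+ β :* y₂) :- a₂ :* (α :* x₁ :+ β :* y₁) :=
        α :* (a₁ :* x₂ :- a₂ :* x₁) :+ β :* (a₁ :* y₂ :- a₂ :* y₁))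
        refl a₁ a₂ α β (proj₁ x) (proj₂ x) (proj₁ y) (proj₂ y)

      same-side : ∀ {p′} → p′ ≢ ⁰ → HasSgn (cross 𝔩 x) p′ → HasSgn (cross 𝔩 y) p′ →
        ¬ RayMeets b 𝔩 p q
      same-side {p′} p′≢⁰ hx hy meets = absurd (rayMeets⁻ meets)
        where
        product : ∀ {a z r} → HasSgn z r → sgn (a * z) ≡ sgn a · r
        product {a} {z} h = ≡.trans (sgn-* a z) (≡.cong (sgn a ·_) (sgn-≡ h))
        impossible : ∀ u v r → r ≢ ⁰ → u ≢ ⁻ → v ≢ ⁻ → Balanced u v (opp ⁺) →
          Balanced (u · r) (v · r) (opp ⁰) → ⊥
        impossible = decide
        absurd : ¬ (∃[ α ] ∃[ β ] (0# ≤ α × 0# ≤ β × α + β ≈ 1# × cross 𝔩 (α ∙ β) ≈ 0#))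
        absurd (α , β , 0≤α , 0≤β , α+β≈1 , on-line) =
          impossible (sgn α) (sgn β) p′ p′≢⁰ (λ eq → ≤⇒≯ 0≤α (sgn-neg eq))
            (λ eq → ≤⇒≯ 0≤β (sgn-neg eq))
            (≡.subst (λ r → Balanced (sgn α) (sgn β) (opp r))
              (sgn-≡ (isPos (<-respʳ-≈ (sym α+β≈1) 0<1))) (sgn-+ α β))
            (≡.subst₂ (λ u (v , r) → Balanced u v (opp r)) (product hx)
              (≡.cong₂ _,_ (product hy) (sgn-≡ (isZero (trans (sym (cross-∙ 𝔩 α β)) on-line))))
              (sgn-+ (α * cross 𝔩 x) (β * cross 𝔩 y)))

      rayMeets-sides : (∦ : ¬ Parallel 𝔩 (q ⊝ p)) → side x ≢ ⁰ → side y ≢ ⁰ →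
        (∀ {α β} → 0# < α → 0# < β → α * cross T x + β * cross T y < 0#) →
        does (rayMeets? b 𝔩 p q ∦) ≡ left (side x) xor left (side y)
      rayMeets-sides ∦ x≢⁰ y≢⁰ inside
        with sgn (cross 𝔩 x) | hasSgn (cross 𝔩 x) | sgn (cross 𝔩 y) | hasSgn (cross 𝔩 y)
      ... | ⁰ | _ | _ | _ = contradiction ≡.refl x≢⁰
      ... | ⁻ | _ | ⁰ | _ = contradiction ≡.refl y≢⁰
      ... | ⁺ | _ | ⁰ | _ = contradiction ≡.refl y≢⁰
      -- The line of 𝔩 divides the segment in the ratio of the distances of its ends from the line,
      -- so the weight of each end is the absolute value of `cross 𝔩` at the other one.
      ... | ⁻ | isNeg lx<0 | ⁺ | isPos 0<ly = dec-true (rayMeets? b 𝔩 p q ∦)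
        (rayMeets⁺ 0<ly (neg⇒0< lx<0)
          (trans (cross-∙ 𝔩 (cross 𝔩 y) (- cross 𝔩 x))
            (solve 2 (λ u v → v :* u :+ :- u :* v := con (+ 0)) refl (cross 𝔩 x) (cross 𝔩 y)))
          (<-respˡ-≈ (sym (cross-∙ T _ _)) (inside 0<ly (neg⇒0< lx<0))))
      ... | ⁺ | isPos 0<lx | ⁻ | isNeg ly<0 = dec-true (rayMeets? b 𝔩 p q ∦)
        (rayMeets⁺ (neg⇒0< ly<0) 0<lx
          (trans (cross-∙ 𝔩 (- cross 𝔩 y) (cross 𝔩 x))
            (solve 2 (λ u v → :- v :* u :+ u :* v := con (+ 0)) refl (cross 𝔩 x) (cross 𝔩 y)))
          (<-respˡ-≈ (sym (cross-∙ T _ _)) (inside (neg⇒0< ly<0) 0<lx)))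
      ... | ⁻ | hx | ⁻ | hy = dec-false (rayMeets? b 𝔩 p q ∦) (same-side (λ ()) hx hy)
      ... | ⁺ | hx | ⁺ | hy = dec-false (rayMeets? b 𝔩 p q ∦) (same-side (λ ()) hx hy)

-- Consequences of planarity, and heights over the boundary segment

module Embedding (ℝ : CompleteOrderedField) (𝔩 : Plabic.Point ℝ) (disk : Plabic.Disk ℝ)
  {n} (G : PlabicGraph n) {pos : PlabicGraph.Vertex G → Plabic.Point ℝ}
  (isEmbedding : Plabic.IsEmbedding ℝ disk G pos) where
  open Plabic ℝ
  open OrderedField ℝ
  open Winding ℝ 𝔩
  open Signs
  open Disk disk
  open PlabicGraph G
  open IsEmbedding isEmbedding

  ∂ : Edge → Point
  ∂ e = pos (target e) ⊝ pos (source e)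

  combination-on-segment : ∀ {α β p q r} → 0# ≤ α → 0# ≤ β → 0# < α + β →
    (α + β) • r ≈ₚ α • p ⊕ β • q → OnSegment p q r
  combination-on-segment {α} {β} {p} {q} {r} 0≤α 0≤β 0<α+β (e₁ , e₂) = on (inverse-pos 0<α+β)
    where
    *-nonneg : ∀ {x y} → 0# ≤ x → 0# < y → 0# ≤ x * y
    *-nonneg (inj₁ 0<x) 0<y = inj₁ (*-pos 0<x 0<y)
    *-nonneg {x} {y} (inj₂ 0≈x) _ = inj₂ (trans (sym (zeroˡ y)) (*-congʳ 0≈x))
    on : ∃[ i ] (0# < i × (α + β) * i ≈ 1#) → OnSegment p q r
    on (i , 0<i , i⁻¹) = β * i , (*-nonneg 0≤β 0<i , β*i≤1 (*-nonneg 0≤α 0<i)) ,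
      coordinate e₁ , coordinate e₂
      where
      1-β*i : 1# - β * i ≈ α * i
      1-β*i = combination (- 1#) i⁻¹ (solve 3 (λ α β i →
        con (+ 1) :- β :* i :- α :* i := :- con (+ 1) :* ((α :+ β) :* i :- con (+ 1))) refl α β i)
      β*i≤1 : 0# ≤ α * i → β * i ≤ 1#
      β*i≤1 (inj₁ 0<αi) = inj₁ (0<⇒< 0<αi 1-β*i)
      β*i≤1 (inj₂ 0≈αi) = inj₂ (combination (- 1#) (trans 1-β*i (sym 0≈αi)) (solve 2 (λ β i →
        β :* i :- con (+ 1) := :- con (+ 1) :* (con (+ 1) :- β :* i :- con (+ 0))) refl β i))
      coordinate : ∀ {p q r} → (α + β) * r ≈ α * p + β * q → r ≈ p + β * i * (q - p)
      coordinate {p} {q} {r} e = combination₂ i (p - r) e i⁻¹ (solve 6 (λ α β i p q r →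
        r :- (p :+ β :* i :* (q :- p)) := i :* ((α :+ β) :* r :- (α :* p :+ β :* q))
          :+ (p :- r) :* ((α :+ β) :* i :- con (+ 1))) refl α β i p q r)

  -- Straight edges with the same two ends share their midpoint, but distinct edges meet at most in
  -- ends.
  no-2-cycle : ∀ {e f} → source e ≡ target f → target e ≢ source f
  no-2-cycle {e} {f} e←f e→f = meets (half 0<1)
    where
    e≢f : e ≢ f
    e≢f ≡.refl = no-loops e e←f
    meets : ∃[ η ] (0# < η × η + η ≈ 1#) → ⊥
    meets (η , 0<η , 2η≈1) = absurd (edges-meet e f e≢f m
      (combination-on-segment (inj₁ 0<η) (inj₁ 0<η) (+-pos 0<η 0<η) (middle , middle))
      (≡.subst₂ (λ u v → OnSegment (pos u) (pos v) m) e→f e←f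
        (combination-on-segment (inj₁ 0<η) (inj₁ 0<η) (+-pos 0<η 0<η) (middle′ , middle′))))
      where
      m : Point
      m = η • pos (source e) ⊕ η • pos (target e)
      middle : ∀ {p q} → (η + η) * (η * p + η * q) ≈ η * p + η * q
      middle = trans (*-congʳ 2η≈1) (*-identityˡ _)
      middle′ : ∀ {p q} → (η + η) * (η * p + η * q) ≈ η * q + η * p
      middle′ = trans middle (+-comm _ _)
      pos-e : pos (source e) ≈ₚ pos (target e) → ⊥
      pos-e eq = no-loops e (injective _ _ eq)
      absurd : ¬ (∃[ v ] (IsEndpoint v e × IsEndpoint v f × m ≈ₚ pos v))
      absurd (_ , inj₁ ≡.refl , _ , e₁ , e₂) = pos-e (other e₁ , other e₂)
        where
        other : ∀ {p q} → η * p + η * q ≈ p → p ≈ q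
        other {p} {q} eq = combination₂ (- (1# + 1#)) (p + q) eq 2η≈1 (solve 3 (λ η p q →
          p :- q := :- (con (+ 1) :+ con (+ 1)) :* (η :* p :+ η :* q :- p)
            :+ (p :+ q) :* (η :+ η :- con (+ 1))) refl η p q)
      absurd (_ , inj₂ ≡.refl , _ , e₁ , e₂) = pos-e (other e₁ , other e₂)
        where
        other : ∀ {p q} → η * p + η * q ≈ q → p ≈ q
        other {p} {q} eq = combination₂ (1# + 1#) (- (p + q)) eq 2η≈1 (solve 3 (λ η p q →
          p :- q := (con (+ 1) :+ con (+ 1)) :* (η :* p :+ η :* q :- q)
            :+ :- (p :+ q) :* (η :+ η :- con (+ 1))) refl η p q)

  -- If f folded back along e, the far end of the shorter edge would lie on the longer one. As the
  -- lengths satisfy α|e| = β|f|, comparing α with β tells which is shorter.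
  no-U-turn : ∀ {e f α β} → target e ≡ source f → 0# ≤ α → 0# ≤ β → 0# < α + β →
    ¬ (α • ∂ e ⊕ β • ∂ f ≈ₚ (0# , 0#))
  no-U-turn {e} {f} {α} {β} e→f 0≤α 0≤β 0<α+β (e₁ , e₂) = by-length (α <? β)
    where
    to-f : ∀ {p u u′ q} → u ≈ u′ → α * (u - p) + β * (q - u′) ≈ 0# →
      ((α - β) + β) * p ≈ (α - β) * u′ + β * q
    to-f {p} {u} {u′} {q} u≈u′ e = combination₂ (- 1#) α e u≈u′ (solve 6 (λ α β p u u′ q →
      (α :- β :+ β) :* p :- ((α :- β) :* u′ :+ β :* q) :=
      :- con (+ 1) :* (α :* (u :- p) :+ β :* (q :- u′) :- con (+ 0)) :+ α :* (u :- u′))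
      refl α β p u u′ q)
    to-e : ∀ {p u u′ q} → u ≈ u′ → α * (u - p) + β * (q - u′) ≈ 0# →
      (α + (β - α)) * q ≈ α * p + (β - α) * u
    to-e {p} {u} {u′} {q} u≈u′ e = combination₂ 1# (- β) e u≈u′ (solve 6 (λ α β p u u′ q →
      (α :+ (β :- α)) :* q :- (α :* p :+ (β :- α) :* u) :=
      con (+ 1) :* (α :* (u :- p) :+ β :* (q :- u′) :- con (+ 0)) :+ :- β :* (u :- u′))
      refl α β p u u′ q)
    pos-u : pos (target e) ≈ₚ pos (source f)
    pos-u rewrite e→f = refl , refl
    by-length : Dec (α < β) → ⊥
    by-length (yes α<β) = meets (vertex-on-edge (target f) e (combination-on-segment
      0≤α (inj₁ (<⇒0< α<β)) (<-respʳ-≈ (solve 2 (λ α β → β := α :+ (β :- α)) refl α β)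
        (≤-<-trans 0≤α α<β)) (to-e (proj₁ pos-u) e₁ , to-e (proj₂ pos-u) e₂)))
      where
      meets : ¬ IsEndpoint (target f) e
      meets (inj₁ f→e) = no-2-cycle (≡.sym f→e) e→f
      meets (inj₂ eq)  = no-loops f (≡.sym (≡.trans eq e→f))
    by-length (no α≮β) = meets (vertex-on-edge (source e) f (combination-on-segment
      (0≤- (≮⇒≥ α≮β)) 0≤β (<-respʳ-≈ (solve 2 (λ α β → α := α :- β :+ β) refl α β)
        (0<α (≮⇒≥ α≮β) 0≤α))
      (to-f (proj₁ pos-u) e₁ , to-f (proj₂ pos-u) e₂)))
      where
      0≤- : β ≤ α → 0# ≤ α - β
      0≤- (inj₁ β<α) = inj₁ (<⇒0< β<α)
      0≤- (inj₂ β≈α) = inj₂ (sym (trans (+-congˡ (-‿cong β≈α)) (-‿inverseʳ α)))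
      0<α : β ≤ α → 0# ≤ α → 0# < α
      0<α (inj₁ β<α) _          = ≤-<-trans 0≤β β<α
      0<α (inj₂ _)   (inj₁ 0<α) = 0<α
      0<α (inj₂ β≈α) (inj₂ 0≈α) = <-respʳ-≈ (trans (+-congˡ (trans β≈α (sym 0≈α)))
        (+-identityʳ α)) 0<α+β
      meets : ¬ IsEndpoint (source e) f
      meets (inj₁ eq)  = no-loops e (≡.trans eq (≡.sym e→f))
      meets (inj₂ f→e) = no-2-cycle f→e e→f

  module _ {e g : Edge} (e→g : target e ≡ source g) where

    chord : Point
    chord = pos (target g) ⊝ pos (source e)

    private
      pos-v : pos (target e) ≈ₚ pos (source g)
      pos-v rewrite e→g = refl , refl

    chord-sum : ∂ e ⊕ ∂ g ≈ₚ chord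
    chord-sum = add (proj₁ pos-v) , add (proj₂ pos-v)
      where
      add : ∀ {a v v′ b} → v ≈ v′ → v - a + (b - v′) ≈ b - a
      add {a} {v} {v′} {b} v≈v′ = combination 1# v≈v′ (solve 4 (λ a v v′ b →
        v :- a :+ (b :- v′) :- (b :- a) := con (+ 1) :* (v :- v′)) refl a v v′ b)

    chord≉0 : ¬ (chord ≈ₚ (0# , 0#))
    chord≉0 (e₁ , e₂) = no-2-cycle (≡.sym (injective _ _ (equal e₁ , equal e₂))) e→g
      where
      equal : ∀ {x y} → x - y ≈ 0# → x ≈ y
      equal {x} {y} e = combination 1# e
        (solve 2 (λ x y → x :- y := con (+ 1) :* (x :- y :- con (+ 0))) refl x y)

    -- Such a dependence puts the source of e on the segment from the common vertex to the target of
    -- g, which is the edge g. In `outgoing-avoids-chord` the target of g comes to lie on e instead.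
    incoming-avoids-chord : ¬ Opposed (∂ e) chord
    incoming-avoids-chord (α , β , 0<α , 0≤β , e₁ , e₂) =
      meets (vertex-on-edge (source e) g (combination-on-segment (inj₁ 0<α) 0≤β
        (<-respʳ-≈ (+-comm β α) (+-nonneg-pos 0≤β 0<α))
        (on-g (proj₁ pos-v) e₁ , on-g (proj₂ pos-v) e₂)))
      where
      on-g : ∀ {a v v′ b} → v ≈ v′ → α * (v - a) + β * (b - a) ≈ 0# → (α + β) * a ≈ α * v′ + β * b
      on-g {a} {v} {v′} {b} v≈v′ e = combination₂ (- 1#) α e v≈v′ (solve 6 (λ α β a v v′ b →
        (α :+ β) :* a :- (α :* v′ :+ β :* b) :=
        :- con (+ 1) :* (α :* (v :- a) :+ β :* (b :- a) :- con (+ 0)) :+ α :* (v :- v′))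
        refl α β a v v′ b)
      meets : ¬ IsEndpoint (source e) g
      meets (inj₁ eq)  = no-loops e (≡.trans eq (≡.sym e→g))
      meets (inj₂ g→e) = no-2-cycle g→e e→g

    outgoing-avoids-chord : ¬ Opposed (∂ g) chord
    outgoing-avoids-chord (α , β , 0<α , 0≤β , e₁ , e₂) =
      meets (vertex-on-edge (target g) e (combination-on-segment 0≤β (inj₁ 0<α)
        (+-nonneg-pos 0≤β 0<α) (on-e (proj₁ pos-v) e₁ , on-e (proj₂ pos-v) e₂)))
      where
      on-e : ∀ {a v v′ b} → v ≈ v′ → α * (b - v′) + β * (b - a) ≈ 0# → (β + α) * b ≈ β * a + α * v
      on-e {a} {v} {v′} {b} v≈v′ e = combination₂ 1# (- α) e v≈v′ (solve 6 (λ α β a v v′ b →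
        (β :+ α) :* b :- (β :* a :+ α :* v) :=
        con (+ 1) :* (α :* (b :- v′) :+ β :* (b :- a) :- con (+ 0)) :+ :- α :* (v :- v′))
        refl α β a v v′ b)
      meets : ¬ IsEndpoint (target g) e
      meets (inj₁ g→e) = no-2-cycle (≡.sym g→e) e→g
      meets (inj₂ eq)  = no-loops g (≡.sym (≡.trans eq e→g))

  T : Point
  T = end ⊝ start

  -- Up to the length of `T`, the signed distance from the line of the boundary segment, negative
  -- inside the disk.
  height : Vertex → Carrier
  height v = cross T (pos v ⊝ start)

  interior-below : ∀ {p} → Interior D p → sgn (cross T (p ⊝ start)) ≡ ⁻
  interior-below inside = toℤ≡-1 _ (≡.trans (≡.sym (s-sgn T _)) (clockwise _ inside))
    where
    toℤ≡-1 : ∀ p → toℤ p ≡ -1ℤ → p ≡ ⁻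
    toℤ≡-1 ⁻ _ = ≡.refl

  height-internal : ∀ v → height (inj₂ v) < 0#
  height-internal v = sgn-neg (interior-below (internal-inside v))

  height-boundary : ∀ i → height (inj₁ i) ≈ 0#
  height-boundary i with e₁ , e₂ ← boundary-position i =
    trans (cross-cong {T} (refl , refl) (along e₁ , along e₂))
      (solve 3 (λ a b t → a :* (t :* b) :- b :* (t :* a) := con (+ 0)) refl (proj₁ T) (proj₂ T)
        (τ i))
    where
    along : ∀ {b s d} → b ≈ s + d → b - s ≈ d
    along {b} {s} {d} e = combination 1# e
      (solve 3 (λ b s d → b :- s :- d := con (+ 1) :* (b :- (s :+ d))) refl b s d)

  cross-T-difference : ∀ u v → cross T (pos u ⊝ pos v) ≈ height u - height v
  cross-T-difference u v = difference (proj₁ T) (proj₂ T) (proj₁ start) (proj₂ start)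
    (proj₁ (pos u)) (proj₂ (pos u)) (proj₁ (pos v)) (proj₂ (pos v))
    where
    difference : ∀ a b c d x y x′ y′ →
      a * (y - y′) - b * (x - x′) ≈ (a * (y - d) - b * (x - c)) - (a * (y′ - d) - b * (x′ - c))
    difference = solve 8 (λ a b c d x y x′ y′ → a :* (y :- y′) :- b :* (x :- x′) :=
      (a :* (y :- d) :- b :* (x :- c)) :- (a :* (y′ :- d) :- b :* (x′ :- c))) refl

-- Counting modulo 2, and edges at a vertex of given degree

module Xor where
  open import Algebra.Properties.CommutativeMonoid.Sum
    (CommutativeRing.+-commutativeMonoid Bool.xor-∧-commutativeRing) public

  sum-delta : ∀ {m} (j : Fin m) c → sum (λ i → if does (j Fin.≟ i) then c else false) ≡ c
  sum-delta {suc m} Fin.zero c = ≡.trans (≡.cong (c xor_) (sum-replicate-zero m))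
    (Bool.xor-identityʳ c)
  sum-delta (Fin.suc j) c = sum-delta j c

odd-length-filter : ∀ {m} {A : Set} {P : A → Set} (P? : ∀ a → Dec (P a)) (f : Fin m → A) →
  odd (length (filter P? (tabulate f))) ≡ Xor.sum (λ i → does (P? (f i)))
odd-length-filter {zero} P? f = ≡.refl
odd-length-filter {suc m} P? f with does (P? (f Fin.zero))
... | true  = ≡.cong not (odd-length-filter P? (f ∘ Fin.suc))
... | false = odd-length-filter P? (f ∘ Fin.suc)

-- Induction by deleting the head x from `ys`. This shortens `ys`, which contains x, and keeps the
-- tail of `xs`, which does not.
unique⊆⇒length≤ : ∀ {m} {xs ys : List (Fin m)} → Unique xs → All (_∈ ys) xs →
  length xs ℕ.≤ length ys
unique⊆⇒length≤ [] [] = z≤n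
unique⊆⇒length≤ {xs = x ∷ xs} {ys} (x∉xs ∷ unique) (x∈ys ∷ xs⊆ys) = ℕ.<-≤-trans
  (s≤s (unique⊆⇒length≤ unique (All.zipWith (λ (x≢y , y∈ys) → ∈-filter⁺ ≢x? y∈ys (x≢y ∘ ≡.sym))
    (x∉xs , xs⊆ys))))
  (List.filter-notAll ≢x? ys (lose x∈ys (λ x≢x → x≢x ≡.refl)))
  where
  ≢x? : ∀ y → Dec (y ≢ x)
  ≢x? y = ¬? (y Fin.≟ x)

module Incidence {n} (G : PlabicGraph n) where
  open PlabicGraph G

  module _ (end : Edge → Vertex) (v : Vertex) where

    incident : List Edge
    incident = filter (λ e → end e ≟ᵛ v) (allFin #edges)

    length≤incident : ∀ {es} → Unique es → All (λ e → end e ≡ v) es → length es ℕ.≤ length incident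
    length≤incident unique all =
      unique⊆⇒length≤ unique (All.map (∈-filter⁺ (λ e → end e ≟ᵛ v) (∈-allFin _)) all)

    only-one : ∀ {e f} → length incident ≡ 1 → end e ≡ v → end f ≡ v → f ≡ e
    only-one {e} {f} deg e∼v f∼v with f Fin.≟ e
    ... | yes eq = eq
    ... | no f≢e = contradiction (≡.subst (2 ℕ.≤_) deg
      (length≤incident ((f≢e ∷ []) ∷ [] ∷ []) (f∼v ∷ e∼v ∷ []))) λ { (s≤s ()) }

    only-two : ∀ {e₁ e₂ f} → length incident ≡ 2 → e₁ ≢ e₂ → end e₁ ≡ v → end e₂ ≡ v → end f ≡ v →
      f ≡ e₁ ⊎ f ≡ e₂
    only-two {e₁} {e₂} {f} deg e₁≢e₂ e₁∼v e₂∼v f∼v with f Fin.≟ e₁ | f Fin.≟ e₂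
    ... | yes eq | _ = inj₁ eq
    ... | no _ | yes eq = inj₂ eq
    ... | no f≢e₁ | no f≢e₂ = contradiction (≡.subst (3 ℕ.≤_) deg
      (length≤incident ((f≢e₁ ∷ f≢e₂ ∷ []) ∷ (e₁≢e₂ ∷ []) ∷ [] ∷ []) (f∼v ∷ e₁∼v ∷ e₂∼v ∷ [])))
      λ { (s≤s (s≤s ())) }

  source≢sink : ∀ {i e f} → source e ≡ inj₁ i → target f ≢ inj₁ i
  source≢sink {i} e∼i f∼i = contradiction (≡.subst (2 ℕ.≤_) (boundary-degree i)
    (ℕ.+-mono-≤ (length≤incident target (inj₁ i) ([] ∷ []) (f∼i ∷ []))
                (length≤incident source (inj₁ i) ([] ∷ []) (e∼i ∷ [])))) λ { (s≤s ()) }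

-- Winding and intersection parities of a single network

module Gauge (ℝ : CompleteOrderedField) {disk : Plabic.Disk ℝ} {n} (N : Plabic.Network ℝ disk n)
  {𝔩 : Plabic.Point ℝ} (γ : Plabic.IsGaugeDirection ℝ N 𝔩) where
  open Plabic ℝ
  open OrderedField ℝ
  open Winding ℝ 𝔩
  open Rays ℝ 𝔩
  open Signs
  open Disk disk
  open Network N
  open IsGaugeDirection γ
  open Embedding ℝ 𝔩 disk graph isEmbedding
  open IsEmbedding isEmbedding using (injective)
  open Incidence graph

  odd-wind : ∀ e f → odd ∣ wind N 𝔩 e f ∣ ≡ w (direction e) (direction f)
  odd-wind e f = ≡.trans
    (≡.cong₂ (λ p (q , r) → odd ∣ if does ((p ℤ.≟ q) ×-dec (p ℤ.≟ r)) then p else 0ℤ ∣)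
      (s-sgn (direction e) (direction f))
      (≡.cong₂ _,_ (≡.trans (s-sgn (direction e) 𝔩) (≡.cong toℤ (sgn-cross-opp (direction e) 𝔩)))
                   (s-sgn 𝔩 (direction f))))
    (turns-wind (side (direction e)) (side (direction f))
      (sgn (cross (direction e) (direction f))) (side≢⁰ (not-parallel e)) (side≢⁰ (not-parallel f)))

  T𝔩<0 : Internal → cross T 𝔩 < 0#
  -- That 𝔩 points inward is given at boundary vertices; one exists because `v` is connected to the
  -- boundary.
  T𝔩<0 v = from-inward (proj₁ (not-isolated v))
    where
    from-inward : Fin n → cross T 𝔩 < 0#
    from-inward i = negative-factor (inward i)
      where
      raise : ∀ a b c d x y s l m → a * (y + s * m - d) - b * (x + s * l - c) ≈
        s * (a * m - b * l) + (a * (y - d) - b * (x - c))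
      raise = solve 9 (λ a b c d x y s l m → a :* (y :+ s :* m :- d) :- b :* (x :+ s :* l :- c) :=
        s :* (a :* m :- b :* l) :+ (a :* (y :- d) :- b :* (x :- c))) refl
      opposite : ∀ {t} → 0# < t → sgn (t * cross T 𝔩) ≡ ⁻ → sgn (cross T 𝔩) ≡ ⁻
      opposite {t} 0<t eq = ≡.trans (≡.cong (_· sgn (cross T 𝔩)) (≡.sym (sgn-≡ (isPos 0<t))))
        (≡.trans (≡.sym (sgn-* t (cross T 𝔩))) eq)
      negative-factor : ∃[ t ] (0# < t × Interior D (pos (inj₁ i) ⊕ t • 𝔩)) → cross T 𝔩 < 0#
      negative-factor (t , 0<t , inside) = sgn-neg (opposite 0<t (≡.trans
        (sgn-cong (sym (trans (raise (proj₁ T) (proj₂ T) (proj₁ start) (proj₂ start)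
          (proj₁ (pos (inj₁ i))) (proj₂ (pos (inj₁ i))) t (proj₁ 𝔩) (proj₂ 𝔩))
          (trans (+-congˡ (height-boundary i)) (+-identityʳ _)))))
        (interior-below inside)))

  meets : Fin n → Edge → Bool
  meets i e = does (rayMeets? (pos (inj₁ i)) 𝔩 (pos (source e)) (pos (target e)) (not-parallel e))

  leftOf : Fin n → Vertex → Bool
  leftOf i v = left (side (pos v ⊝ pos (inj₁ i)))

  -- The ray and e leave the same point in directions that are not parallel, so they share only this
  -- point, which is not counted.
  meets-base : ∀ i e → source e ≡ inj₁ i →
    meets i e ≡ false
  meets-base i e e∼i = dec-false (rayMeets? _ 𝔩 _ _ (not-parallel e)) no-meeting
    where
    base : pos (inj₁ i) ≈ₚ pos (source e)
    base rewrite e∼i = refl , refl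
    no-meeting : ¬ RayMeets (pos (inj₁ i)) 𝔩 (pos (source e)) (pos (target e))
    no-meeting (t , 0<t , r , _ , e₁ , e₂) = nonzero
      (vanish (tl e₁ (proj₁ base)) , vanish (tl e₂ (proj₂ base)))
      where
      tl : ∀ {b l p d} → b + t * l ≈ p + r * d → b ≈ p → t * l ≈ r * d
      tl {b} {l} {p} {d} e b≈p = combination₂ 1# (- 1#) e b≈p (solve 6 (λ b t l p r d →
        t :* l :- r :* d := con (+ 1) :* (b :+ t :* l :- (p :+ r :* d)) :+ :- con (+ 1) :* (b :- p))
        refl b t l p r d)
      r≈0 : r ≈ 0#
      r≈0 = cancel-* (not-parallel e) (cross-r (proj₁ 𝔩) (proj₂ 𝔩) _ _ (tl e₁ (proj₁ base))
        (tl e₂ (proj₂ base)))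
        where
        cross-r : ∀ l m d d′ → t * l ≈ r * d → t * m ≈ r * d′ → (l * d′ - m * d) * r ≈ 0#
        cross-r l m d d′ e₁ e₂ = combination₂ m (- l) e₁ e₂ (solve 6 (λ l m d d′ t r →
          (l :* d′ :- m :* d) :* r :- con (+ 0) := m :* (t :* l :- r :* d)
            :+ :- l :* (t :* m :- r :* d′))
          refl l m d d′ t r)
      vanish : ∀ {l d} → t * l ≈ r * d → l ≈ 0#
      vanish {l} {d} e = cancel-* (0≢ 0<t) (trans e (trans (*-congʳ r≈0) (zeroˡ d)))

  module _ (v₀ : Internal) where
    open HalfPlane (T𝔩<0 v₀)

    height≤0 : ∀ v → height v ≤ 0#
    height≤0 (inj₁ i) = inj₂ (height-boundary i)
    height≤0 (inj₂ v) = inj₁ (height-internal v)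

    -- `m` is the inverse of `cross 𝔩 T`, so the coefficient of 𝔩 has the sign of `- height v`. As
    -- no vertex has positive height, a vertex on the line lies on the ray itself.
    on-gauge-line : ∀ i v → cross 𝔩 (pos v ⊝ pos (inj₁ i)) ≈ 0# →
      ∃[ m ] (0# < m × pos v ≈ₚ pos (inj₁ i) ⊕ (- height v * m) • 𝔩)
    on-gauge-line i v on-line = scale (inverse-pos
      (<-respʳ-≈ (sym (cross-antisym 𝔩 T)) (neg⇒0< (T𝔩<0 v₀))))
      where
      Δ : Point
      Δ = pos v ⊝ pos (inj₁ i)
      TΔ : cross T Δ ≈ height v
      TΔ = trans (cross-T-difference v (inj₁ i)) (combination (- 1#) (height-boundary i)
        (solve 2 (λ x y → x :- y :- x := :- con (+ 1) :* (y :- con (+ 0))) refl (height v)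
          (height (inj₁ i))))
      e : cross 𝔩 T • Δ ⊕ cross T Δ • 𝔩 ≈ₚ (0# , 0#)
      e = dropᵐ (trans (cross-antisym Δ 𝔩) (trans (-‿cong on-line)
        (solve 0 (:- con (+ 0) := con (+ 0)) refl))) (relation 𝔩 T Δ)
      coordinate′ : ∀ {M m H K p b l} → M * m ≈ 1# → K ≈ H → M * (p - b) + K * l ≈ 0# →
        p ≈ b + (- H) * m * l
      coordinate′ {M} {m} {H} {K} {p} {b} {l} m⁻¹ K≈H e = combination₂ (b - p) m m⁻¹
        (trans (+-congˡ (*-congʳ (sym K≈H))) e)
        (solve 6 (λ M m H p b l → p :- (b :+ :- H :* m :* l) :=
          (b :- p) :* (M :* m :- con (+ 1)) :+ m :* (M :* (p :- b) :+ H :* l :- con (+ 0)))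
          refl M m H p b l)
      scale : ∃[ m ] (0# < m × cross 𝔩 T * m ≈ 1#) →
        ∃[ m ] (0# < m × pos v ≈ₚ pos (inj₁ i) ⊕ (- height v * m) • 𝔩)
      scale (m , 0<m , m⁻¹) = m , 0<m , coordinate′ m⁻¹ TΔ (proj₁ e) , coordinate′ m⁻¹ TΔ (proj₂ e)

    -- By the sign just found, an internal vertex on the line would be on the ray, against
    -- `avoids-internal`. A boundary vertex on the line has height zero and hence is the base point.
    off-gauge-line : ∀ i v → v ≢ inj₁ i → ¬ Parallel 𝔩 (pos v ⊝ pos (inj₁ i))
    off-gauge-line i (inj₂ v) _ on-line = on-ray (on-gauge-line i (inj₂ v) on-line)
      where
      on-ray : ¬ (∃[ m ] (0# < m × pos (inj₂ v) ≈ₚ pos (inj₁ i) ⊕ (- height (inj₂ v) * m) • 𝔩))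
      on-ray (m , 0<m , e) = avoids-internal i v _ (inj₁ (*-pos (neg⇒0< (height-internal v)) 0<m)) e
    off-gauge-line i (inj₁ j) j≢i on-line = coincide (on-gauge-line i (inj₁ j) on-line)
      where
      coincide : ¬ (∃[ m ] (0# < m × pos (inj₁ j) ≈ₚ pos (inj₁ i) ⊕ (- height (inj₁ j) * m) • 𝔩))
      coincide (m , _ , e₁ , e₂) = j≢i (injective _ _ (trans e₁ base , trans e₂ base))
        where
        base : ∀ {b l} → b + (- height (inj₁ j)) * m * l ≈ b
        base {b} {l} = combination (- (m * l)) (height-boundary j) (solve 4 (λ b H m l →
          b :+ :- H :* m :* l :- b := :- (m :* l) :* (H :- con (+ 0))) refl b (height (inj₁ j)) m l)

    -- The opposite ray need not be considered, as it lies outside D.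
    meets-sides : ∀ i e → source e ≢ inj₁ i → target e ≢ inj₁ i →
      (height (source e) < 0# ⊎ height (target e) < 0#) →
      meets i e ≡ leftOf i (source e) xor leftOf i (target e)
    meets-sides i e s≢i t≢i below = rayMeets-sides (not-parallel e)
      (side≢⁰ (off-gauge-line i (source e) s≢i)) (side≢⁰ (off-gauge-line i (target e) t≢i))
      λ 0<α 0<β → 0<⇒neg (<-respʳ-≈ (rearrange _ _ (height-above (source e))
        (height-above (target e)))
        (positive-combination 0<α 0<β below))
      where
      height-above : ∀ v → cross T (pos v ⊝ pos (inj₁ i)) ≈ height v
      height-above v = trans (cross-T-difference v (inj₁ i)) (combination (- 1#) (height-boundary i)
        (solve 2 (λ x y → x :- y :- x := :- con (+ 1) :* (y :- con (+ 0))) refl (height v)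
          (height (inj₁ i))))
      rearrange : ∀ α β {x y x′ y′} → x ≈ x′ → y ≈ y′ → α * - x′ + β * - y′ ≈ - (α * x + β * y)
      rearrange α β {x} {y} {x′} {y′} e₁ e₂ = combination₂ α β e₁ e₂ (solve 6 (λ α β x y x′ y′ →
        α :* :- x′ :+ β :* :- y′ :- :- (α :* x :+ β :* y) := α :* (x :- x′) :+ β :* (y :- y′))
        refl α β x y x′ y′)
      -*-nonneg : ∀ {α} v → 0# < α → 0# ≤ α * - height v
      -*-nonneg v 0<α = scale (height≤0 v)
        where
        scale : height v ≤ 0# → 0# ≤ _ * - height v
        scale (inj₁ h<0) = inj₁ (*-pos 0<α (neg⇒0< h<0))
        scale (inj₂ h≈0) = inj₂ (sym (trans (*-congˡ (-‿cong h≈0))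
          (solve 1 (λ α → α :* :- con (+ 0) := con (+ 0)) refl _)))
      positive-combination : ∀ {α β} → 0# < α → 0# < β →
        (height (source e) < 0# ⊎ height (target e) < 0#) →
        0# < α * - height (source e) + β * - height (target e)
      positive-combination 0<α 0<β (inj₂ t<0) =
        +-nonneg-pos (-*-nonneg (source e) 0<α) (*-pos 0<β (neg⇒0< t<0))
      positive-combination 0<α 0<β (inj₁ s<0) = <-respʳ-≈ (+-comm _ _)
        (+-nonneg-pos (-*-nonneg (target e) 0<β) (*-pos 0<α (neg⇒0< s<0)))

  -- A ray based at the source of e does not meet e; the side of the target of e
  -- then makes meets-consecutive hold for this ray too.
  leftOf-source : Fin n → Edge → Bool
  leftOf-source i e = if does (source e ≟ᵛ inj₁ i) then leftOf i (target e) else leftOf i (source e)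

  meets-consecutive : ∀ {v e g} → target e ≡ inj₂ v → source g ≡ inj₂ v → ∀ i → IsBoundarySource i →
    meets i e xor meets i g ≡ leftOf-source i e xor leftOf i (target g)
  meets-consecutive {v} {e} {g} e→v v→g i (_ , source-i) with source e ≟ᵛ inj₁ i
  ... | yes e∼i = ≡.trans (≡.cong₂ _xor_ (meets-base i e e∼i) meets-g)
    (≡.cong (λ u → leftOf i u xor leftOf i (target g)) (≡.trans v→g (≡.sym e→v)))
    where
    meets-g : meets i g ≡ leftOf i (source g) xor leftOf i (target g)
    meets-g = meets-sides v i g (λ g∼i → inner (≡.trans (≡.sym v→g) g∼i)) (source≢sink source-i)
      (inj₁ (≡.subst (λ u → height u < 0#) (≡.sym v→g) (height-internal v)))
      where
      inner : inj₂ v ≢ inj₁ i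
      inner ()
  ... | no e≁i = ≡.trans (≡.cong₂ _xor_
    (meets-sides v i e e≁i (source≢sink source-i)
      (inj₂ (≡.subst (λ u → height u < 0#) (≡.sym e→v) (height-internal v))))
    (meets-sides v i g (λ g∼i → inner (≡.trans (≡.sym v→g) g∼i)) (source≢sink source-i)
      (inj₁ (≡.subst (λ u → height u < 0#) (≡.sym v→g) (height-internal v)))))
    (cancel (leftOf i (source e)) (≡.cong (leftOf i) (≡.trans e→v (≡.sym v→g)))
      (leftOf i (target g)))
    where
    inner : inj₂ v ≢ inj₁ i
    inner ()
    cancel : ∀ a {b b′} → b ≡ b′ → ∀ c → (a xor b) xor (b′ xor c) ≡ a xor c
    cancel true  {true}  ≡.refl c = ≡.refl
    cancel true  {false} ≡.refl c = ≡.refl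
    cancel false {true}  ≡.refl c = Bool.not-involutive c
    cancel false {false} ≡.refl c = ≡.refl

  odd-int : ∀ e → odd (int N γ e) ≡ Xor.sum (λ i → does (isBoundarySource? i) ∧ meets i e)
  odd-int e = odd-length-filter (λ i → isBoundarySource? i ×-dec
    rayMeets? (pos (inj₁ i)) 𝔩 (pos (source e)) (pos (target e)) (not-parallel e)) id

  odd-int-consecutive : ∀ {v e g} → target e ≡ inj₂ v → source g ≡ inj₂ v →
    odd (int N γ e) xor odd (int N γ g) ≡
    Xor.sum (λ i → does (isBoundarySource? i) ∧ (leftOf-source i e xor leftOf i (target g)))
  odd-int-consecutive {v} {e} {g} e→v v→g = ≡.trans (≡.cong₂ _xor_ (odd-int e) (odd-int g))
    (≡.trans (≡.sym (Xor.∑-distrib-+ (λ i → does (isBoundarySource? i) ∧ meets i e) _))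
      (Xor.sum-cong-≗ λ i → ≡.trans (≡.sym (Bool.∧-distribˡ-xor (does (isBoundarySource? i))
        (meets i e) _))
        (under i (isBoundarySource? i))))
    where
    under : ∀ i (source? : Dec (IsBoundarySource i)) → does source? ∧ (meets i e xor meets i g) ≡
      does source? ∧ (leftOf-source i e xor leftOf i (target g))
    under i (yes source-i) = meets-consecutive e→v v→g i source-i
    under i (no _)         = ≡.refl

  outgoing-to-sink : ∀ {v g i} u → source g ≡ inj₂ v → target g ≡ inj₁ i →
    w (pos (target g) ⊝ pos u) (direction g) ≡ false
  outgoing-to-sink {v} {g} {i} u v→g g→i = HalfPlane.w-outward (T𝔩<0 v)
    (nonneg (height≤0 v u)) (<-respʳ-≈ (sym (drop (source g)))
      (neg⇒0< (≡.subst (λ u → height u < 0#) (≡.sym v→g) (height-internal v)))) (not-parallel g)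
    where
    drop : ∀ u → cross T (pos (target g) ⊝ pos u) ≈ - height u
    drop u = trans (cross-T-difference (target g) u) (combination 1#
      (≡.subst (λ u → height u ≈ 0#) (≡.sym g→i) (height-boundary i))
      (solve 2 (λ x y → x :- y :- :- y := con (+ 1) :* (x :- con (+ 0))) refl (height (target g))
        (height u)))
    nonneg : height u ≤ 0# → 0# ≤ cross T (pos (target g) ⊝ pos u)
    nonneg (inj₁ h<0) = inj₁ (<-respʳ-≈ (sym (drop u)) (neg⇒0< h<0))
    nonneg (inj₂ h≈0) = inj₂ (sym (trans (drop u) (trans (-‿cong h≈0)
      (solve 0 (:- con (+ 0) := con (+ 0)) refl))))

  -- This term stands in for the missing winding at a boundary source: the side of e is what the ray
  -- based there adds to the intersection parity, and the side of the chord does not depend on the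
  -- move.
  incoming-from-source : ∀ {v e i} u → source e ≡ inj₁ i → target e ≡ inj₂ v → u ≢ inj₁ i →
    w (direction e) (pos u ⊝ pos (source e)) ≡
    left (side (direction e)) xor left (side (pos u ⊝ pos (source e)))
  incoming-from-source {v} {e} {i} u i→e e→v u≢i = HalfPlane.w-inward (T𝔩<0 v)
    (<-respˡ-≈ (sym (rise (target e))) (≡.subst (λ u → height u < 0#) (≡.sym e→v)
      (height-internal v)))
    (nonpos (height≤0 v u)) (not-parallel e)
    (λ _ → ≡.subst (λ s → ¬ Parallel 𝔩 (pos u ⊝ pos s)) (≡.sym i→e) (off-gauge-line v i u u≢i))
    where
    rise : ∀ u → cross T (pos u ⊝ pos (source e)) ≈ height u
    rise u = trans (cross-T-difference u (source e)) (combination (- 1#)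
      (≡.subst (λ u → height u ≈ 0#) (≡.sym i→e) (height-boundary i))
      (solve 2 (λ x y → y :- x :- y := :- con (+ 1) :* (x :- con (+ 0))) refl (height (source e))
        (height u)))
    nonpos : height u ≤ 0# → cross T (pos u ⊝ pos (source e)) ≤ 0#
    nonpos (inj₁ h<0) = inj₁ (<-respˡ-≈ (sym (rise u)) h<0)
    nonpos (inj₂ h≈0) = inj₂ (trans (rise u) h≈0)

-- Identities modulo 2, and the parity of integers

module XorIdentities where
  open xor-∧-Solver

  cancel-outer : ∀ s l l̃ → (s xor (l xor l̃)) xor l ≡ s xor l̃
  cancel-outer = solve 3 (λ s l l̃ → (s :+ (l :+ l̃)) :+ l := s :+ l̃) ≡.refl

  exchange : ∀ l l̃ b → l xor b ≡ (l̃ xor b) xor (l xor l̃)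
  exchange = solve 3 (λ l l̃ b → l :+ b := (l̃ :+ b) :+ (l :+ l̃)) ≡.refl

  rotate : ∀ l h s → (l xor h) xor s ≡ (s xor l) xor h
  rotate = solve 3 (λ l h s → (l :+ h) :+ s := (s :+ l) :+ h) ≡.refl

  separate : ∀ p a p̃ ã → p xor a ≡ p̃ xor ã → p xor p̃ ≡ a xor ã
  separate p a p̃ ã eq = ≡.trans (expand p a p̃)
    (≡.trans (≡.cong (_xor (p̃ xor a)) eq) (contract p̃ ã a))
    where
    expand : ∀ p a p̃ → p xor p̃ ≡ (p xor a) xor (p̃ xor a)
    expand = solve 3 (λ p a p̃ → p :+ p̃ := (p :+ a) :+ (p̃ :+ a)) ≡.refl
    contract : ∀ p̃ ã a → (p̃ xor ã) xor (p̃ xor a) ≡ a xor ã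
    contract = solve 3 (λ p̃ ã a → (p̃ :+ ã) :+ (p̃ :+ a) := a :+ ã) ≡.refl

  balance-through : ∀ a ã c c̃ i ĩ j j̃ →
    (((a xor (i xor j)) xor (ã xor (ĩ xor j̃))) xor ((c xor c̃) xor (j xor j̃)))
      xor ((i xor ĩ) xor ((a xor c) xor (ã xor c̃))) ≡ false
  balance-through = solve 8 (λ a ã c c̃ i ĩ j j̃ →
    (((a :+ (i :+ j)) :+ (ã :+ (ĩ :+ j̃))) :+ ((c :+ c̃) :+ (j :+ j̃)))
      :+ ((i :+ ĩ) :+ ((a :+ c) :+ (ã :+ c̃))) := con false) ≡.refl

  xor-shift : ∀ a b → (a xor b) xor (b xor a) ≡ false
  xor-shift = solve 2 (λ a b → (a :+ b) :+ (b :+ a) := con false) ≡.refl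

  absorb : ∀ s i ĩ → s xor i ≡ ĩ xor (s xor (i xor ĩ))
  absorb = solve 3 (λ s i ĩ → s :+ i := ĩ :+ (s :+ (i :+ ĩ))) ≡.refl

  isolate : ∀ s i ĩ → s xor (i xor ĩ) ≡ false → s xor i ≡ ĩ xor false
  isolate s i ĩ eq = ≡.trans (absorb s i ĩ) (≡.cong (ĩ xor_) eq)

  transfer : ∀ s s′ i m m̃ → (s xor s′) xor (i xor (m xor m̃)) ≡ false → (s xor i) xor m ≡ m̃ xor s′
  transfer s s′ i m m̃ eq = ≡.trans (expand s s′ i m m̃)
    (≡.trans (≡.cong ((m̃ xor s′) xor_) eq) (Bool.xor-identityʳ (m̃ xor s′)))
    where
    expand : ∀ s s′ i m m̃ → (s xor i) xor m ≡ (m̃ xor s′) xor ((s xor s′) xor (i xor (m xor m̃)))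
    expand = solve 5 (λ s s′ i m m̃ →
      (s :+ i) :+ m := (m̃ :+ s′) :+ ((s :+ s′) :+ (i :+ (m :+ m̃)))) ≡.refl

  swap-both : ∀ m̃ m ĩ i → ((m̃ xor m) xor ĩ) xor i ≡ (m xor m̃) xor (i xor ĩ)
  swap-both = solve 4 (λ m̃ m ĩ i → ((m̃ :+ m) :+ ĩ) :+ i := (m :+ m̃) :+ (i :+ ĩ)) ≡.refl

odd-+ : ∀ m n → odd (m ℕ.+ n) ≡ odd m xor odd n
odd-+ zero    n = ≡.refl
odd-+ (suc m) n = ≡.trans (≡.cong not (odd-+ m n)) (Bool.not-distribˡ-xor (odd m) (odd n))

odd-⊖ : ∀ m n → odd ∣ m ℤ.⊖ n ∣ ≡ odd m xor odd n
odd-⊖ m zero = ≡.sym (Bool.xor-identityʳ (odd m))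
odd-⊖ zero (suc n) = ≡.refl
odd-⊖ (suc m) (suc n) = ≡.trans (≡.cong (λ z → odd ∣ z ∣) (ℤ.[1+m]⊖[1+n]≡m⊖n m n))
  (≡.trans (odd-⊖ m n) (not-xor-not (odd m) (odd n)))
  where
  not-xor-not : ∀ a b → a xor b ≡ not a xor not b
  not-xor-not true  b = ≡.refl
  not-xor-not false b = ≡.sym (Bool.not-involutive b)

odd-∣+∣ : ∀ i j → odd ∣ i ℤ.+ j ∣ ≡ odd ∣ i ∣ xor odd ∣ j ∣
odd-∣+∣ (+ m)      (+ n)      = odd-+ m n
odd-∣+∣ (+ m)      -[1+ n ] = odd-⊖ m (suc n)
odd-∣+∣ -[1+ m ] (+ n)      = ≡.trans (odd-⊖ n (suc m)) (Bool.xor-comm (odd n) (odd (suc m)))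
odd-∣+∣ -[1+ m ] -[1+ n ] =
  ≡.trans (≡.cong (λ k → odd (suc k)) (≡.sym (ℕ.+-suc m n))) (odd-+ (suc m) (suc n))

odd-∣-∣ : ∀ i j → odd ∣ i ℤ.- j ∣ ≡ odd ∣ i ∣ xor odd ∣ j ∣
odd-∣-∣ i j = ≡.trans (odd-∣+∣ i (ℤ.- j)) (≡.cong (λ m → odd ∣ i ∣ xor odd m) (ℤ.∣-i∣≡∣i∣ j))

-- How the move changes the parities

module Move (ℝ : CompleteOrderedField) {disk : Plabic.Disk ℝ} {n} (N : Plabic.Network ℝ disk n)
  {V : Plabic.Network.Internal N} (μ : Plabic.VertexMove ℝ N V) {𝔩 : Plabic.Point ℝ}
  (γ : Plabic.IsGaugeDirection ℝ N 𝔩) (γ̃ : Plabic.IsGaugeDirection ℝ (Plabic.moved ℝ N μ) 𝔩) where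
  open Plabic ℝ
  open OrderedField ℝ
  open Continuity ℝ
  open Winding ℝ 𝔩
  open Rays ℝ 𝔩 using (w-sum)
  open Signs
  open Network N
  open VertexMove μ
  open Incidence graph

  Ñ : Network disk n
  Ñ = moved N μ

  private
    module Ñ = Network Ñ
    module γ = IsGaugeDirection γ
    module γ̃ = IsGaugeDirection γ̃
    module G = Gauge ℝ N γ
    module G̃ = Gauge ℝ Ñ γ̃
    module X = Embedding ℝ 𝔩 disk graph isEmbedding
    module Embeddingₜ (t : Carrier) (t∈I : InUnit t) = Embedding ℝ 𝔩 disk graph (embedded t t∈I)
    module XM = IsEmbedding isEmbedding

  posₜ : Carrier → Vertex → Point
  posₜ t = moveVertex N V (path t)

  pos-fixed : ∀ t {u} → u ≢ inj₂ V → posₜ t u ≡ pos u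
  pos-fixed t {inj₁ i} _   = ≡.refl
  pos-fixed t {inj₂ v} v≢V = updateAt-minimal v V (pos ∘ inj₂) (v≢V ∘ ≡.cong inj₂)

  pos-moving : ∀ t → posₜ t (inj₂ V) ≡ path t
  pos-moving t = updateAt-updates V (pos ∘ inj₂)

  -- The path starts at V only up to `≈ₚ`, whereas `posₜ 1#` is the final position by definition;
  -- hence the different treatment of the two ends of the move.
  pos-initial : ∀ u → posₜ 0# u ≈ₚ pos u
  pos-initial u with u ≟ᵛ inj₂ V
  ... | yes ≡.refl rewrite pos-moving 0# = initial
  ... | no u≢V rewrite pos-fixed 0# u≢V = refl , refl

  continuous-pos : ∀ u → Continuousₚ (λ t → posₜ t u)
  continuous-pos u with u ≟ᵛ inj₂ V
  ... | yes ≡.refl =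
    continuous-cong (λ t → reflexive (≡.cong proj₁ (≡.sym (pos-moving t))))
      (λ t t∈I ε 0<ε → Around-map proj₁ (continuous t t∈I ε 0<ε)) ,
    continuous-cong (λ t → reflexive (≡.cong proj₂ (≡.sym (pos-moving t))))
      (λ t t∈I ε 0<ε → Around-map proj₂ (continuous t t∈I ε 0<ε))
  ... | no u≢V =
    continuous-cong (λ t → reflexive (≡.cong proj₁ (≡.sym (pos-fixed t u≢V))))
      (continuous-const _) ,
    continuous-cong (λ t → reflexive (≡.cong proj₂ (≡.sym (pos-fixed t u≢V)))) (continuous-const _)

  displacement : Vertex → Vertex → Carrier → Point
  displacement u v t = posₜ t v ⊝ posₜ t u

  directionₜ : Edge → Carrier → Point
  directionₜ e = displacement (source e) (target e)

  displacement-fixed : ∀ t {u v} → u ≢ inj₂ V → v ≢ inj₂ V → displacement u v t ≡ pos v ⊝ pos u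
  displacement-fixed t u≢V v≢V = ≡.cong₂ _⊝_ (pos-fixed t v≢V) (pos-fixed t u≢V)

  continuous-direction : ∀ e → Continuousₚ (directionₜ e)
  continuous-direction e =
    continuous-+ (proj₁ (continuous-pos (target e)))
      (continuous-neg (proj₁ (continuous-pos (source e)))) ,
    continuous-+ (proj₂ (continuous-pos (target e)))
      (continuous-neg (proj₂ (continuous-pos (source e))))

  direction-initial : ∀ e → directionₜ e 0# ≈ₚ direction e
  direction-initial e with e₁ , e₂ ← pos-initial (target e) | e₁′ , e₂′ ← pos-initial (source e) =
    RayIntersection.sub-cong e₁ e₁′ , RayIntersection.sub-cong e₂ e₂′

  Fixed : Edge → Set
  Fixed e = source e ≢ inj₂ V × target e ≢ inj₂ V

  direction-fixed : ∀ t {e} → Fixed e → directionₜ e t ≡ direction e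
  direction-fixed t (s≢V , t≢V) = displacement-fixed t s≢V t≢V

  invariant-against-chord : ∀ m {f h} → Fixed f → ¬ (h ≈ₚ (0# , 0#)) →
    (∀ t → InUnit t → ¬ Opposed (directionₜ m t) (directionₜ f t)) →
    (∀ t → InUnit t → ¬ Opposed (directionₜ m t) h) →
    w (direction f) (direction m) xor w h (direction m) ≡
    w (direction f) (Ñ.direction m) xor w h (Ñ.direction m)
  invariant-against-chord m {f} {h} fixed h≉0 avoids-f avoids-h = ≡.trans
    (≡.sym (≡.cong₂ _xor_ (w-cong {direction f} (refl , refl) (direction-initial m))
                          (w-cong {h} (refl , refl) (direction-initial m))))
    (w-difference-invariant (continuous-direction m)
      (λ ∥ → γ.not-parallel m (trans (sym (cross-cong {𝔩} (refl , refl) (direction-initial m))) ∥))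
      (γ̃.not-parallel m) (γ.not-parallel f) h≉0
      (λ t t∈I opp → avoids-f t t∈I (≡.subst (Opposed (directionₜ m t))
        (≡.sym (direction-fixed t fixed)) opp))
      avoids-h)

  no-U-turn-from : ∀ t → InUnit t → ∀ {m f} → target m ≡ source f →
    ¬ Opposed (directionₜ m t) (directionₜ f t)
  no-U-turn-from t t∈I m→f (α , β , 0<α , 0≤β , eq) = Embeddingₜ.no-U-turn t t∈I m→f
    (inj₁ 0<α) 0≤β (<-respʳ-≈ (+-comm β α) (+-nonneg-pos 0≤β 0<α)) eq

  no-U-turn-into : ∀ t → InUnit t → ∀ {m f} → target f ≡ source m →
    ¬ Opposed (directionₜ m t) (directionₜ f t)
  no-U-turn-into t t∈I f→m (α , β , 0<α , 0≤β , e₁ , e₂) = Embeddingₜ.no-U-turn t t∈I f→m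
    0≤β (inj₁ 0<α) (+-nonneg-pos 0≤β 0<α) (trans (+-comm _ _) e₁ , trans (+-comm _ _) e₂)

  source≢V : ∀ {e} → target e ≡ inj₂ V → source e ≢ inj₂ V
  source≢V {e} e→V V→e = XM.no-loops e (≡.trans V→e (≡.sym e→V))

  target≢V : ∀ {e} → source e ≡ inj₂ V → target e ≢ inj₂ V
  target≢V {e} V→e e→V = XM.no-loops e (≡.trans V→e (≡.sym e→V))

  -- The far end of f is not V either, since f and g would form a 2-cycle.
  next-fixed : ∀ {g f} → source g ≡ inj₂ V → source f ≡ target g → Fixed f
  next-fixed V→g g→f = (λ V→f → target≢V V→g (≡.trans (≡.sym g→f) V→f)) ,
    λ f→V → X.no-2-cycle g→f (≡.trans f→V (≡.sym V→g))

  prev-fixed : ∀ {e f} → target e ≡ inj₂ V → target f ≡ source e → Fixed f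
  prev-fixed e→V f→e = (λ V→f → X.no-2-cycle (≡.trans V→f (≡.sym e→V)) f→e) ,
    λ f→V → source≢V e→V (≡.trans (≡.sym f→e) f→V)

  windNext-parity : (M : Network disk n) → ∀ e → Next (Network.graph M) e → Bool
  windNext-parity M e nx = odd ∣ windNext M 𝔩 e nx ∣

  windPrev-parity : (M : Network disk n) → ∀ e → Prev (Network.graph M) e → Bool
  windPrev-parity M e pv = odd ∣ windPrev M 𝔩 e pv ∣

  module Through {e g} (e→V : target e ≡ inj₂ V) (V→g : source g ≡ inj₂ V) where

    e→g : target e ≡ source g
    e→g = ≡.trans e→V (≡.sym V→g)

    h : Point
    h = pos (target g) ⊝ pos (source e)

    h-fixed : ∀ t → displacement (source e) (target g) t ≡ h
    h-fixed t = displacement-fixed t (source≢V e→V) (target≢V V→g)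

    pass-through : odd ∣ wind N 𝔩 e g ∣ ≡ w (direction e) h xor w h (direction g)
    pass-through = ≡.trans (G.odd-wind e g)
      (w-sum (X.chord-sum e→g) (γ.not-parallel e) (γ.not-parallel g))

    pass-through~ : odd ∣ wind Ñ 𝔩 e g ∣ ≡ w (Ñ.direction e) h xor w h (Ñ.direction g)
    pass-through~ = ≡.trans (G̃.odd-wind e g)
      (w-sum (≡.subst (λ h → Ñ.direction e ⊕ Ñ.direction g ≈ₚ h) (h-fixed 1#)
        (Embeddingₜ.chord-sum 1# 1∈I e→g)) (γ̃.not-parallel e) (γ̃.not-parallel g))

    outgoing-invariant : (nx : Next graph g) →
      windNext-parity N g nx xor w h (direction g) ≡ windNext-parity Ñ g nx xor w h (Ñ.direction g)
    outgoing-invariant (none i g→i) = ≡.trans (G.outgoing-to-sink (source e) V→g g→i)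
      (≡.sym (≡.subst (λ h → w h (Ñ.direction g) ≡ false) (h-fixed 1#)
        (G̃.outgoing-to-sink (source e) V→g g→i)))
    outgoing-invariant (edge f f∼g) = ≡.trans
      (≡.cong (_xor w h (direction g)) (≡.trans (G.odd-wind g f)
        (w-sym (direction g) (direction f))))
      (≡.trans (invariant-against-chord g fixed (X.chord≉0 e→g)
        (λ t t∈I → no-U-turn-from t t∈I {g} {f} (≡.sym f∼g))
        (λ t t∈I → ≡.subst (λ h → ¬ Opposed (directionₜ g t) h) (h-fixed t)
          (Embeddingₜ.outgoing-avoids-chord t t∈I e→g)))
      (≡.cong (_xor w h (Ñ.direction g)) (≡.sym (≡.trans (G̃.odd-wind g f)
        (≡.trans (≡.cong (w (Ñ.direction g)) (direction-fixed 1# fixed))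
          (w-sym (Ñ.direction g) (direction f)))))))
      where
      fixed : Fixed f
      fixed = next-fixed V→g f∼g

    int-parity int-parity~ : Bool
    int-parity  = odd (int N γ e) xor odd (int N γ g)
    int-parity~ = odd (int Ñ γ̃ e) xor odd (int Ñ γ̃ g)

    leftOf-fixed : ∀ i {u} → u ≢ inj₂ V → G̃.leftOf i u ≡ G.leftOf i u
    leftOf-fixed i u≢V = ≡.cong (λ d → left (side d)) (displacement-fixed 1# {inj₁ i} (λ ()) u≢V)

    int-parity-from-internal : ∀ {u} → source e ≡ inj₂ u → int-parity ≡ int-parity~
    int-parity-from-internal u→e = ≡.trans (G.odd-int-consecutive e→V V→g)
      (≡.trans (Xor.sum-cong-≗ λ i → ≡.cong (does (isBoundarySource? i) ∧_) (≡.cong₂ _xor_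
        (source-fixed i) (≡.sym (leftOf-fixed i (target≢V V→g)))))
      (≡.sym (G̃.odd-int-consecutive e→V V→g)))
      where
      source-fixed : ∀ i → G.leftOf-source i e ≡ G̃.leftOf-source i e
      source-fixed i with source e ≟ᵛ inj₁ i
      ... | yes i→e = contradiction (≡.trans (≡.sym u→e) i→e) λ ()
      ... | no _    = ≡.sym (leftOf-fixed i (source≢V e→V))

    -- Among the rays, only the one based at j gives a summand that sees the position of V, namely
    -- the side of V, which as seen from j is that of the direction of e.
    int-parity-from-source : ∀ {j} → source e ≡ inj₁ j →
      int-parity xor left (side (direction e)) ≡ int-parity~ xor left (side (Ñ.direction e))
    int-parity-from-source {j} j→e = ≡.trans (≡.cong (_xor L)
      (≡.trans (G.odd-int-consecutive e→V V→g)
      (≡.trans (Xor.sum-cong-≗ compare-at)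
      (≡.trans (Xor.∑-distrib-+ (λ i → does (isBoundarySource? i) ∧ F̃ i) _)
        (≡.cong₂ _xor_ (≡.sym (G̃.odd-int-consecutive e→V V→g)) (Xor.sum-delta j (L xor L̃)))))))
      (XorIdentities.cancel-outer int-parity~ L L̃)
      where
      L L̃ : Bool
      L = left (side (direction e))
      L̃ = left (side (Ñ.direction e))
      F F̃ : Fin n → Bool
      F i = G.leftOf-source i e xor G.leftOf i (target g)
      F̃ i = G̃.leftOf-source i e xor G̃.leftOf i (target g)
      compare-at : ∀ i → does (isBoundarySource? i) ∧ F i ≡
        (does (isBoundarySource? i) ∧ F̃ i) xor (if does (j Fin.≟ i) then L xor L̃ else false)
      compare-at i with j Fin.≟ i
      compare-at i | yes ≡.refl with source e ≟ᵛ inj₁ j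
      ... | no e≁j = contradiction j→e e≁j
      ... | yes _ rewrite dec-true (isBoundarySource? j) (e , j→e) = ≡.trans
        (≡.cong₂ _xor_ (≡.cong (λ u → left (side (pos (target e) ⊝ pos u))) (≡.sym j→e))
                       (≡.sym (leftOf-fixed j (target≢V V→g))))
        (≡.trans (XorIdentities.exchange L L̃ (G̃.leftOf j (target g)))
          (≡.cong (λ u → (left (side (posₜ 1# (target e) ⊝ posₜ 1# u)) 
            xor G̃.leftOf j (target g)) xor (L xor L̃)) j→e))
      compare-at i | no j≢i with source e ≟ᵛ inj₁ i
      ... | yes i→e = contradiction (Sum.inj₁-injective (≡.trans (≡.sym j→e) i→e)) j≢i
      ... | no _ = ≡.trans (≡.cong (does (isBoundarySource? i) ∧_) (≡.sym (≡.cong₂ _xor_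
        (leftOf-fixed i (source≢V e→V)) (leftOf-fixed i (target≢V V→g)))))
          (≡.sym (Bool.xor-identityʳ _))

    -- With a preceding edge, the windings and the intersection parity are invariant separately; at
    -- a boundary source their changes compensate. The sum covers both cases.
    incoming-invariant : (pv : Prev graph e) →
      windPrev-parity N e pv xor (w (direction e) h xor int-parity) ≡
      windPrev-parity Ñ e pv xor (w (Ñ.direction e) h xor int-parity~)
    incoming-invariant (none i i→e) = ≡.trans
      (≡.cong (_xor int-parity) (G.incoming-from-source (target g) i→e e→V g≢i))
      (≡.trans (XorIdentities.rotate (left (side (direction e))) (left (side h)) int-parity)
      (≡.trans (≡.cong (_xor left (side h)) (int-parity-from-source i→e))
      (≡.trans (≡.sym (XorIdentities.rotate (left (side (Ñ.direction e)))
        (left (side h)) int-parity~))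
        (≡.cong (_xor int-parity~) (≡.sym (≡.subst
          (λ h → w (Ñ.direction e) h ≡ left (side (Ñ.direction e)) xor left (side h)) (h-fixed 1#)
          (G̃.incoming-from-source (target g) i→e e→V g≢i)))))))
      where
      g≢i : target g ≢ inj₁ i
      g≢i = source≢sink i→e
    incoming-invariant (edge f f∼e) = ≡.trans
      (≡.sym (Bool.xor-assoc (windPrev-parity N e (edge f f∼e)) _ _))
      (≡.trans (≡.cong₂ _xor_ winds (from (source e) ≡.refl))
        (Bool.xor-assoc (windPrev-parity Ñ e (edge f f∼e)) _ _))
      where
      fixed : Fixed f
      fixed = prev-fixed e→V f∼e
      from : ∀ u → source e ≡ u → int-parity ≡ int-parity~
      from (inj₁ j) j→e = contradiction (≡.trans f∼e j→e) (source≢sink j→e)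
      from (inj₂ u) u→e = int-parity-from-internal u→e
      winds : windPrev-parity N e (edge f f∼e) xor w (direction e) h ≡
              windPrev-parity Ñ e (edge f f∼e) xor w (Ñ.direction e) h
      winds = ≡.trans (≡.cong₂ _xor_ (G.odd-wind f e) (w-sym (direction e) h))
        (≡.trans (invariant-against-chord e fixed (X.chord≉0 e→g)
          (λ t t∈I → no-U-turn-into t t∈I {e} {f} f∼e)
          (λ t t∈I → ≡.subst (λ h → ¬ Opposed (directionₜ e t) h) (h-fixed t)
            (Embeddingₜ.incoming-avoids-chord t t∈I e→g)))
        (≡.cong₂ _xor_ (≡.sym (≡.trans (G̃.odd-wind f e)
          (≡.cong (λ d → w d (Ñ.direction e)) (direction-fixed 1# fixed))))
            (w-sym h (Ñ.direction e))))

  Δint : Edge → Bool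
  Δint e = odd (int N γ e) xor odd (int Ñ γ̃ e)

  Δwind : Edge → Edge → Bool
  Δwind e f = odd ∣ wind N 𝔩 e f ∣ xor odd ∣ wind Ñ 𝔩 e f ∣

  Δnext : (g : Edge) → Next graph g → Bool
  Δnext g nx = windNext-parity N g nx xor windNext-parity Ñ g nx

  Δprev : (e : Edge) → Prev graph e → Bool
  Δprev e pv = windPrev-parity N e pv xor windPrev-parity Ñ e pv

  module _ {e g} (e→V : target e ≡ inj₂ V) (V→g : source g ≡ inj₂ V) where
    open Through e→V V→g

    -- The right-hand side is free of `nx`, which makes the claimed sign independent of the
    -- following edge chosen. `Δprev≡` does the same for the preceding edge.
    Δnext≡ : ∀ nx → Δnext g nx ≡ w h (direction g) xor w h (Ñ.direction g)
    Δnext≡ nx = XorIdentities.separate (windNext-parity N g nx) (w h (direction g))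
      (windNext-parity Ñ g nx) (w h (Ñ.direction g)) (outgoing-invariant nx)

    Δprev≡ : ∀ pv → Δprev e pv ≡
      (w (direction e) h xor int-parity) xor (w (Ñ.direction e) h xor int-parity~)
    Δprev≡ pv = XorIdentities.separate (windPrev-parity N e pv) (w (direction e) h xor int-parity)
      (windPrev-parity Ñ e pv) (w (Ñ.direction e) h xor int-parity~) (incoming-invariant pv)

    -- After substitution every parity occurs twice: the chord terms of `Δprev` and `Δnext` cancel
    -- against the two parts into which the chord splits the winding of e and g.
    Δ-through : ∀ pv nx → (Δprev e pv xor (Δnext g nx xor Δint g)) xor (Δint e xor Δwind e g)
      ≡ false
    Δ-through pv nx = ≡.trans
      (≡.cong₂ (λ (p , q) m → (p xor (q xor Δint g)) xor (Δint e xor m))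
        (≡.cong₂ _,_ (Δprev≡ pv) (Δnext≡ nx)) (≡.cong₂ _xor_ pass-through pass-through~))
      (XorIdentities.balance-through (w (direction e) h) (w (Ñ.direction e) h) (w h (direction g))
        (w h (Ñ.direction g))
        (odd (int N γ e)) (odd (int Ñ γ̃ e)) (odd (int N γ g)) (odd (int Ñ γ̃ g)))

  Δint-fixed : ∀ {e} → Fixed e → Δint e ≡ false
  Δint-fixed {e} (s≢V , t≢V) = ≡.trans (≡.cong (_xor odd (int Ñ γ̃ e)) (≡.trans (G.odd-int e)
    (≡.trans (Xor.sum-cong-≗ λ i → ≡.cong (does (isBoundarySource? i) ∧_)
      (same-meets (≡.sym (pos-fixed 1# s≢V)) (≡.sym (pos-fixed 1# t≢V)) (γ.not-parallel e)
        (γ̃.not-parallel e)))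
    (≡.sym (G̃.odd-int e))))) (Bool.xor-same (odd (int Ñ γ̃ e)))
    where
    same-meets : ∀ {b p p′ q q′} → p ≡ p′ → q ≡ q′ → (∦ : ¬ Parallel 𝔩 (q ⊝ p))
      (∦′ : ¬ Parallel 𝔩 (q′ ⊝ p′)) →
      does (rayMeets? b 𝔩 p q ∦) ≡ does (rayMeets? b 𝔩 p′ q′ ∦′)
    -- The two decisions contain different proofs that e is not parallel to 𝔩, but they decide the
    -- same proposition.
    same-meets {b} {p} {_} {q} ≡.refl ≡.refl ∦ ∦′ = does-≡ (rayMeets? b 𝔩 p q ∦)
      (rayMeets? b 𝔩 p q ∦′)

  Δwind-fixed : ∀ {e f} → Fixed e → Fixed f → Δwind e f ≡ false
  Δwind-fixed {e} {f} fixed-e fixed-f = ≡.trans (≡.cong (_xor odd ∣ wind Ñ 𝔩 e f ∣)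
    (≡.trans (G.odd-wind e f) (≡.trans
      (≡.sym (≡.cong₂ w (direction-fixed 1# fixed-e) (direction-fixed 1# fixed-f)))
      (≡.sym (G̃.odd-wind e f))))) (Bool.xor-same (odd ∣ wind Ñ 𝔩 e f ∣))

  module Gauged (e₀ g₀ : Edge) (e₀→V : target e₀ ≡ inj₂ V) (V→g₀ : source g₀ ≡ inj₂ V)
    (next : ∀ g → source g ≡ inj₂ V → Next graph g)
    (prev : ∀ e → target e ≡ inj₂ V → Prev graph e) where

    private
      pick : ∀ e → Dec (source e ≡ inj₂ V) → Dec (target e ≡ inj₂ V) → Bool
      pick e (yes V→e) _         = Δnext e (next e V→e) xor Δint e
      pick e (no _)    (yes e→V) = Δprev e (prev e e→V)
      pick e (no _)    (no _)    = false

    -- The claimed exponents modulo 2, extended by zero to the edges that do not touch V.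
    σ : Edge → Bool
    σ e = pick e (source e ≟ᵛ inj₂ V) (target e ≟ᵛ inj₂ V)

    σ-outgoing : ∀ {g} → source g ≡ inj₂ V → ∀ nx → σ g ≡ Δnext g nx xor Δint g
    σ-outgoing {g} V→g nx = picked (source g ≟ᵛ inj₂ V) (target g ≟ᵛ inj₂ V)
      where
      picked : ∀ s? t? → pick g s? t? ≡ Δnext g nx xor Δint g
      picked (yes V→g′) _ = ≡.cong (_xor Δint g)
        (≡.trans (Δnext≡ e₀→V V→g (next g V→g′)) (≡.sym (Δnext≡ e₀→V V→g nx)))
      picked (no V↛g) _ = contradiction V→g V↛g

    σ-incoming : ∀ {e} → target e ≡ inj₂ V → ∀ pv → σ e ≡ Δprev e pv
    σ-incoming {e} e→V pv = picked (source e ≟ᵛ inj₂ V) (target e ≟ᵛ inj₂ V)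
      where
      picked : ∀ s? t? → pick e s? t? ≡ Δprev e pv
      picked (yes V→e) _ = contradiction V→e (source≢V e→V)
      picked (no _) (yes e→V′) = ≡.trans (Δprev≡ e→V V→g₀ (prev e e→V′))
        (≡.sym (Δprev≡ e→V V→g₀ pv))
      picked (no _) (no e↛V) = contradiction e→V e↛V

    σ-fixed : ∀ {e} → Fixed e → σ e ≡ false
    σ-fixed {e} (V↛e , e↛V) = picked (source e ≟ᵛ inj₂ V) (target e ≟ᵛ inj₂ V)
      where
      picked : ∀ s? t? → pick e s? t? ≡ false
      picked (yes V→e) _ = contradiction V→e V↛e
      picked (no _) (yes e→V) = contradiction e→V e↛V
      picked (no _) (no _) = ≡.refl

    -- The condition under which multiplication by the signs turns the term of f in the equation of
    -- e into the corresponding term for the moved network.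
    σ-internal : ∀ {e f u} → target e ≡ inj₂ u → source f ≡ inj₂ u →
      (σ e xor σ f) xor (Δint e xor Δwind e f) ≡ false
    σ-internal {e} {f} {u} e→u u→f = by-position (target e ≟ᵛ inj₂ V) (source e ≟ᵛ inj₂ V)
      (target f ≟ᵛ inj₂ V)
      where
      f∼e : source f ≡ target e
      f∼e = ≡.trans u→f (≡.sym e→u)
      by-position : Dec (target e ≡ inj₂ V) → Dec (source e ≡ inj₂ V) → Dec (target f ≡ inj₂ V) →
        (σ e xor σ f) xor (Δint e xor Δwind e f) ≡ false
      by-position (yes e→V) _ _ = ≡.trans
        (≡.cong₂ (λ s s′ → (s xor s′) xor (Δint e xor Δwind e f))
          (σ-incoming e→V (prev e e→V)) (σ-outgoing V→f (next f V→f)))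
        (Δ-through e→V V→f (prev e e→V) (next f V→f))
        where
        V→f : source f ≡ inj₂ V
        V→f = ≡.trans f∼e e→V
      -- The edge following e is taken to be f, so that `σ e` contains the change of this very
      -- winding. In the next case e is likewise taken as the edge preceding f.
      by-position (no _) (yes V→e) _ = ≡.trans
        (≡.cong₂ (λ s s′ → (s xor s′) xor (Δint e xor Δwind e f))
          (σ-outgoing V→e (edge f f∼e)) (σ-fixed (next-fixed V→e f∼e)))
        (≡.trans (≡.cong (_xor (Δint e xor Δwind e f)) (Bool.xor-identityʳ (Δwind e f xor Δint e)))
          (XorIdentities.xor-shift (Δwind e f) (Δint e)))
      by-position (no e↛V) (no V↛e) (yes f→V) = ≡.trans
        (≡.cong₂ (λ s (s′ , i) → (s xor s′) xor (i xor Δwind e f)) (σ-fixed fixed)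
          (≡.cong₂ _,_ (σ-incoming f→V (edge e (≡.sym f∼e))) (Δint-fixed fixed)))
        (Bool.xor-same (Δwind e f))
        where
        fixed : Fixed e
        fixed = V↛e , e↛V
      by-position (no e↛V) (no V↛e) (no f↛V) =
        ≡.cong₂ (λ (s , s′) (i , m) → (s xor s′) xor (i xor m))
          (≡.cong₂ _,_ (σ-fixed fixed-e) (σ-fixed fixed-f))
          (≡.cong₂ _,_ (Δint-fixed fixed-e) (Δwind-fixed fixed-e fixed-f))
        where
        fixed-e : Fixed e
        fixed-e = V↛e , e↛V
        fixed-f : Fixed f
        fixed-f = (λ V→f → e↛V (≡.trans (≡.sym f∼e) V→f)) , f↛V

    σ-sink : ∀ {e j} → target e ≡ inj₁ j → σ e xor Δint e ≡ false
    σ-sink {e} {j} e→j = by-position (source e ≟ᵛ inj₂ V)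
      where
      by-position : Dec (source e ≡ inj₂ V) → σ e xor Δint e ≡ false
      -- There is no following edge, so the winding term is zero and `σ e` is the change of the
      -- intersection number alone.
      by-position (yes V→e) = ≡.trans (≡.cong (_xor Δint e) (σ-outgoing V→e (none j e→j)))
        (Bool.xor-same (Δint e))
      by-position (no V↛e) = ≡.cong₂ _xor_ (σ-fixed fixed) (Δint-fixed fixed)
        where
        fixed : Fixed e
        fixed = V↛e , λ e→V → inner (≡.trans (≡.sym e→j) e→V)
          where
          inner : inj₁ j ≢ inj₂ V
          inner ()

-- From parities to signs in the field

module Sign (ℝ : CompleteOrderedField) where
  open Plabic ℝ
  open OrderedField ℝ
  open import Algebra.Properties.Semiring.Exp semiring using (_^_)

  [-1]^ : Bool → Carrier
  [-1]^ false = 1#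
  [-1]^ true  = - 1#

  [-1]^-xor : ∀ a b → [-1]^ (a xor b) ≈ [-1]^ a * [-1]^ b
  [-1]^-xor false b     = sym (*-identityˡ _)
  [-1]^-xor true  false = sym (*-identityʳ _)
  [-1]^-xor true  true  = solve 0 (con (+ 1) := :- con (+ 1) :* :- con (+ 1)) refl

  ^-odd : ∀ m → (- 1#) ^ m ≈ [-1]^ (odd m)
  ^-odd zero    = refl
  ^-odd (suc m) = trans (*-congˡ (^-odd m)) (sym ([-1]^-xor true (odd m)))

  -1^-≈ : ∀ z {b} → odd ∣ z ∣ ≡ b → -1^ z ≈ [-1]^ b
  -1^-≈ z ≡.refl = ^-odd ∣ z ∣

  [-1]^-* : ∀ a b {c d x y z} → y ≈ [-1]^ b → z ≈ [-1]^ c → a xor b ≡ c xor d →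
    [-1]^ a * (y * x) ≈ z * ([-1]^ d * x)
  [-1]^-* a b {c} {d} {x} {y} {z} y≈ z≈ eq = trans (sym (*-assoc _ y x))
    (trans (*-congʳ signs) (*-assoc z _ x))
    where
    signs : [-1]^ a * y ≈ z * [-1]^ d
    signs = trans (*-congˡ y≈) (trans (sym ([-1]^-xor a b))
      (trans (reflexive (≡.cong [-1]^ eq)) (trans ([-1]^-xor c d) (*-congʳ (sym z≈)))))

  [-1]^-** : ∀ a b {c d} r {p q x y} → p ≈ [-1]^ b → q ≈ [-1]^ c → a xor b ≡ c xor d →
    y ≈ p * r * x → [-1]^ a * y ≈ q * r * ([-1]^ d * x)
  [-1]^-** a b {c} {d} r {p} {q} {x} p≈ q≈ eq y≈ = trans (*-congˡ (trans y≈ (*-assoc p r x)))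
    (trans ([-1]^-* a b {c} {d} p≈ q≈ eq) (rearrange q ([-1]^ d) r x))
    where
    rearrange : ∀ a b c x → a * (b * (c * x)) ≈ a * c * (b * x)
    rearrange = solve 4 (λ a b c x → a :* (b :* (c :* x)) := a :* c :* (b :* x)) refl

-- The edge vectors with changed signs solve the moved system

module Solution (ℝ : CompleteOrderedField) {disk : Plabic.Disk ℝ} {n} (N : Plabic.Network ℝ disk n)
  {V : Plabic.Network.Internal N} (μ : Plabic.VertexMove ℝ N V) {𝔩 : Plabic.Point ℝ}
  (γ : Plabic.IsGaugeDirection ℝ N 𝔩) (γ̃ : Plabic.IsGaugeDirection ℝ (Plabic.moved ℝ N μ) 𝔩) where
  open Plabic ℝ
  open OrderedField ℝ
  open Sign ℝ
  open Network N
  open Move ℝ N μ γ γ̃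
  open import Algebra.Properties.Semiring.Sum semiring using (sum; sum-cong-≋; *-distribˡ-sum)

  module Edges {E Ẽ : Edge → Vector Carrier n} (isE : IsEdgeVectors N γ E)
    (isẼ : IsEdgeVectors Ñ γ̃ Ẽ)
    (e₀ g₀ : Edge) (e₀→V : target e₀ ≡ inj₂ V) (V→g₀ : source g₀ ≡ inj₂ V)
    (next : ∀ g → source g ≡ inj₂ V → Next graph g)
    (prev : ∀ e → target e ≡ inj₂ V → Prev graph e) where
    open Gauged e₀ g₀ e₀→V V→g₀ next prev
    private
      module E = IsSolution (IsEdgeVectors.isSolution isE)

    signed : Edge → Vector Carrier n
    signed e k = [-1]^ (σ e) * E e k

    odd-int~ odd-int : Edge → Bool
    odd-int~ e = odd (int Ñ γ̃ e)
    odd-int  e = odd (int N γ e)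

    change-sign : ∀ e {d x y} → σ e xor odd-int e ≡ odd-int~ e xor d →
      y ≈ -1^ (+ int N γ e) * weight e * x →
      [-1]^ (σ e) * y ≈ -1^ (+ int Ñ γ̃ e) * weight e * ([-1]^ d * x)
    change-sign e {d} {x} {y} eq y≈ = [-1]^-** (σ e) (odd-int e) {odd-int~ e} {d}
      (weight e) {x = x} {y = y}
      (^-odd (int N γ e)) (^-odd (int Ñ γ̃ e)) eq y≈

    signed-isSolution : IsSolution Ñ γ̃ signed
    signed-isSolution = record { internal = internal′ ; sink = sink′ }
      where
      internal′ : ∀ e v → target e ≡ inj₂ v → ∀ k → signed e k ≈
        -1^ (+ int Ñ γ̃ e) * weight e *
          sum (λ f → if does (source f ≟ᵛ inj₂ v) then -1^ (wind Ñ 𝔩 e f) * signed f k else 0#)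
      internal′ e v e→v k = trans
        (change-sign e (XorIdentities.absorb (σ e) (odd-int e) (odd-int~ e)) (E.internal e v e→v k))
        (*-congˡ (trans (*-distribˡ-sum κ term)
          (sum-cong-≋ λ f → same-term f (source f ≟ᵛ inj₂ v))))
        where
        -- What is left of the sign of e once the change of its intersection number has gone into
        -- the new prefactor; the changes of winding have to account for the rest.
        κ : Carrier
        κ = [-1]^ (σ e xor Δint e)
        term : Edge → Carrier
        term f = if does (source f ≟ᵛ inj₂ v) then -1^ (wind N 𝔩 e f) * E f k else 0#
        same-term : ∀ f (s? : Dec (source f ≡ inj₂ v)) →
          κ * (if does s? then -1^ (wind N 𝔩 e f) * E f k else 0#) ≈
          (if does s? then -1^ (wind Ñ 𝔩 e f) * signed f k else 0#)
        same-term f (no _)    = zeroʳ κ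
        same-term f (yes v→f) = [-1]^-* (σ e xor Δint e) (odd ∣ wind N 𝔩 e f ∣)
          {odd ∣ wind Ñ 𝔩 e f ∣} {σ f} {E f k} (-1^-≈ (wind N 𝔩 e f) ≡.refl)
          (-1^-≈ (wind Ñ 𝔩 e f) ≡.refl)
          (XorIdentities.transfer (σ e) (σ f) (Δint e) (odd ∣ wind N 𝔩 e f ∣) (odd ∣ wind Ñ 𝔩 e f ∣)
            (σ-internal e→v v→f))
      sink′ : ∀ e j → target e ≡ inj₁ j → ∀ k →
        signed e k ≈ -1^ (+ int Ñ γ̃ e) * weight e * (if does (j Fin.≟ k) then 1# else 0#)
      sink′ e j e→j k = trans
        (change-sign e {false} (XorIdentities.isolate (σ e) (odd-int e) (odd-int~ e) (σ-sink e→j))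
          (E.sink e j e→j k))
        (*-congˡ (*-identityˡ _))

    signed-edge-vectors : ∀ e k → Ẽ e k ≈ [-1]^ (σ e) * E e k
    signed-edge-vectors e k = sym (IsEdgeVectors.unique isẼ signed signed-isSolution e k)

    fixed-edge : ∀ {e} → Fixed e → ∀ k → Ẽ e k ≈ E e k
    fixed-edge {e} fixed k = trans (signed-edge-vectors e k)
      (trans (*-congʳ (reflexive (≡.cong [-1]^ (σ-fixed fixed)))) (*-identityˡ _))

    outgoing-edge : ∀ {g} → source g ≡ inj₂ V → ∀ nx k → Ẽ g k ≈
      -1^ (windNext Ñ 𝔩 g nx ℤ.- windNext N 𝔩 g nx ℤ.+ + int Ñ γ̃ g ℤ.- + int N γ g) * E g k
    outgoing-edge {g} V→g nx k = exponent (windNext Ñ 𝔩 g nx) (windNext N 𝔩 g nx)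
      (int Ñ γ̃ g) (int N γ g) (σ-outgoing V→g nx) (signed-edge-vectors g k)
      where
      parity : ∀ m̃ m ĩ i → odd ∣ m̃ ℤ.- m ℤ.+ + ĩ ℤ.- + i ∣ ≡
        (odd ∣ m ∣ xor odd ∣ m̃ ∣) xor (odd i xor odd ĩ)
      parity m̃ m ĩ i = ≡.trans (odd-∣-∣ (m̃ ℤ.- m ℤ.+ + ĩ) (+ i)) (≡.trans
        (≡.cong (_xor odd i) (≡.trans (odd-∣+∣ (m̃ ℤ.- m) (+ ĩ))
          (≡.cong (_xor odd ĩ) (odd-∣-∣ m̃ m))))
        (XorIdentities.swap-both (odd ∣ m̃ ∣) (odd ∣ m ∣) (odd ĩ) (odd i)))
      exponent : ∀ m̃ m ĩ i {s x y} → s ≡ (odd ∣ m ∣ xor odd ∣ m̃ ∣) xor (odd i xor odd ĩ) →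
        y ≈ [-1]^ s * x → y ≈ -1^ (m̃ ℤ.- m ℤ.+ + ĩ ℤ.- + i) * x
      exponent m̃ m ĩ i eq y≈ = trans y≈ (*-congʳ (sym (-1^-≈ (m̃ ℤ.- m ℤ.+ + ĩ ℤ.- + i)
        (≡.trans (parity m̃ m ĩ i) (≡.sym eq)))))

    incoming-edge : ∀ {e} → target e ≡ inj₂ V → ∀ pv k → Ẽ e k ≈
      -1^ (windPrev Ñ 𝔩 e pv ℤ.- windPrev N 𝔩 e pv) * E e k
    incoming-edge {e} e→V pv k = trans (signed-edge-vectors e k) (*-congʳ (sym (-1^-≈
      (windPrev Ñ 𝔩 e pv ℤ.- windPrev N 𝔩 e pv)
      (≡.trans (odd-∣-∣ (windPrev Ñ 𝔩 e pv) (windPrev N 𝔩 e pv)) (≡.trans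
        (Bool.xor-comm (windPrev-parity Ñ e pv) (windPrev-parity N e pv))
        (≡.sym (σ-incoming e→V pv)))))))

lemma4p12 : (ℝ : CompleteOrderedField) →
    let open Plabic ℝ in
    (D : Disk) (n : ℕ) (N : Network D n) →
    let open Network N in
    (V : Internal) (μ : VertexMove N V) →
    let Ñ = moved N μ in
    (𝔩 : Point) (γ : IsGaugeDirection N 𝔩) (γ̃ : IsGaugeDirection Ñ 𝔩)
    (E Ẽ : Edge → Vector Carrier n) →
    IsEdgeVectors N γ E → IsEdgeVectors Ñ γ̃ Ẽ →
    degree (inj₂ V) ≡ 3 →
    ( colour V ≡ white →
    (e₁ e₂ e₃ : Edge) → e₁ ≢ e₂ →
    source e₁ ≡ inj₂ V → source e₂ ≡ inj₂ V → target e₃ ≡ inj₂ V →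
    (f₁ : Next graph e₁) (f₂ : Next graph e₂) (f₃ : Prev graph e₃) →
    (∀ e → e ≢ e₁ → e ≢ e₂ → e ≢ e₃ → ∀ k → Ẽ e k ≈ E e k)
    × (∀ k → Ẽ e₁ k ≈ (-1^ (windNext Ñ 𝔩 e₁ f₁ ℤ.- windNext N 𝔩 e₁ f₁ ℤ.+ + int Ñ γ̃ e₁ ℤ.- + int N γ e₁)) * E e₁ k)
    × (∀ k → Ẽ e₂ k ≈ (-1^ (windNext Ñ 𝔩 e₂ f₂ ℤ.- windNext N 𝔩 e₂ f₂ ℤ.+ + int Ñ γ̃ e₂ ℤ.- + int N γ e₂)) * E e₂ k)
    × (∀ k → Ẽ e₃ k ≈ (-1^ (windPrev Ñ 𝔩 e₃ f₃ ℤ.- windPrev N 𝔩 e₃ f₃)) * E e₃ k)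
    ) ×
    ( colour V ≡ black →
    (e₁ e₂ e₃ : Edge) → e₂ ≢ e₃ →
    source e₁ ≡ inj₂ V → target e₂ ≡ inj₂ V → target e₃ ≡ inj₂ V →
    (f₁ : Next graph e₁) (f₂ : Prev graph e₂) (f₃ : Prev graph e₃) →
    (∀ e → e ≢ e₁ → e ≢ e₂ → e ≢ e₃ → ∀ k → Ẽ e k ≈ E e k)
    × (∀ k → Ẽ e₁ k ≈ (-1^ (windNext Ñ 𝔩 e₁ f₁ ℤ.- windNext N 𝔩 e₁ f₁ ℤ.+ + int Ñ γ̃ e₁ ℤ.- + int N γ e₁)) * E e₁ k)
    × (∀ k → Ẽ e₂ k ≈ (-1^ (windPrev Ñ 𝔩 e₂ f₂ ℤ.- windPrev N 𝔩 e₂ f₂)) * E e₂ k)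
    × (∀ k → Ẽ e₃ k ≈ (-1^ (windPrev Ñ 𝔩 e₃ f₃ ℤ.- windPrev N 𝔩 e₃ f₃)) * E e₃ k)
    )
lemma4p12 ℝ D n N V μ 𝔩 γ γ̃ E Ẽ isE isẼ degree≡3 =
  -- Perfectness and degree 3 determine all edges at V, so an edge other than the three named ones
  -- has both ends fixed.
  (λ V-white e₁ e₂ e₃ e₁≢e₂ V→e₁ V→e₂ e₃→V f₁ f₂ f₃ →
    let open White V-white e₁≢e₂ V→e₁ V→e₂ e₃→V f₁ f₂ f₃ in
    (λ e e≢e₁ e≢e₂ e≢e₃ → fixed-edge
      ((λ V→e → [ e≢e₁ , e≢e₂ ] (outgoing V→e)) , (λ e→V → e≢e₃ (incoming e→V)))) ,
    outgoing-edge V→e₁ f₁ , outgoing-edge V→e₂ f₂ , incoming-edge e₃→V f₃) ,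
  (λ V-black e₁ e₂ e₃ e₂≢e₃ V→e₁ e₂→V e₃→V f₁ f₂ f₃ →
    let open Black V-black e₂≢e₃ V→e₁ e₂→V e₃→V f₁ f₂ f₃ in
    (λ e e≢e₁ e≢e₂ e≢e₃ → fixed-edge
      ((λ V→e → e≢e₁ (outgoing V→e)) , (λ e→V → [ e≢e₂ , e≢e₃ ] (incoming e→V)))) ,
    outgoing-edge V→e₁ f₁ , incoming-edge e₂→V f₂ , incoming-edge e₃→V f₃)
  where
  open Plabic.Network N
  open Solution ℝ N μ γ γ̃
  open Incidence graph

  module White {e₁ e₂ e₃} (V-white : colour V ≡ white) (e₁≢e₂ : e₁ ≢ e₂)
    (V→e₁ : source e₁ ≡ inj₂ V) (V→e₂ : source e₂ ≡ inj₂ V) (e₃→V : target e₃ ≡ inj₂ V)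
    (f₁ : Next graph e₁) (f₂ : Next graph e₂) (f₃ : Prev graph e₃) where

    indegree≡1 : indegree (inj₂ V) ≡ 1
    indegree≡1 = white-perfect V V-white

    outdegree≡2 : outdegree (inj₂ V) ≡ 2
    outdegree≡2 = ℕ.suc-injective (≡.subst (λ d → d ℕ.+ outdegree (inj₂ V) ≡ 3) indegree≡1 degree≡3)

    outgoing : ∀ {e} → source e ≡ inj₂ V → e ≡ e₁ ⊎ e ≡ e₂
    outgoing = only-two source (inj₂ V) outdegree≡2 e₁≢e₂ V→e₁ V→e₂

    incoming : ∀ {e} → target e ≡ inj₂ V → e ≡ e₃
    incoming = only-one target (inj₂ V) indegree≡1 e₃→V

    next : ∀ e → source e ≡ inj₂ V → Next graph e
    next e V→e = [ (λ { ≡.refl → f₁ }) , (λ { ≡.refl → f₂ }) ] (outgoing V→e)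

    prev : ∀ e → target e ≡ inj₂ V → Prev graph e
    prev e e→V = ≡.subst (Prev graph) (≡.sym (incoming e→V)) f₃

    -- Any incoming and outgoing edge at V may serve as the pair that provides the chords; `e₃` and
    -- `e₁` are one choice.
    open Edges isE isẼ e₃ e₁ e₃→V V→e₁ next prev public

  module Black {e₁ e₂ e₃} (V-black : colour V ≡ black) (e₂≢e₃ : e₂ ≢ e₃)
    (V→e₁ : source e₁ ≡ inj₂ V) (e₂→V : target e₂ ≡ inj₂ V) (e₃→V : target e₃ ≡ inj₂ V)
    (f₁ : Next graph e₁) (f₂ : Prev graph e₂) (f₃ : Prev graph e₃) where

    outdegree≡1 : outdegree (inj₂ V) ≡ 1
    outdegree≡1 = black-perfect V V-black

    indegree≡2 : indegree (inj₂ V) ≡ 2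
    indegree≡2 = ℕ.+-cancelʳ-≡ 1 _ 2 (≡.subst
      (λ d → indegree (inj₂ V) ℕ.+ d ≡ 3) outdegree≡1 degree≡3)

    outgoing : ∀ {e} → source e ≡ inj₂ V → e ≡ e₁
    outgoing = only-one source (inj₂ V) outdegree≡1 V→e₁

    incoming : ∀ {e} → target e ≡ inj₂ V → e ≡ e₂ ⊎ e ≡ e₃
    incoming = only-two target (inj₂ V) indegree≡2 e₂≢e₃ e₂→V e₃→V

    next : ∀ e → source e ≡ inj₂ V → Next graph e
    next e V→e = ≡.subst (Next graph) (≡.sym (outgoing V→e)) f₁

    prev : ∀ e → target e ≡ inj₂ V → Prev graph e
    prev e e→V = [ (λ { ≡.refl → f₂ }) , (λ { ≡.refl → f₃ }) ] (incoming e→V)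

    open Edges isE isẼ e₂ e₁ e₂→V V→e₁ next prev public
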